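{- Every $4$-Ore graph has at least four triangles. Moreover, a $4$-Ore graph $G$ has exactly four triangles if and only if $G$ is a $\mathrm{Pl}_{4,4f}$-graph.
   Context: All graphs are finite and simple. A graph is $4$-critical if it is not $3$-colorable but every proper subgraph is $3$-colorable. An Ore-composition $O(G_1,G_2)$ of vertex-disjoint graphs $G_1,G_2$ is obtained as follows: delete some edge $xy$ of $G_1$; split some vertex $z$ of $G_2$ into two new nonadjacent vertices $z_1,z_2$ of positive degree (i.e. remove $z$ and partition its neighbourhood into two nonempty parts, making $z_1$ adjacent to the first part and $z_2$ to the second); identify $x$ with $z_1$ and $y$ with $z_2$. A graph is $4$-Ore if it is obtained from a set of copies of $K_4$ by a sequence of Ore-compositions. A $\mathrm{Pl}_4$-graph is a planar $4$-critical graph with exactly four triangles; a $\mathrm{Pl}_{4,4f}$-graph is a $\mathrm{Pl}_4$-graph that has a plane drawing with no face of length $4$. -}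

module Defs where

open import Data.Nat using (ℕ; zero; suc; _+_; _*_; _≤_; _<_; _≤ᵇ_; _<ᵇ_)
open import Data.Bool using (Bool; true; false; _∧_; if_then_else_)
open import Data.Fin using (Fin; toℕ)
open import Data.List using (List; map; allFin; upTo)
open import Data.Nat.ListAction using (sum)
open import Data.Bool.ListAction using (all)
open import Data.Product using (Σ; ∃; _×_; _,_)
open import Data.Sum using (_⊎_)
open import Data.Empty using (⊥)
open import Relation.Nullary using (¬_)
open import Relation.Binary.PropositionalEquality using (_≡_; _≢_)
open import Function.Bundles using (_⇔_)

record Graph : Set where
  field
    n      : ℕ
    adj    : Fin n → Fin n → Bool
    sym    : ∀ u v → adj u v ≡ adj v u
    irrefl : ∀ u → adj u u ≡ false

open Graph public

triangles : Graph → ℕ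
triangles G =
  sum (map (λ i → sum (map (λ j → sum (map (λ k →
    if (toℕ i <ᵇ toℕ j) ∧ (toℕ j <ᵇ toℕ k)
         ∧ adj G i j ∧ adj G j k ∧ adj G i k
    then 1 else 0) (allFin (n G)))) (allFin (n G)))) (allFin (n G)))

IsK4 : Graph → Set
IsK4 G = Σ (n G ≡ 4) λ _ → ∀ u v → (adj G u v ≡ true) ⇔ (u ≢ v)

-- Ore-composition.  H is (isomorphic to) O(G₁,G₂): delete edge xy of G₁,
-- split z of G₂ into z₁ (adjacent to the nonempty part A of N(z)) and z₂
-- (adjacent to the nonempty rest), identify x = z₁ and y = z₂.
-- φ₁ embeds V(G₁) into V(H), φ₂ embeds V(G₂) ∖ {z} into V(H); together they
-- form a bijection onto V(H).

record OreComp (G₁ G₂ H : Graph) : Set where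
  field
    x y   : Fin (n G₁)
    xy    : adj G₁ x y ≡ true
    z     : Fin (n G₂)
    A     : Fin (n G₂) → Bool   -- on N(z): true = first part, false = second
    A-ne₁ : ∃ λ w → adj G₂ z w ≡ true × A w ≡ true
    A-ne₂ : ∃ λ w → adj G₂ z w ≡ true × A w ≡ false
    φ₁    : Fin (n G₁) → Fin (n H)
    φ₂    : Fin (n G₂) → Fin (n H)
    inj₁  : ∀ u u' → φ₁ u ≡ φ₁ u' → u ≡ u'
    inj₂  : ∀ w w' → w ≢ z → w' ≢ z → φ₂ w ≡ φ₂ w' → w ≡ w'
    disj  : ∀ u w → w ≢ z → φ₁ u ≢ φ₂ w
    cover : ∀ h → (∃ λ u → φ₁ u ≡ h) ⊎ (∃ λ w → w ≢ z × φ₂ w ≡ h)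
    adj₁  : ∀ u u' → (adj H (φ₁ u) (φ₁ u') ≡ true)
              ⇔ (adj G₁ u u' ≡ true × ¬ ((u ≡ x × u' ≡ y) ⊎ (u ≡ y × u' ≡ x)))
    adj₂  : ∀ w w' → w ≢ z → w' ≢ z → adj H (φ₂ w) (φ₂ w') ≡ adj G₂ w w'
    adj₁₂ : ∀ u w → w ≢ z → (adj H (φ₁ u) (φ₂ w) ≡ true)
              ⇔ (adj G₂ z w ≡ true × ((u ≡ x × A w ≡ true) ⊎ (u ≡ y × A w ≡ false)))

data Ore4 : Graph → Set where
  base : ∀ {G} → IsK4 G → Ore4 G
  comp : ∀ {G₁ G₂ H} → Ore4 G₁ → Ore4 G₂ → OreComp G₁ G₂ H → Ore4 H

Colorable3 : Graph → Set
Colorable3 G = ∃ λ (c : Fin (n G) → Fin 3) → ∀ u v → adj G u v ≡ true → c u ≢ c v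

record Subgraph (G : Graph) : Set where
  field
    S    : Fin (n G) → Bool
    F    : Fin (n G) → Fin (n G) → Bool
    F-sym : ∀ u v → F u v ≡ F v u
    F⊆E  : ∀ u v → F u v ≡ true → adj G u v ≡ true
    F⊆S  : ∀ u v → F u v ≡ true → S u ≡ true × S v ≡ true

Proper : {G : Graph} → Subgraph G → Set
Proper {G} s = (∃ λ v → Subgraph.S s v ≡ false)
             ⊎ (∃ λ u → ∃ λ v → adj G u v ≡ true × Subgraph.F s u v ≡ false)

-- A subgraph is 3-colourable iff its vertices (those in S) can be coloured
-- with 3 colours properly w.r.t. F; colouring all of Fin n is equivalent.
SubColorable3 : {G : Graph} → Subgraph G → Set
SubColorable3 {G} s =
  ∃ λ (c : Fin (n G) → Fin 3) → ∀ u v → Subgraph.F s u v ≡ true → c u ≢ c v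

Critical4 : Graph → Set
Critical4 G = ¬ Colorable3 G × (∀ (s : Subgraph G) → Proper s → SubColorable3 s)

data Reach (G : Graph) : Fin (n G) → Fin (n G) → Set where
  here : ∀ {u} → Reach G u u
  step : ∀ {u w v} → adj G u w ≡ true → Reach G w v → Reach G u v

Connected : Graph → Set
Connected G = ∀ u v → Reach G u v

-- Plane drawings, combinatorially: rotation systems of genus 0.
-- Darts d : Fin m are the oriented edges (tl d, hd d); rev reverses a dart;
-- rot is the rotation (a permutation cycling the darts at each vertex);
-- the faces are the orbits of the face permutation rot ∘ rev, and the
-- length of a face is the length of its orbit (its boundary walk).
-- For a connected graph, the embedding is plane iff V − E + F = 2.

iter : {A : Set} → (A → A) → ℕ → A → A
iter f zero    a = a
iter f (suc k) a = f (iter f k a)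

-- number of orbits of a map φ on Fin m (counting orbit minima);
-- a graph without darts (single vertex) has one face.
faceCount : (m : ℕ) → (Fin m → Fin m) → ℕ
faceCount zero    φ = 1
faceCount (suc m) φ =
  sum (map (λ d → if all (λ k → toℕ d ≤ᵇ toℕ (iter φ k d)) (upTo (suc m)) then 1 else 0)
           (allFin (suc m)))

record PlaneEmbedding (G : Graph) : Set where
  field
    m        : ℕ
    tl hd    : Fin m → Fin (n G)
    dart-adj : ∀ d → adj G (tl d) (hd d) ≡ true
    dart-inj : ∀ d d' → tl d ≡ tl d' → hd d ≡ hd d' → d ≡ d'
    dart-sur : ∀ u v → adj G u v ≡ true → ∃ λ d → tl d ≡ u × hd d ≡ v
    rev      : Fin m → Fin m
    rev-tl   : ∀ d → tl (rev d) ≡ hd d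
    rev-hd   : ∀ d → hd (rev d) ≡ tl d
    rot rot⁻¹ : Fin m → Fin m
    rot-inv₁ : ∀ d → rot (rot⁻¹ d) ≡ d
    rot-inv₂ : ∀ d → rot⁻¹ (rot d) ≡ d
    rot-tl   : ∀ d → tl (rot d) ≡ tl d
    rot-cyc  : ∀ d d' → tl d ≡ tl d' → ∃ λ k → iter rot k d ≡ d'
    euler    : 2 * n G + 2 * faceCount m (λ d → rot (rev d)) ≡ m + 4

  facePerm : Fin m → Fin m
  facePerm d = rot (rev d)

HasFace4 : {G : Graph} → PlaneEmbedding G → Set
HasFace4 E = ∃ λ d → iter φ 4 d ≡ d × (∀ k → 1 ≤ k → k < 4 → iter φ k d ≢ d)
  where φ = PlaneEmbedding.facePerm E

Planar : Graph → Set
Planar G = Connected G × PlaneEmbedding G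

Pl4 : Graph → Set
Pl4 G = Planar G × Critical4 G × triangles G ≡ 4

Pl44f : Graph → Set
Pl44f G = Pl4 G × (∃ λ (E : PlaneEmbedding G) → ¬ HasFace4 E)

{-# OPTIONS --safe #-}
module Submission where

-- Deleting the edge xy of a 4-Ore graph, or splitting a vertex z of it, leaves at least two triangles, so O(G₁,G₂)
-- has at least two in G₁ - xy and two in the split G₂.  If there are exactly four, both inequalities are tight.
-- As every edge of a 4-Ore graph lies in at most two triangles, G₁ then has four triangles, while the splitting of
-- G₂ breaks all but two.  By induction G₁ has a good drawing, and G₂ has one in which the two parts of N(z) are
-- consecutive around z; the split G₂ can be drawn in the face of G₁ - xy that contained xy, and the two faces
-- created have length at least (3 - 1) + 3 > 4.  The statement on split vertices needs in turn the one on two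
-- vertices whose splitting breaks all triangles, and then the induction closes.
--
-- For criticality, the induction is on a stronger property: if z is split into vertices of degree one and these
-- are precoloured, not all with the same colour, then the precolouring extends to a 3-colouring.

open import Defs hiding (sym)
open import Data.Bool using (Bool; true; false; _∧_; not; if_then_else_)
import Data.Bool.Properties as Bool
open import Data.Bool.ListAction using (all)
open import Data.Empty using (⊥)
open import Data.Fin using (Fin; zero; suc; toℕ; punchIn; punchOut)
open import Data.Fin.Patterns
import Data.Fin.Permutation as Permutation
import Data.Fin.Properties as Fin
open import Data.Fin.Properties using (all?; any?)
open import Data.List using (List; []; _∷_; _++_; [_]; map; length; filter; concatMap; allFin; upTo)
import Data.List.Properties as List
open import Data.List.Membership.Propositional using (_∈_; lose)
open import Data.List.Membership.Propositional.Properties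
open import Data.List.Relation.Unary.All as All using (All; []; _∷_)
import Data.List.Relation.Unary.All.Properties as All
open import Data.List.Relation.Unary.AllPairs using ([]; _∷_; allPairs?)
open import Data.List.Relation.Unary.Any using (here; there)
open import Data.List.Relation.Unary.Unique.Propositional using (Unique)
import Data.List.Relation.Unary.Unique.Propositional.Properties as Unique
open import Data.Nat using (ℕ; zero; suc; _+_; _*_; _∸_; _≤_; _<_; _≤ᵇ_; _<ᵇ_; z≤n; s≤s)
open import Data.Nat.Induction using (<-rec)
open import Data.Nat.ListAction using (sum)
import Data.Nat.Properties as ℕ
open import Data.Nat.Solver using (module +-*-Solver)
open import Data.Product using (Σ; ∃; _×_; _,_; proj₁; proj₂)
open import Data.Product.Properties using (≡-dec)
open import Data.Sum using (_⊎_; inj₁; inj₂; [_,_]′)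
open import Data.Sum.Function.Propositional using (_⊎-↔_)
import Data.Sum.Properties as Sum
open import Data.Unit using (⊤; tt)
open import Function using (_∘_; id)
open import Function.Bundles using (_⇔_; mk⇔; Equivalence; _↔_; mk↔ₛ′; Inverse)
open import Function.Construct.Composition using (_↔-∘_)
open import Function.Construct.Identity using (↔-id)
open import Function.Construct.Symmetry using (↔-sym)
open import Relation.Binary.Definitions using (DecidableEquality; tri<; tri≈; tri>)
open import Relation.Binary.PropositionalEquality using (_≡_; _≢_; refl; sym; trans; cong; cong₂; subst; subst₂; module ≡-Reasoning)
open import Relation.Nullary using (¬_; Dec; yes; no; contradiction)
open import Relation.Nullary.Decidable using (_⊎-dec_; _×-dec_; _→-dec_; ¬?; from-yes; decidable-stable)
open import Relation.Unary using (Decidable)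

-- Triangles

-- A vertex of a composition other than `x` and `y` lies in one part only. The triangles guaranteed
-- in the other part then use up the allowance, so that the bound passes to the parts. The obstacle
-- is a splitting at the merged vertex `x = z₁`, whose neighbours come from both parts. One triangle
-- of each part avoids this vertex, and a composite part would supply two; so both parts are K₄, the
-- vertex has degree three or four, and its rotation is inspected directly.
--
-- Gluing preserves genus 0 only if the two places where `G₂` is opened at `z` lie in different
-- faces; hence the demand that no face passes twice through a vertex.
--
-- Triangles are counted as ordered triples. So every guaranteed number is a multiple of 6, and "at
-- most four" reads "not 25 triples".

unique⊆⇒length≤ : {A : Set} {xs ys : List A} → Unique xs →
                  (∀ {x} → x ∈ xs → x ∈ ys) → length xs ≤ length ys
unique⊆⇒length≤ {xs = []} _ _ = z≤n
unique⊆⇒length≤ {xs = x ∷ xs} (x∉xs ∷ uxs) sub with ∈-∃++ (sub (here refl))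
... | as , bs , refl =
  subst (suc (length xs) ≤_) (sym (trans (List.length-++ as) (ℕ.+-suc _ _)))
    (s≤s (subst (length xs ≤_) (List.length-++ as) (unique⊆⇒length≤ uxs sub′)))
  where
  sub′ : ∀ {y} → y ∈ xs → y ∈ as ++ bs
  sub′ y∈ with ∈-++⁻ as (sub (there y∈))
  ... | inj₁ p = ∈-++⁺ˡ p
  ... | inj₂ (here refl) = contradiction refl (All.lookup x∉xs y∈)
  ... | inj₂ (there p) = ∈-++⁺ʳ as p

length-concatMap : {A B : Set} (f : A → List B) (xs : List A) →
                   length (concatMap f xs) ≡ sum (map (λ x → length (f x)) xs)
length-concatMap f [] = refl
length-concatMap f (x ∷ xs) =
  trans (List.length-++ (f x)) (cong (length (f x) +_) (length-concatMap f xs))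

-- A lower bound is witnessed by a list, so `P` need not be decidable; "at most k" is expressed as
-- `¬ AtLeast (suc k) P`.
AtLeast : {X : Set} → ℕ → (X → Set) → Set
AtLeast k P = ∃ λ L → Unique L × All P L × k ≤ length L

AtLeast-⇒ : {X : Set} {k : ℕ} {P Q : X → Set} → (∀ {x} → P x → Q x) → AtLeast k P → AtLeast k Q
AtLeast-⇒ f (L , u , a , l) = L , u , All.map f a , l

AtLeast-0 : {X : Set} {P : X → Set} → AtLeast 0 P
AtLeast-0 = [] , [] , [] , z≤n

AtLeast-weaken : {X : Set} {j k : ℕ} {P : X → Set} → j ≤ k → AtLeast k P → AtLeast j P
AtLeast-weaken j≤k (L , u , a , l) = L , u , a , ℕ.≤-trans j≤k l

AtLeast-+ : {X Y Z : Set} {j k : ℕ} {P : X → Set} {Q : Y → Set} {R : Z → Set}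
            (f : X → Z) (g : Y → Z) →
            (∀ {x x′} → f x ≡ f x′ → x ≡ x′) → (∀ {y y′} → g y ≡ g y′ → y ≡ y′) →
            (∀ {x y} → Q y → f x ≢ g y) →
            (∀ {x} → P x → R (f x)) → (∀ {y} → Q y → R (g y)) →
            AtLeast j P → AtLeast k Q → AtLeast (j + k) R
AtLeast-+ f g fi gi dis pf pg (L , u , a , l) (M , v , b , m) =
  map f L ++ map g M ,
  Unique.++⁺ (Unique.map⁺ fi u) (Unique.map⁺ gi v) dj ,
  All.++⁺ (All.map⁺ (All.map pf a)) (All.map⁺ (All.map pg b)) ,
  subst (_ ≤_) (sym (trans (List.length-++ (map f L))
                      (cong₂ _+_ (List.length-map f L) (List.length-map g M))))
    (ℕ.+-mono-≤ l m)
  where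
  dj : ∀ {z} → ¬ (z ∈ map f L × z ∈ map g M)
  dj (p , q) with ∈-map⁻ f p | ∈-map⁻ g q
  ... | x , _ , refl | y , y∈ , e = dis (All.lookup b y∈) e

length-filter-split : {X : Set} {P : X → Set} (P? : ∀ x → Dec (P x)) (L : List X) →
  length L ≡ length (filter P? L) + length (filter (λ x → ¬? (P? x)) L)
length-filter-split P? [] = refl
length-filter-split P? (x ∷ L) with P? x
... | yes _ = cong suc (length-filter-split P? L)
... | no _ = trans (cong suc (length-filter-split P? L)) (sym (ℕ.+-suc _ _))

Triple : Set → Set
Triple V = V × V × V

infix 4 _∈₃_

_∈₃_ : {V : Set} → V → Triple V → Set
a ∈₃ (u , v , w) = a ≡ u ⊎ a ≡ v ⊎ a ≡ w

map₃ : {V W : Set} → (V → W) → Triple V → Triple W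
map₃ f (u , v , w) = f u , f v , f w

pattern 1st e = inj₁ e
pattern 2nd e = inj₂ (inj₁ e)
pattern 3rd e = inj₂ (inj₂ e)

∈₃-map⁻ : {V W : Set} (f : V → W) (t : Triple V) {h : W} → h ∈₃ map₃ f t → ∃ λ a → a ∈₃ t × h ≡ f a
∈₃-map⁻ f (u , v , w) (1st e) = u , 1st refl , e
∈₃-map⁻ f (u , v , w) (2nd e) = v , 2nd refl , e
∈₃-map⁻ f (u , v , w) (3rd e) = w , 3rd refl , e

,-inj : {V : Set} {u v w u′ v′ w′ : V} → _≡_ {A = Triple V} (u , v , w) (u′ , v′ , w′) → u ≡ u′ × v ≡ v′ × w ≡ w′
,-inj refl = refl , refl , refl

Adj : (G : Graph) → Fin (n G) → Fin (n G) → Set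
Adj G u v = adj G u v ≡ true

Adj-sym : (G : Graph) {u v : Fin (n G)} → Adj G u v → Adj G v u
Adj-sym G {u} {v} a = trans (Graph.sym G v u) a

Adj-≢ : (G : Graph) {u v : Fin (n G)} → Adj G u v → u ≢ v
Adj-≢ G {u} a refl with trans (sym a) (irrefl G u)
... | ()

Adj? : (G : Graph) (u v : Fin (n G)) → Dec (Adj G u v)
Adj? G u v with adj G u v
... | true = yes refl
... | false = no λ ()

-- Triangles are ordered triples, so each one is counted six times.
Tri : (G : Graph) → Triple (Fin (n G)) → Set
Tri G (u , v , w) = Adj G u v × Adj G v w × Adj G u w

Tri-map : (G H : Graph) (f : Fin (n G) → Fin (n H)) (t : Triple (Fin (n G))) →
          (∀ {a b} → a ∈₃ t → b ∈₃ t → a ≢ b → Adj G a b → Adj H (f a) (f b)) → Tri G t → Tri H (map₃ f t)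
Tri-map G H f (u , v , w) h (uv , vw , uw) =
  h (1st refl) (2nd refl) (Adj-≢ G uv) uv ,
  h (2nd refl) (3rd refl) (Adj-≢ G vw) vw ,
  h (1st refl) (3rd refl) (Adj-≢ G uw) uw

shuffles : {V : Set} → List (Triple V → Triple V)
shuffles = (λ { (u , v , w) → u , v , w }) ∷ (λ { (u , v , w) → u , w , v }) ∷
           (λ { (u , v , w) → v , u , w }) ∷ (λ { (u , v , w) → v , w , u }) ∷
           (λ { (u , v , w) → w , u , v }) ∷ (λ { (u , v , w) → w , v , u }) ∷ []

shuffled : {V : Set} → List (Triple V) → List (Triple V)
shuffled L = concatMap (λ s → map s L) shuffles

length-shuffled : {V : Set} (L : List (Triple V)) → length (shuffled L) ≡ 6 * length L
length-shuffled L = trans (length-concatMap (λ s → map s L) shuffles) (aux shuffles)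
  where
  aux : ∀ ss → sum (map (λ s → length (map s L)) ss) ≡ length ss * length L
  aux [] = refl
  aux (s ∷ ss) = cong₂ _+_ (List.length-map s L) (aux ss)

∈-shuffled : {V : Set} {L : List (Triple V)} {s : Triple V → Triple V} {t : Triple V} →
             s ∈ shuffles → t ∈ L → s t ∈ shuffled L
∈-shuffled {L = L} {s} s∈ t∈ =
  ∈-concatMap⁺ (λ s → map s L) (lose s∈ (∈-map⁺ s t∈))

module _ (G : Graph) where

  increasing? : Fin (n G) → Fin (n G) → Fin (n G) → Bool
  increasing? i j k = (toℕ i <ᵇ toℕ j) ∧ (toℕ j <ᵇ toℕ k) ∧ adj G i j ∧ adj G j k ∧ adj G i k

  increasing : List (Triple (Fin (n G)))
  increasing = concatMap (λ i → concatMap (λ j → concatMap (λ k →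
    if increasing? i j k then [ (i , j , k) ] else []) (allFin (n G))) (allFin (n G))) (allFin (n G))

  length-increasing : length increasing ≡ triangles G
  length-increasing =
    trans (length-concatMap _ (allFin (n G)))
      (cong sum (List.map-cong (λ i → trans (length-concatMap _ (allFin (n G)))
        (cong sum (List.map-cong (λ j → trans (length-concatMap _ (allFin (n G)))
          (cong sum (List.map-cong (λ k → length-if (increasing? i j k)) (allFin (n G))))) (allFin (n G))))) (allFin (n G))))
    where
    length-if : (b : Bool) {t : Triple (Fin (n G))} → length (if b then [ t ] else []) ≡ (if b then 1 else 0)
    length-if true = refl
    length-if false = refl

  ∈-increasing : ∀ {i j k} → toℕ i < toℕ j → toℕ j < toℕ k → Tri G (i , j , k) → (i , j , k) ∈ increasing
  ∈-increasing {i} {j} {k} i<j j<k (ij , jk , ik) =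
    ∈-concatMap⁺ _ (lose (∈-allFin i) (∈-concatMap⁺ _ (lose (∈-allFin j) (∈-concatMap⁺ _ (lose (∈-allFin k)
      (subst (λ b → (i , j , k) ∈ (if b then [ (i , j , k) ] else [])) (sym test) (here refl)))))))
    where
    <ᵇ-true : ∀ {a b} → a < b → (a <ᵇ b) ≡ true
    <ᵇ-true p = Equivalence.to Bool.T-≡ (ℕ.<⇒<ᵇ p)
    test : increasing? i j k ≡ true
    test rewrite <ᵇ-true i<j | <ᵇ-true j<k | ij | jk | ik = refl

  ∈-shuffled-increasing : ∀ {t} → Tri G t → t ∈ shuffled increasing
  ∈-shuffled-increasing {u , v , w} (uv , vw , uw)
    with Fin.<-cmp u v | Fin.<-cmp v w | Fin.<-cmp u w
  ... | tri≈ _ e _ | _ | _ = contradiction e (Adj-≢ G uv)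
  ... | tri< _ _ _ | tri≈ _ e _ | _ = contradiction e (Adj-≢ G vw)
  ... | tri> _ _ _ | tri≈ _ e _ | _ = contradiction e (Adj-≢ G vw)
  ... | tri< _ _ _ | tri< _ _ _ | tri≈ _ e _ = contradiction e (Adj-≢ G uw)
  ... | tri< _ _ _ | tri> _ _ _ | tri≈ _ e _ = contradiction e (Adj-≢ G uw)
  ... | tri> _ _ _ | tri< _ _ _ | tri≈ _ e _ = contradiction e (Adj-≢ G uw)
  ... | tri> _ _ _ | tri> _ _ _ | tri≈ _ e _ = contradiction e (Adj-≢ G uw)
  ... | tri< a _ _ | tri< b _ _ | tri> _ _ c = contradiction (ℕ.<-trans a b) (ℕ.<-asym c)
  ... | tri> _ _ a | tri> _ _ b | tri< c _ _ = contradiction (ℕ.<-trans b a) (ℕ.<-asym c)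
  ... | tri< a _ _ | tri< b _ _ | tri< _ _ _ = ∈-shuffled (here refl) (∈-increasing a b (uv , vw , uw))
  ... | tri< a _ _ | tri> _ _ b | tri< c _ _ =
    ∈-shuffled (there (here refl)) (∈-increasing c b (uw , Adj-sym G vw , uv))
  ... | tri< a _ _ | tri> _ _ b | tri> _ _ c =
    ∈-shuffled (there (there (there (here refl)))) (∈-increasing c a (Adj-sym G uw , uv , Adj-sym G vw))
  ... | tri> _ _ a | tri< b _ _ | tri< c _ _ =
    ∈-shuffled (there (there (here refl))) (∈-increasing a c (Adj-sym G uv , uw , vw))
  ... | tri> _ _ a | tri< b _ _ | tri> _ _ c =
    ∈-shuffled (there (there (there (there (here refl))))) (∈-increasing b c (vw , Adj-sym G uw , Adj-sym G uv))
  ... | tri> _ _ a | tri> _ _ b | tri> _ _ c =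
    ∈-shuffled (there (there (there (there (there (here refl)))))) (∈-increasing b a (Adj-sym G vw , Adj-sym G uv , Adj-sym G uw))

  AtLeast-Tri⇒≤ : ∀ {k} → AtLeast k (Tri G) → k ≤ 6 * triangles G
  AtLeast-Tri⇒≤ {k} (L , u , a , k≤) = begin
    k                            ≤⟨ k≤ ⟩
    length L                     ≤⟨ unique⊆⇒length≤ u (λ x∈ → ∈-shuffled-increasing (All.lookup a x∈)) ⟩
    length (shuffled increasing) ≡⟨ length-shuffled increasing ⟩
    6 * length increasing        ≡⟨ cong (6 *_) length-increasing ⟩
    6 * triangles G              ∎
    where open ℕ.≤-Reasoning

  -- For adjacent `x` and `y`, a triangle through both contains the edge `xy`, so these are the
  -- triangles that survive its deletion.
  NoE : Fin (n G) → Fin (n G) → Triple (Fin (n G)) → Set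
  NoE x y t = ¬ (x ∈₃ t × y ∈₃ t)

  Avoid : Fin (n G) → Triple (Fin (n G)) → Set
  Avoid v t = ¬ v ∈₃ t

  -- The triangles that survive splitting z along A.
  Sp : Fin (n G) → (Fin (n G) → Bool) → Triple (Fin (n G)) → Set
  Sp z A t = z ∈₃ t → ∀ {a b} → a ∈₃ t → b ∈₃ t → a ≢ z → b ≢ z → A a ≡ A b

  ThinEdges : Set
  ThinEdges = ∀ {u v} → Adj G u v → (w₁ w₂ w₃ : Fin (n G)) →
    Adj G u w₁ × Adj G v w₁ → Adj G u w₂ × Adj G v w₂ → Adj G u w₃ × Adj G v w₃ →
    w₁ ≡ w₂ ⊎ w₁ ≡ w₃ ⊎ w₂ ≡ w₃

  infix 4 _∈₃?_
  _∈₃?_ : (a : Fin (n G)) (t : Triple (Fin (n G))) → Dec (a ∈₃ t)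
  a ∈₃? (u , v , w) = (a Fin.≟ u) ⊎-dec ((a Fin.≟ v) ⊎-dec (a Fin.≟ w))

  -- The triangles through `xy` are the reorderings of `(x , y , w)` for common neighbours `w`.
  -- There are at most two such `w`, which gives 6 * 2 = 12 triples. This turns a bound on `G - xy`
  -- into one on `G`.
  AtLeast-NoE : ThinEdges → ∀ {x y} → Adj G x y → ∀ {k} {K : Triple (Fin (n G)) → Set} →
    AtLeast (12 + k) (λ t → Tri G t × K t) → AtLeast k (λ t → Tri G t × NoE x y t × K t)
  AtLeast-NoE thin {x} {y} xy {k} (L , u , a , l) =
    filter (¬? ∘ P?) L ,
    Unique.filter⁺ (¬? ∘ P?) u ,
    All.tabulate good ,
    ℕ.+-cancelˡ-≤ 12 _ _ (ℕ.≤-trans l (subst (_≤ 12 + length (filter (¬? ∘ P?) L)) (sym (length-filter-split P? L))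
      (ℕ.+-monoˡ-≤ _ few)))
    where
    P? : ∀ t → Dec (x ∈₃ t × y ∈₃ t)
    P? t = (x ∈₃? t) ×-dec (y ∈₃? t)
    good : ∀ {t} → t ∈ filter (¬? ∘ P?) L → _
    good t∈ with ∈-filter⁻ (¬? ∘ P?) {xs = L} t∈
    ... | t∈L , np = proj₁ (All.lookup a t∈L) , np , proj₂ (All.lookup a t∈L)
    C? : ∀ w → Dec (Adj G x w × Adj G y w)
    C? w = Adj? G x w ×-dec Adj? G y w
    C : List (Fin (n G))
    C = filter C? (allFin (n G))
    short : (M : List (Fin (n G))) → Unique M → All (λ w → Adj G x w × Adj G y w) M → length M ≤ 2
    short [] _ _ = z≤n
    short (_ ∷ []) _ _ = s≤s z≤n
    short (_ ∷ _ ∷ []) _ _ = s≤s (s≤s z≤n)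
    short (a ∷ b ∷ c ∷ _) ((a≢b ∷ a≢c ∷ _) ∷ (b≢c ∷ _) ∷ _) (pa ∷ pb ∷ pc ∷ _) with thin xy a b c pa pb pc
    ... | 1st e = contradiction e a≢b
    ... | 2nd e = contradiction e a≢c
    ... | 3rd e = contradiction e b≢c
    ∈C : ∀ {w} → Adj G x w → Adj G y w → (x , y , w) ∈ map (λ w → x , y , w) C
    ∈C xw yw = ∈-map⁺ _ (∈-filter⁺ C? (∈-allFin _) (xw , yw))
    covered : ∀ {t} → Tri G t → x ∈₃ t × y ∈₃ t → t ∈ shuffled (map (λ w → x , y , w) C)
    covered (uv , vw , uw) (1st refl , 1st refl) = contradiction refl (Adj-≢ G xy)
    covered (uv , vw , uw) (1st refl , 2nd refl) = ∈-shuffled (here refl) (∈C uw vw)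
    covered (uv , vw , uw) (1st refl , 3rd refl) = ∈-shuffled (there (here refl)) (∈C uv (Adj-sym G vw))
    covered (uv , vw , uw) (2nd refl , 1st refl) = ∈-shuffled (there (there (here refl))) (∈C vw uw)
    covered (uv , vw , uw) (2nd refl , 2nd refl) = contradiction refl (Adj-≢ G xy)
    covered (uv , vw , uw) (2nd refl , 3rd refl) =
      ∈-shuffled (there (there (there (there (here refl))))) (∈C (Adj-sym G uv) (Adj-sym G uw))
    covered (uv , vw , uw) (3rd refl , 1st refl) =
      ∈-shuffled (there (there (there (here refl)))) (∈C (Adj-sym G vw) uv)
    covered (uv , vw , uw) (3rd refl , 2nd refl) =
      ∈-shuffled (there (there (there (there (there (here refl)))))) (∈C (Adj-sym G uw) (Adj-sym G uv))
    covered (uv , vw , uw) (3rd refl , 3rd refl) = contradiction refl (Adj-≢ G xy)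
    few : length (filter P? L) ≤ 12
    few = begin
      length (filter P? L)                        ≤⟨ unique⊆⇒length≤ (Unique.filter⁺ P? u)
                                                      (λ t∈ → let t∈L , p = ∈-filter⁻ P? {xs = L} t∈ in
                                                        covered (proj₁ (All.lookup a t∈L)) p) ⟩
      length (shuffled (map (λ w → x , y , w) C)) ≡⟨ length-shuffled (map (λ w → x , y , w) C) ⟩
      6 * length (map (λ w → x , y , w) C)        ≡⟨ cong (6 *_) (List.length-map (λ w → x , y , w) C) ⟩
      6 * length C                                ≤⟨ ℕ.*-monoʳ-≤ 6 (short C (Unique.filter⁺ C? (Unique.allFin⁺ _)) (All.all-filter C? (allFin _))) ⟩
      12                                          ∎
      where open ℕ.≤-Reasoning

-- The complete graph K₄

abstract
  fourth : (z c d : Fin 4) → z ≢ c → z ≢ d → c ≢ d →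
           ∃ λ e → (z ≢ e × c ≢ e × d ≢ e) × (∀ v → v ≡ z ⊎ v ≡ c ⊎ v ≡ d ⊎ v ≡ e)
  fourth = from-yes (all? {n = 4} λ z → all? λ c → all? λ d →
    ¬? (z Fin.≟ c) →-dec (¬? (z Fin.≟ d) →-dec (¬? (c Fin.≟ d) →-dec
      any? λ e → (¬? (z Fin.≟ e) ×-dec (¬? (c Fin.≟ e) ×-dec ¬? (d Fin.≟ e))) ×-dec
        all? λ v → (v Fin.≟ z) ⊎-dec ((v Fin.≟ c) ⊎-dec ((v Fin.≟ d) ⊎-dec (v Fin.≟ e))))))

-- Up to symmetry, distinct vertices of a K₄ may be taken to be 0, 1, 2; statements about `G` then
-- reduce to enumerations over `Fin 4`.
record Frame (G : Graph) (z c d : Fin (n G)) : Set where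
  field
    size : n G ≡ 4
    ν    : Fin 4 → Fin (n G)
    inj  : ∀ {i j} → ν i ≡ ν j → i ≡ j
    sur  : ∀ v → ∃ λ i → ν i ≡ v
    adj⁺ : ∀ {i j} → i ≢ j → Adj G (ν i) (ν j)
    ν₀   : ν 0F ≡ z
    ν₁   : ν 1F ≡ c
    ν₂   : ν 2F ≡ d

frame : (G : Graph) → IsK4 G → ∀ {z c d} → z ≢ c → z ≢ d → c ≢ d → Frame G z c d
frame record { n = .4 ; adj = a } (refl , k) {z} {c} {d} zc zd cd with fourth z c d zc zd cd
... | e , (ze , ce , de) , all = record
  { size = refl ; ν = ν ; inj = λ {i} {j} → inj i j ; sur = sur
  ; adj⁺ = λ {i} {j} ne → Equivalence.from (k (ν i) (ν j)) (λ eq → ne (inj i j eq))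
  ; ν₀ = refl ; ν₁ = refl ; ν₂ = refl }
  where
  ν : Fin 4 → Fin 4
  ν 0F = z
  ν 1F = c
  ν 2F = d
  ν 3F = e
  inj : ∀ i j → ν i ≡ ν j → i ≡ j
  inj 0F 0F _ = refl
  inj 0F 1F p = contradiction p zc
  inj 0F 2F p = contradiction p zd
  inj 0F 3F p = contradiction p ze
  inj 1F 0F p = contradiction (sym p) zc
  inj 1F 1F _ = refl
  inj 1F 2F p = contradiction p cd
  inj 1F 3F p = contradiction p ce
  inj 2F 0F p = contradiction (sym p) zd
  inj 2F 1F p = contradiction (sym p) cd
  inj 2F 2F _ = refl
  inj 2F 3F p = contradiction p de
  inj 3F 0F p = contradiction (sym p) ze
  inj 3F 1F p = contradiction (sym p) ce
  inj 3F 2F p = contradiction (sym p) de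
  inj 3F 3F _ = refl
  sur : ∀ v → ∃ λ i → ν i ≡ v
  sur v with all v
  ... | inj₁ p = 0F , sym p
  ... | inj₂ (inj₁ p) = 1F , sym p
  ... | inj₂ (inj₂ (inj₁ p)) = 2F , sym p
  ... | inj₂ (inj₂ (inj₂ p)) = 3F , sym p

frameAt : (G : Graph) → IsK4 G → (z : Fin (n G)) → ∃ λ c → ∃ λ d → Frame G z c d
frameAt G@record { n = .4 } K@(refl , _) z with others z
  where
  others : (z : Fin 4) → ∃ λ c → ∃ λ d → z ≢ c × z ≢ d × c ≢ d
  others = from-yes (all? {n = 4} λ z → any? λ c → any? λ d →
    ¬? (z Fin.≟ c) ×-dec (¬? (z Fin.≟ d) ×-dec ¬? (c Fin.≟ d)))
... | c , d , zc , zd , cd = c , d , frame G K zc zd cd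

frameAt₂ : (G : Graph) → IsK4 G → {z c : Fin (n G)} → z ≢ c → ∃ λ d → Frame G z c d
frameAt₂ G@record { n = .4 } K@(refl , _) {z} {c} zc with others z c zc
  where
  others : (z c : Fin 4) → z ≢ c → ∃ λ d → z ≢ d × c ≢ d
  others = from-yes (all? {n = 4} λ z → all? λ c → ¬? (z Fin.≟ c) →-dec any? λ d →
    ¬? (z Fin.≟ d) ×-dec ¬? (c Fin.≟ d))
... | d , zd , cd = d , frame G K zc zd cd

≟-triple : (s t : Triple (Fin 4)) → Dec (s ≡ t)
≟-triple = ≡-dec Fin._≟_ (≡-dec Fin._≟_ Fin._≟_)

Distinct : Triple (Fin 4) → Set
Distinct (i , j , k) = i ≢ j × j ≢ k × i ≢ k

Distinct? : ∀ t → Dec (Distinct t)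
Distinct? (i , j , k) = ¬? (i Fin.≟ j) ×-dec (¬? (j Fin.≟ k) ×-dec ¬? (i Fin.≟ k))

-- The triangle 123 avoids the vertex 0, the triangles 023 and 123 avoid the edge 01, and 012 and
-- 123 survive a splitting of 0 that leaves 1 and 2 on the same side.
shuffles-of-123 shuffles-of-012-and-123 shuffles-of-023-and-123 : List (Triple (Fin 4))
shuffles-of-123 = shuffled ((1F , 2F , 3F) ∷ [])
shuffles-of-012-and-123 = shuffled ((0F , 1F , 2F) ∷ (1F , 2F , 3F) ∷ [])
shuffles-of-023-and-123 = shuffled ((0F , 2F , 3F) ∷ (1F , 2F , 3F) ∷ [])

module _ (G : Graph) (K : IsK4 G) where

  private
    V : Set
    V = Fin (n G)

  module _ {z c d : V} (F : Frame G z c d) where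
    open Frame F

    frame-triangles : {P : Triple V → Set} (L : List (Triple (Fin 4))) → Unique L → All Distinct L →
      All (λ t → P (map₃ ν t)) L → AtLeast (length L) (λ t → Tri G t × P t)
    frame-triangles {P} L u dis ps =
      map (map₃ ν) L ,
      Unique.map⁺ (λ {s} {t} e → inj₃ s t e) u ,
      All.map⁺ (All.zipWith (λ {t} (p , q) → tri t p , q) (dis , ps)) ,
      ℕ.≤-reflexive (sym (List.length-map (map₃ ν) L))
      where
      inj₃ : ∀ s t → map₃ ν s ≡ map₃ ν t → s ≡ t
      inj₃ (_ , _ , _) (_ , _ , _) e with ,-inj e
      ... | p , q , r with inj p | inj q | inj r
      ... | refl | refl | refl = refl
      tri : ∀ t → Distinct t → Tri G (map₃ ν t)
      tri (_ , _ , _) (p , q , r) = adj⁺ p , adj⁺ q , adj⁺ r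

    ∈₃-ν⁻ : ∀ {i} (t : Triple (Fin 4)) → ν i ∈₃ map₃ ν t → i ∈₃ t
    ∈₃-ν⁻ (_ , _ , _) (1st e) = 1st (inj e)
    ∈₃-ν⁻ (_ , _ , _) (2nd e) = 2nd (inj e)
    ∈₃-ν⁻ (_ , _ , _) (3rd e) = 3rd (inj e)

  infix 4 _∈?_
  _∈?_ : (i : Fin 4) (t : Triple (Fin 4)) → Dec (i ∈₃ t)
  i ∈? (a , b , c) = (i Fin.≟ a) ⊎-dec ((i Fin.≟ b) ⊎-dec (i Fin.≟ c))

  K4-NoE : ∀ {x y} → Adj G x y → AtLeast 12 (λ t → Tri G t × NoE G x y t)
  K4-NoE {x} {y} xy with frameAt₂ G K (Adj-≢ G xy)
  ... | _ , F = frame-triangles F shuffles-of-023-and-123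
    (from-yes (allPairs? (λ s t → ¬? (≟-triple s t)) shuffles-of-023-and-123))
    (from-yes (All.all? Distinct? shuffles-of-023-and-123))
    (All.map (λ {t} np (p , q) → np (∈₃-ν⁻ F t (subst (_∈₃ map₃ ν t) (sym ν₀) p) , ∈₃-ν⁻ F t (subst (_∈₃ map₃ ν t) (sym ν₁) q)))
      (from-yes (All.all? (λ t → ¬? ((0F ∈? t) ×-dec (1F ∈? t))) shuffles-of-023-and-123)))
    where open Frame F

  K4-Avoid : ∀ v → AtLeast 6 (λ t → Tri G t × Avoid G v t)
  K4-Avoid v with frameAt G K v
  ... | _ , _ , F = frame-triangles F shuffles-of-123
    (from-yes (allPairs? (λ s t → ¬? (≟-triple s t)) shuffles-of-123))
    (from-yes (All.all? Distinct? shuffles-of-123))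
    (All.map (λ {t} np p → np (∈₃-ν⁻ F t (subst (_∈₃ map₃ ν t) (sym ν₀) p)))
      (from-yes (All.all? (λ t → ¬? (0F ∈? t)) shuffles-of-123)))
    where open Frame F

  -- Two of the three neighbours of z are on the same side of A.
  K4-Sp : ∀ z A → AtLeast 12 (λ t → Tri G t × Sp G z A t)
  K4-Sp z A = go (twins z A)
    where
    twins : ∀ z (A : V → Bool) → ∃ λ c → ∃ λ d → z ≢ c × z ≢ d × c ≢ d × A c ≡ A d
    twins z A with frameAt G K z
    ... | _ , _ , F = pick (A (ν 1F)) (A (ν 2F)) (A (ν 3F)) refl refl refl
      where
      open Frame F
      z≢ : ∀ {i} → 0F ≢ i → z ≢ ν i
      z≢ ne e = ne (inj (trans ν₀ e))
      pick : ∀ p q r → A (ν 1F) ≡ p → A (ν 2F) ≡ q → A (ν 3F) ≡ r → ∃ λ c → ∃ λ d → z ≢ c × z ≢ d × c ≢ d × A c ≡ A d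
      pick p q r ep eq er with p Bool.≟ q | p Bool.≟ r | q Bool.≟ r
      ... | yes e | _ | _ = ν 1F , ν 2F , z≢ (λ ()) , z≢ (λ ()) , (λ h → contradiction (inj h) λ ()) , trans ep (trans e (sym eq))
      ... | no _ | yes e | _ = ν 1F , ν 3F , z≢ (λ ()) , z≢ (λ ()) , (λ h → contradiction (inj h) λ ()) , trans ep (trans e (sym er))
      ... | no _ | no _ | yes e = ν 2F , ν 3F , z≢ (λ ()) , z≢ (λ ()) , (λ h → contradiction (inj h) λ ()) , trans eq (trans e (sym er))
      ... | no a | no b | no c = contradiction (three p q r a b) c
        where
        three : ∀ p q r → p ≢ q → p ≢ r → q ≡ r
        three true true _ a _ = contradiction refl a
        three true false true _ b = contradiction refl b
        three true false false _ _ = refl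
        three false false _ a _ = contradiction refl a
        three false true false _ b = contradiction refl b
        three false true true _ _ = refl
    go : (∃ λ c → ∃ λ d → z ≢ c × z ≢ d × c ≢ d × A c ≡ A d) → AtLeast 12 (λ t → Tri G t × Sp G z A t)
    go (c , d , zc , zd , cd , Acd) = frame-triangles F shuffles-of-012-and-123
      (from-yes (allPairs? (λ s t → ¬? (≟-triple s t)) shuffles-of-012-and-123))
      (from-yes (All.all? Distinct? shuffles-of-012-and-123))
      (All.map good (from-yes (All.all? (λ t → (0F ∈? t) →-dec (all? λ i → (i ∈? t) →-dec (¬? (i Fin.≟ 0F) →-dec ((i Fin.≟ 1F) ⊎-dec (i Fin.≟ 2F))))) shuffles-of-012-and-123)))
      where
      F = frame G K zc zd cd
      open Frame F
      good : ∀ {t} → (0F ∈₃ t → ∀ i → i ∈₃ t → i ≢ 0F → i ≡ 1F ⊎ i ≡ 2F) → Sp G z A (map₃ ν t)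
      good {t} h z∈ a∈ b∈ a≢z b≢z = trans (val a∈ a≢z) (sym (val b∈ b≢z))
        where
        val : ∀ {a} → a ∈₃ map₃ ν t → a ≢ z → A a ≡ A c
        val {a} a∈ a≢ with ∈₃-map⁻ ν t a∈
        ... | i , i∈ , refl with h (∈₃-ν⁻ F t (subst (_∈₃ map₃ ν t) (sym ν₀) z∈)) i i∈ (λ e → a≢ (trans (cong ν e) ν₀))
        ... | inj₁ refl = cong A ν₁
        ... | inj₂ refl = trans (cong A ν₂) (sym Acd)

  K4-thin : ThinEdges G
  K4-thin {u} {v} uv a b c (ua , va) (ub , vb) (uc , vc) with frameAt₂ G K (Adj-≢ G uv)
  ... | _ , F = go
    where
    open Frame F
    class : ∀ {w} → Adj G u w → Adj G v w → w ≡ ν 2F ⊎ w ≡ ν 3F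
    class {w} uw vw with sur w
    ... | 0F , refl = contradiction (sym ν₀) (Adj-≢ G uw)
    ... | 1F , refl = contradiction (sym ν₁) (Adj-≢ G vw)
    ... | 2F , refl = inj₁ refl
    ... | 3F , refl = inj₂ refl
    go : a ≡ b ⊎ a ≡ c ⊎ b ≡ c
    go with class ua va | class ub vb | class uc vc
    ... | inj₁ p | inj₁ q | _ = 1st (trans p (sym q))
    ... | inj₂ p | inj₂ q | _ = 1st (trans p (sym q))
    ... | inj₁ p | inj₂ _ | inj₁ r = 2nd (trans p (sym r))
    ... | inj₂ p | inj₁ _ | inj₂ r = 2nd (trans p (sym r))
    ... | inj₁ _ | inj₂ q | inj₂ r = 3rd (trans q (sym r))
    ... | inj₂ _ | inj₁ q | inj₁ r = 3rd (trans q (sym r))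

-- Ore-compositions and lower bounds on triangles

-- The roles of `x` and `y` are symmetric once `A` is complemented, so what is proved at `x` also
-- holds at `y`.
swapOre : ∀ {G₁ G₂ H} → OreComp G₁ G₂ H → OreComp G₁ G₂ H
swapOre {G₁} {G₂} {H} C = record
  { x = y ; y = x ; xy = Adj-sym G₁ xy ; z = z ; A = not ∘ A
  ; A-ne₁ = let w , zw , e = A-ne₂ in w , zw , cong not e
  ; A-ne₂ = let w , zw , e = A-ne₁ in w , zw , cong not e
  ; φ₁ = φ₁ ; φ₂ = φ₂ ; inj₁ = inj₁′ ; inj₂ = inj₂′ ; disj = disj ; cover = cover
  ; adj₁ = λ u u′ → mk⇔
      (λ a → let g , ne = Equivalence.to (adj₁ u u′) a in g , ne ∘ [ inj₂ , inj₁ ]′)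
      (λ { (g , ne) → Equivalence.from (adj₁ u u′) (g , ne ∘ [ inj₂ , inj₁ ]′) })
  ; adj₂ = adj₂
  ; adj₁₂ = λ u w w≢z → mk⇔
      (λ a → let g , s = Equivalence.to (adj₁₂ u w w≢z) a in g ,
        [ (λ { (e , aw) → inj₂ (e , cong not aw) }) , (λ { (e , aw) → inj₁ (e , cong not aw) }) ]′ s)
      (λ { (g , s) → Equivalence.from (adj₁₂ u w w≢z) (g ,
        [ (λ { (e , aw) → inj₂ (e , Bool.not-injective aw) }) , (λ { (e , aw) → inj₁ (e , Bool.not-injective aw) }) ]′ s) })
  }
  where
  open OreComp C renaming (inj₁ to inj₁′; inj₂ to inj₂′)

module Comp {G₁ G₂ H : Graph} (C : OreComp G₁ G₂ H) where

  open OreComp C renaming (inj₁ to φ₁-inj; inj₂ to φ₂-inj) public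

  x≢y : x ≢ y
  x≢y = Adj-≢ G₁ xy

  end : Bool → Fin (n G₁)
  end true = x
  end false = y

  end-inj : ∀ {b c} → end b ≡ end c → b ≡ c
  end-inj {true} {true} _ = refl
  end-inj {true} {false} e = contradiction e x≢y
  end-inj {false} {true} e = contradiction (sym e) x≢y
  end-inj {false} {false} _ = refl

  -- ψ true and ψ false identify z with z₁ = x and z₂ = y, respectively.
  ψ : Bool → Fin (n G₂) → Fin (n H)
  ψ b w with w Fin.≟ z
  ... | yes _ = φ₁ (end b)
  ... | no _ = φ₂ w

  ψ-z : ∀ b → ψ b z ≡ φ₁ (end b)
  ψ-z b with z Fin.≟ z
  ... | yes _ = refl
  ... | no ne = contradiction refl ne

  ψ-φ₂ : ∀ {b w} → w ≢ z → ψ b w ≡ φ₂ w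
  ψ-φ₂ {b} {w} ne with w Fin.≟ z
  ... | yes e = contradiction e ne
  ... | no _ = refl

  ψ-indep : ∀ {b c w} → w ≢ z → ψ b w ≡ ψ c w
  ψ-indep ne = trans (ψ-φ₂ ne) (sym (ψ-φ₂ ne))

  ψ≡φ₁ : ∀ {b w u} → ψ b w ≡ φ₁ u → w ≡ z × u ≡ end b
  ψ≡φ₁ {b} {w} {u} e with w Fin.≟ z
  ... | yes p = p , sym (φ₁-inj _ _ e)
  ... | no ne = contradiction (sym e) (disj u w ne)

  ψ≡φ₂ : ∀ {b w w′} → w′ ≢ z → ψ b w ≡ φ₂ w′ → w ≡ w′
  ψ≡φ₂ {b} {w} {w′} ne e with w Fin.≟ z
  ... | yes p = contradiction e (disj _ w′ ne)
  ... | no nw = φ₂-inj _ _ nw ne e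

  ψ-inj : ∀ {b c w w′} → ψ b w ≡ ψ c w′ → w ≡ w′
  ψ-inj {b} {c} {w} {w′} e with w′ Fin.≟ z
  ... | yes refl = proj₁ (ψ≡φ₁ {b} {w} e)
  ... | no ne = ψ≡φ₂ {b} {w} ne e

  data VertexView : Fin (n H) → Set where
    one : ∀ u → VertexView (φ₁ u)
    two : ∀ w → w ≢ z → VertexView (φ₂ w)

  view : ∀ h → VertexView h
  view h with cover h
  ... | inj₁ (u , refl) = one u
  ... | inj₂ (w , ne , refl) = two w ne

  IsXY : Fin (n G₁) → Fin (n G₁) → Set
  IsXY u u′ = (u ≡ x × u′ ≡ y) ⊎ (u ≡ y × u′ ≡ x)

  IsXY? : ∀ u u′ → Dec (IsXY u u′)
  IsXY? u u′ = ((u Fin.≟ x) ×-dec (u′ Fin.≟ y)) ⊎-dec ((u Fin.≟ y) ×-dec (u′ Fin.≟ x))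

  φ₁-adj⁺ : ∀ {u u′} → Adj G₁ u u′ → ¬ IsXY u u′ → Adj H (φ₁ u) (φ₁ u′)
  φ₁-adj⁺ a ne = Equivalence.from (adj₁ _ _) (a , ne)

  φ₁-adj⁻ : ∀ {u u′} → Adj H (φ₁ u) (φ₁ u′) → Adj G₁ u u′ × ¬ IsXY u u′
  φ₁-adj⁻ = Equivalence.to (adj₁ _ _)

  φ₁₂-adj⁺ : ∀ {w} → Adj G₂ z w → Adj H (φ₁ (end (A w))) (φ₂ w)
  φ₁₂-adj⁺ {w} zw = Equivalence.from (adj₁₂ _ w (λ e → Adj-≢ G₂ zw (sym e))) (zw , sides (A w) refl)
    where
    sides : ∀ b → A w ≡ b → (end b ≡ x × A w ≡ true) ⊎ (end b ≡ y × A w ≡ false)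
    sides true e = inj₁ (refl , e)
    sides false e = inj₂ (refl , e)

  φ₁₂-adj⁻ : ∀ {u w} → w ≢ z → Adj H (φ₁ u) (φ₂ w) → Adj G₂ z w × u ≡ end (A w)
  φ₁₂-adj⁻ {u} {w} ne a with Equivalence.to (adj₁₂ u w ne) a
  ... | zw , inj₁ (refl , e) = zw , cong end (sym e)
  ... | zw , inj₂ (refl , e) = zw , cong end (sym e)

  -- Only the image of `z` depends on the side, and for an edge at `z` the side is that of its other
  -- end. Taking the side from the other end in both places covers all edges uniformly.
  ψ-adj⁺ : ∀ {w w′} → Adj G₂ w w′ → Adj H (ψ (A w′) w) (ψ (A w) w′)
  ψ-adj⁺ {w} {w′} a = go (w Fin.≟ z) (w′ Fin.≟ z)
    where
    go : Dec (w ≡ z) → Dec (w′ ≡ z) → Adj H (ψ (A w′) w) (ψ (A w) w′)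
    go (yes refl) (yes refl) = contradiction refl (Adj-≢ G₂ a)
    go (yes refl) (no n′) = subst₂ (Adj H) (sym (ψ-z _)) (sym (ψ-φ₂ n′)) (φ₁₂-adj⁺ a)
    go (no n₀) (yes refl) = subst₂ (Adj H) (sym (ψ-φ₂ n₀)) (sym (ψ-z _)) (Adj-sym H (φ₁₂-adj⁺ (Adj-sym G₂ a)))
    go (no n₀) (no n′) = subst₂ (Adj H) (sym (ψ-φ₂ n₀)) (sym (ψ-φ₂ n′)) (trans (adj₂ _ _ n₀ n′) a)

  ends-nonadjacent : ∀ b c → ¬ Adj H (φ₁ (end b)) (φ₁ (end c))
  ends-nonadjacent true true a = Adj-≢ H a refl
  ends-nonadjacent true false a = proj₂ (φ₁-adj⁻ a) (inj₁ (refl , refl))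
  ends-nonadjacent false true a = proj₂ (φ₁-adj⁻ a) (inj₂ (refl , refl))
  ends-nonadjacent false false a = Adj-≢ H a refl

  ψ-adj⁻ : ∀ {b c w w′} → Adj H (ψ b w) (ψ c w′) → Adj G₂ w w′
  ψ-adj⁻ {b} {c} {w} {w′} = go (w Fin.≟ z) (w′ Fin.≟ z)
    where
    go : Dec (w ≡ z) → Dec (w′ ≡ z) → Adj H (ψ b w) (ψ c w′) → Adj G₂ w w′
    go (yes refl) (yes refl) a = contradiction (subst₂ (Adj H) (ψ-z b) (ψ-z c) a) (ends-nonadjacent b c)
    go (yes refl) (no n′) a = proj₁ (φ₁₂-adj⁻ n′ (subst₂ (Adj H) (ψ-z b) (ψ-φ₂ n′) a))
    go (no n₀) (yes refl) a = Adj-sym G₂ (proj₁ (φ₁₂-adj⁻ n₀ (Adj-sym H (subst₂ (Adj H) (ψ-φ₂ n₀) (ψ-z c) a))))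
    go (no n₀) (no n′) a = trans (sym (adj₂ _ _ n₀ n′)) (subst₂ (Adj H) (ψ-φ₂ n₀) (ψ-φ₂ n′) a)

  φ₂-neighbour : ∀ {w h} → w ≢ z → Adj H (φ₂ w) h → ∃ λ w′ → h ≡ ψ (A w) w′ × Adj G₂ w w′
  φ₂-neighbour {w} {h} ne a with view h
  ... | one u = let zw , e = φ₁₂-adj⁻ ne (Adj-sym H a) in z , trans (cong φ₁ e) (sym (ψ-z (A w))) , Adj-sym G₂ zw
  ... | two w′ n′ = w′ , sym (ψ-φ₂ n′) , trans (sym (adj₂ _ _ ne n′)) a

  -- All neighbours of `φ₂ w` are values of the single map `ψ (A w)`, so an edge at `φ₂ w` and all
  -- its triangles pull back to `G₂` together.
  thin₂ : ThinEdges G₂ → ∀ {w h′} → w ≢ z → Adj H (φ₂ w) h′ → ∀ a b c → Adj H (φ₂ w) a → Adj H h′ a → Adj H (φ₂ w) b → Adj H h′ b →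
          Adj H (φ₂ w) c → Adj H h′ c → a ≡ b ⊎ a ≡ c ⊎ b ≡ c
  thin₂ t₂ {w} ne hh a b c ha h′a hb h′b hc h′c
    with φ₂-neighbour ne hh | φ₂-neighbour ne ha | φ₂-neighbour ne hb | φ₂-neighbour ne hc
  ... | w′ , refl , ww′ | p , refl , wp | q , refl , wq | r , refl , wr
    with t₂ ww′ p q r (wp , ψ-adj⁻ h′a) (wq , ψ-adj⁻ h′b) (wr , ψ-adj⁻ h′c)
  ... | 1st refl = 1st refl
  ... | 2nd refl = 2nd refl
  ... | 3rd refl = 3rd refl

  thin : ThinEdges G₁ → ThinEdges G₂ → ThinEdges H
  thin t₁ t₂ {h} {h′} hh a b c (ha , h′a) (hb , h′b) (hc , h′c) with view h | view h′
  ... | two w ne | _ = thin₂ t₂ ne hh a b c ha h′a hb h′b hc h′c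
  ... | one u | two w ne = thin₂ t₂ ne (Adj-sym H hh) a b c h′a ha h′b hb h′c hc
  ... | one u | one v = thin₁ (pull ha h′a) (pull hb h′b) (pull hc h′c)
    where
    pull : ∀ {a} → Adj H (φ₁ u) a → Adj H (φ₁ v) a → ∃ λ w → a ≡ φ₁ w × Adj G₁ u w × Adj G₁ v w
    pull {a} ua va with view a
    ... | one w = w , refl , proj₁ (φ₁-adj⁻ ua) , proj₁ (φ₁-adj⁻ va)
    -- A common neighbour outside `φ₁` would force `u` and `v` both to be `end (A w)`.
    ... | two w ne = contradiction
      (trans (proj₂ (φ₁₂-adj⁻ ne ua)) (sym (proj₂ (φ₁₂-adj⁻ ne va)))) (Adj-≢ G₁ (proj₁ (φ₁-adj⁻ hh)))
    thin₁ : ∀ {a b c} → (∃ λ w → a ≡ φ₁ w × Adj G₁ u w × Adj G₁ v w) → (∃ λ w → b ≡ φ₁ w × Adj G₁ u w × Adj G₁ v w) →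
            (∃ λ w → c ≡ φ₁ w × Adj G₁ u w × Adj G₁ v w) → a ≡ b ⊎ a ≡ c ⊎ b ≡ c
    thin₁ (p , refl , P) (q , refl , Q) (r , refl , R) with t₁ (proj₁ (φ₁-adj⁻ hh)) p q r P Q R
    ... | 1st refl = 1st refl
    ... | 2nd refl = 2nd refl
    ... | 3rd refl = 3rd refl

  -- Meaningful only for a surviving triangle through z: the side of its two other vertices.
  side : Triple (Fin (n G₂)) → Bool
  side (u , v , w) with u Fin.≟ z
  ... | yes _ = A v
  ... | no _ = A u

  image : Triple (Fin (n G₂)) → Triple (Fin (n H))
  image t = map₃ (ψ (side t)) t

  image-inj : ∀ {s t} → image s ≡ image t → s ≡ t
  image-inj {s@(a , b , c)} {t@(a′ , b′ , c′)} e with ,-inj e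
  ... | p , q , r with ψ-inj {side s} {side t} {a} {a′} p | ψ-inj {side s} {side t} {b} {b′} q | ψ-inj {side s} {side t} {c} {c′} r
  ... | refl | refl | refl = refl

  side-spec : ∀ {t} → Tri G₂ t → Sp G₂ z A t → z ∈₃ t → ∀ {a} → a ∈₃ t → a ≢ z → A a ≡ side t
  side-spec {u , v , w} (uv , _ , _) sp z∈ a∈ a≢ with u Fin.≟ z
  ... | yes refl = sp z∈ a∈ (2nd refl) a≢ (λ e → Adj-≢ G₂ uv (sym e))
  ... | no ne = sp z∈ a∈ (1st refl) a≢ ne

  φ₁-tri : ∀ {t} → Tri G₁ t → NoE G₁ x y t → Tri H (map₃ φ₁ t)
  φ₁-tri {t} tr ne = Tri-map G₁ H φ₁ t
    (λ a∈ b∈ _ ab → φ₁-adj⁺ ab λ { (inj₁ (refl , refl)) → ne (a∈ , b∈) ; (inj₂ (refl , refl)) → ne (b∈ , a∈) }) tr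

  image-tri : ∀ {t} → Tri G₂ t → Sp G₂ z A t → Tri H (image t)
  image-tri {t} tr sp = Tri-map G₂ H (ψ (side t)) t go tr
    where
    go : ∀ {a b} → a ∈₃ t → b ∈₃ t → a ≢ b → Adj G₂ a b → Adj H (ψ (side t) a) (ψ (side t) b)
    go {a} {b} a∈ b∈ a≢b ab = subst₂ (Adj H) (fix a∈ b∈ a≢b) (fix b∈ a∈ (λ e → a≢b (sym e))) (ψ-adj⁺ ab)
      where
      fix : ∀ {a b} → a ∈₃ t → b ∈₃ t → a ≢ b → ψ (A b) a ≡ ψ (side t) a
      fix {a} {b} a∈ b∈ ne with a Fin.≟ z
      ... | no a≢z = refl
      ... | yes refl = cong (λ b → φ₁ (end b)) (side-spec tr sp a∈ b∈ (λ e → ne (sym e)))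

  -- The two families of triangles are disjoint in `H`: a triangle of `G₂` has at most one vertex
  -- equal to `z`, so its image leaves the range of `φ₁`. The predicates `K₁`, `K₂` and `K` carry
  -- whatever further condition is being counted.
  combine : ∀ {j k} {K₁ : Triple (Fin (n G₁)) → Set} {K₂ : Triple (Fin (n G₂)) → Set} {K : Triple (Fin (n H)) → Set} →
    (∀ {t} → Tri G₁ t → K₁ t → K (map₃ φ₁ t)) →
    (∀ {t} → Tri G₂ t → Sp G₂ z A t → K₂ t → K (image t)) →
    AtLeast j (λ t → Tri G₁ t × NoE G₁ x y t × K₁ t) →
    AtLeast k (λ t → Tri G₂ t × Sp G₂ z A t × K₂ t) →
    AtLeast (j + k) (λ t → Tri H t × K t)
  combine f g = AtLeast-+ (map₃ φ₁) image φ-inj image-inj (λ {s} {t} (tr , _) → apart s t tr)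
    (λ { (tr , ne , k) → φ₁-tri tr ne , f tr k })
    (λ { (tr , sp , k) → image-tri tr sp , g tr sp k })
    where
    φ-inj : ∀ {s t} → map₃ φ₁ s ≡ map₃ φ₁ t → s ≡ t
    φ-inj {_ , _ , _} {_ , _ , _} e with ,-inj e
    ... | p , q , r with φ₁-inj _ _ p | φ₁-inj _ _ q | φ₁-inj _ _ r
    ... | refl | refl | refl = refl
    apart : ∀ s t → Tri G₂ t → map₃ φ₁ s ≢ image t
    apart (a , b , c) t@(u , v , w) (uv , _ , _) e with ,-inj e
    ... | p , q , _ with ψ≡φ₁ {side t} {u} (sym p) | ψ≡φ₁ {side t} {v} (sym q)
    ... | refl , _ | refl , _ = Adj-≢ G₂ uv refl

  left : ∀ {j} {K₁ : Triple (Fin (n G₁)) → Set} {K : Triple (Fin (n H)) → Set} →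
    (∀ {t} → Tri G₁ t → K₁ t → K (map₃ φ₁ t)) →
    AtLeast j (λ t → Tri G₁ t × NoE G₁ x y t × K₁ t) → AtLeast j (λ t → Tri H t × K t)
  left {j} f m = subst (λ i → AtLeast i _) (ℕ.+-identityʳ j)
    (combine {K₂ = λ _ → ⊥} f (λ _ _ ()) m AtLeast-0)

  right : ∀ {k} {K₂ : Triple (Fin (n G₂)) → Set} {K : Triple (Fin (n H)) → Set} →
    (∀ {t} → Tri G₂ t → Sp G₂ z A t → K₂ t → K (image t)) →
    AtLeast k (λ t → Tri G₂ t × Sp G₂ z A t × K₂ t) → AtLeast k (λ t → Tri H t × K t)
  right g m = combine {K₁ = λ _ → ⊥} (λ _ ()) g AtLeast-0 m

  ∈₃-φ₁ : ∀ {t u} → φ₁ u ∈₃ map₃ φ₁ t → u ∈₃ t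
  ∈₃-φ₁ {t} h with ∈₃-map⁻ φ₁ t h
  ... | a , a∈ , e with φ₁-inj _ _ e
  ... | refl = a∈

  φ₂∉φ₁ : ∀ {t w} → w ≢ z → ¬ φ₂ w ∈₃ map₃ φ₁ t
  φ₂∉φ₁ {t} ne h with ∈₃-map⁻ φ₁ t h
  ... | a , _ , e = disj a _ ne (sym e)

  φ₁∈image : ∀ {t u} → φ₁ u ∈₃ image t → z ∈₃ t × u ≡ end (side t)
  φ₁∈image {t} h with ∈₃-map⁻ (ψ (side t)) t h
  ... | a , a∈ , e with ψ≡φ₁ {side t} {a} (sym e)
  ... | refl , u≡ = a∈ , u≡

  φ₂∈image : ∀ {t w} → w ≢ z → φ₂ w ∈₃ image t → w ∈₃ t
  φ₂∈image {t} ne h with ∈₃-map⁻ (ψ (side t)) t h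
  ... | a , a∈ , e with ψ≡φ₂ {side t} {a} ne (sym e)
  ... | refl = a∈

  interior : Fin (n G₁) → Set
  interior u = ∀ b → u ≢ end b

  data CaseOn (u : Fin (n G₁)) : Set where
    is-x : u ≡ x → CaseOn u
    is-y : u ≡ y → CaseOn u
    is-interior : interior u → CaseOn u

  caseOn : ∀ u → CaseOn u
  caseOn u with u Fin.≟ x | u Fin.≟ y
  ... | yes e | _ = is-x e
  ... | no _ | yes e = is-y e
  ... | no nx | no ny = is-interior λ { true → nx ; false → ny }

-- Two triangles avoid any edge, two survive any splitting, and one avoids any vertex, each counted
-- six times. The last bound serves the merged vertex of a composition, where each part is only
-- guaranteed to contribute one triangle.
record Bounds (G : Graph) : Set where
  field
    thin  : ThinEdges G
    noE   : ∀ {x y} → Adj G x y → AtLeast 12 (λ t → Tri G t × NoE G x y t)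
    sp    : ∀ z A → (∃ λ w → Adj G z w × A w ≡ true) → (∃ λ w → Adj G z w × A w ≡ false) →
            AtLeast 12 (λ t → Tri G t × Sp G z A t)
    avoid : ∀ v → AtLeast 6 (λ t → Tri G t × Avoid G v t)

  noE⊤ : ∀ {x y} → Adj G x y → AtLeast 12 (λ t → Tri G t × NoE G x y t × ⊤)
  noE⊤ xy = AtLeast-⇒ (λ (tr , ne) → tr , ne , tt) (noE xy)

  sp⊤ : ∀ z A → (∃ λ w → Adj G z w × A w ≡ true) → (∃ λ w → Adj G z w × A w ≡ false) →
        AtLeast 12 (λ t → Tri G t × Sp G z A t × ⊤)
  sp⊤ z A p q = AtLeast-⇒ (λ (tr , s) → tr , s , tt) (sp z A p q)

K4-bounds : ∀ {G} → IsK4 G → Bounds G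
K4-bounds {G} K = record
  { thin = K4-thin G K ; noE = K4-NoE G K ; sp = λ z A _ _ → K4-Sp G K z A ; avoid = K4-Avoid G K }

Avoid⇒NoE : ∀ G {x y t} → Avoid G x t → NoE G x y t
Avoid⇒NoE G av (p , _) = av p

Avoid⇒Sp : ∀ G {z A t} → Avoid G z t → Sp G z A t
Avoid⇒Sp G av z∈ = contradiction z∈ av

module _ {G₁ G₂ H : Graph} (B₁ : Bounds G₁) (B₂ : Bounds G₂) where

  module _ (C : OreComp G₁ G₂ H) where
    open Comp C
    private
      module B₁ = Bounds B₁
      module B₂ = Bounds B₂

    -- The merged vertex lies in both parts, so each part contributes one triangle: one of `G₁`
    -- avoiding `x` and one of `G₂` avoiding `z`.
    avoid-x : AtLeast 12 (λ t → Tri H t × Avoid H (φ₁ x) t)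
    avoid-x = combine {K₁ = Avoid G₁ x} {K₂ = Avoid G₂ z}
      (λ _ av h → av (∈₃-φ₁ h)) (λ _ _ av h → av (proj₁ (φ₁∈image h)))
      (AtLeast-⇒ (λ (tr , av) → tr , Avoid⇒NoE G₁ av , av) (B₁.avoid x))
      (AtLeast-⇒ (λ (tr , av) → tr , Avoid⇒Sp G₂ av , av) (B₂.avoid z))

    bounds-right : ∀ {K : Triple (Fin (n H)) → Set} →
      (∀ {t} → Tri G₂ t → Sp G₂ z A t → K (image t)) → AtLeast 12 (λ t → Tri H t × K t)
    bounds-right f = right {K₂ = λ _ → ⊤} (λ tr s _ → f tr s) (B₂.sp⊤ z A A-ne₁ A-ne₂)

    bounds-left : ∀ {K : Triple (Fin (n H)) → Set} →
      (∀ {t} → Tri G₁ t → K (map₃ φ₁ t)) → AtLeast 12 (λ t → Tri H t × K t)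
    bounds-left f = left {K₁ = λ _ → ⊤} (λ tr _ → f tr) (B₁.noE⊤ xy)

  -- A vertex other than `x` and `y` is missed by all triangles of the part that does not contain
  -- it. Thus a composition has two triangles off every vertex, where K₄ has only one.
  comp-avoid : OreComp G₁ G₂ H → ∀ v → AtLeast 12 (λ t → Tri H t × Avoid H v t)
  comp-avoid C v with Comp.view C v
  ... | Comp.two w ne = bounds-left C (λ _ → φ₂∉φ₁ ne)
    where open Comp C
  ... | Comp.one u with Comp.caseOn C u
  ... | Comp.is-x refl = avoid-x C
  ... | Comp.is-y refl = avoid-x (swapOre C)
  ... | Comp.is-interior nu = bounds-right C (λ {t} _ _ h → nu (side t) (proj₂ (φ₁∈image {t} h)))
    where open Comp C

  comp-bounds : OreComp G₁ G₂ H → Bounds H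
  comp-bounds C = record
    { thin = thin (Bounds.thin B₁) (Bounds.thin B₂)
    ; noE = noE′
    ; sp = λ v A′ _ _ → AtLeast-Sp v A′
    ; avoid = λ v → AtLeast-weaken (ℕ.m≤m+n 6 6) (comp-avoid C v) }
    where
    open Comp C
    noE′ : ∀ {h h′} → Adj H h h′ → AtLeast 12 (λ t → Tri H t × NoE H h h′ t)
    noE′ {h} {h′} a with view h | view h′
    ... | two w ne | _ = bounds-left C (λ _ (p , _) → φ₂∉φ₁ ne p)
    ... | one _ | two w ne = bounds-left C (λ _ (_ , p) → φ₂∉φ₁ ne p)
    -- The image of a triangle of `G₂` meets the range of `φ₁` at most in `end (side t)`, hence
    -- contains no edge with both ends there.
    ... | one u | one v = bounds-right C (λ {t} _ _ (p , q) →
      Adj-≢ H a (cong φ₁ (trans (proj₂ (φ₁∈image {t} p)) (sym (proj₂ (φ₁∈image {t} q))))))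
    AtLeast-Sp : ∀ v A′ → AtLeast 12 (λ t → Tri H t × Sp H v A′ t)
    AtLeast-Sp v A′ = AtLeast-⇒ (λ (tr , av) → tr , Avoid⇒Sp H av) (comp-avoid C v)

ore-bounds : ∀ {G} → Ore4 G → Bounds G
ore-bounds (base K) = K4-bounds K
ore-bounds (comp O₁ O₂ C) = comp-bounds (ore-bounds O₁) (ore-bounds O₂) C

module _ {G₁ G₂ H : Graph} (B₁ : Bounds G₁) (B₂ : Bounds G₂) (C : OreComp G₁ G₂ H) where
  open Comp C

  ore-24 : AtLeast 24 (Tri H)
  ore-24 = AtLeast-⇒ proj₁ (combine {K₁ = λ _ → ⊤} {K₂ = λ _ → ⊤} {K = λ _ → ⊤} (λ _ _ → tt) (λ _ _ _ → tt)
    (Bounds.noE⊤ B₁ xy) (Bounds.sp⊤ B₂ z A A-ne₁ A-ne₂))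

-- Criticality and connectivity

SamePair : {V : Set} → V → V → V → V → Set
SamePair a b u v = (a ≡ u × b ≡ v) ⊎ (a ≡ v × b ≡ u)

-- Connectivity of a part of G is path induction: a property P closed under its edges holds at all or none of its vertices.
record Structure (G : Graph) : Set₁ where
  field
    edge : ∃ λ u → ∃ λ v → Adj G u v
    2-edge-connected : ∀ {u v} → Adj G u v → (P : Fin (n G) → Set) →
      (∀ {a b} → Adj G a b → ¬ SamePair a b u v → P a → P b) → ∀ a b → P a → P b
    2-connected : ∀ v (P : Fin (n G) → Set) →
      (∀ {a b} → a ≢ v → b ≢ v → Adj G a b → P a → P b) → ∀ {a b} → a ≢ v → b ≢ v → P a → P b
    uncolourable : ¬ Colorable3 G
    -- f colours the vertices of degree one into which z is split.
    extend : ∀ z (f : Fin (n G) → Fin 3) → (∃ λ w → ∃ λ w′ → Adj G z w × Adj G z w′ × f w ≢ f w′) →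
      ∃ λ (c : Fin (n G) → Fin 3) → (∀ {u v} → u ≢ z → v ≢ z → Adj G u v → c u ≢ c v) × (∀ {w} → Adj G z w → c w ≢ f w)

  -- Otherwise `uv` would be a bridge: the set consisting of `u` would be closed under all other
  -- edges.
  second-neighbour : ∀ {u v} → Adj G u v → ∃ λ w → Adj G u w × w ≢ v
  second-neighbour {u} {v} uv with any? (λ w → Adj? G u w ×-dec ¬? (w Fin.≟ v))
  ... | yes p = p
  ... | no none = contradiction (2-edge-connected uv (u ≡_) closed u v refl) (Adj-≢ G uv)
    where
    closed : ∀ {a b} → Adj G a b → ¬ SamePair a b u v → u ≡ a → u ≡ b
    closed {a} {b} ab ne refl with b Fin.≟ v
    ... | yes refl = contradiction (inj₁ (refl , refl)) ne
    ... | no b≢v = contradiction (b , ab , b≢v) none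

  neighbour : ∀ v → ∃ λ w → Adj G v w
  neighbour v with any? (λ w → Adj? G v w)
  ... | yes p = p
  ... | no none with edge
  ... | a , b , ab = contradiction (trans (sym (alone a)) (alone b)) (Adj-≢ G ab)
    where
    alone : ∀ u → v ≡ u
    alone u = 2-edge-connected ab (v ≡_) (λ { {b = b} ab _ refl → contradiction (b , ab) none }) v u refl

  connected : Connected G
  connected u v with edge
  ... | _ , _ , ab = 2-edge-connected ab (Reach G u) (λ ab _ r → snoc r ab) u v here
    where
    snoc : ∀ {a b c} → Reach G a b → Adj G b c → Reach G a c
    snoc here e = step e here
    snoc (step e r) e′ = step e (snoc r e′)

  -- Split `u` and precolour its copy at `v` with some `δ ≢ γ` and all other copies with `γ`. In the
  -- extension, no neighbour of `u` other than `v` has colour `γ`, so `u` can receive it. If `v` did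
  -- not have colour `γ` as well, this would be a 3-colouring of `G`.
  equal-ends : ∀ {u v} → Adj G u v → (γ : Fin 3) → ∃ λ (c : Fin (n G) → Fin 3) →
    c u ≡ γ × c v ≡ γ × (∀ {a b} → Adj G a b → ¬ SamePair a b u v → c a ≢ c b)
  equal-ends {u} {v} uv γ = c′ , c′u , c′v , proper
    where
    δ : ∃ λ δ → δ ≢ γ
    δ = from-yes (all? {n = 3} λ γ → any? λ δ → ¬? (δ Fin.≟ γ)) γ
    f : Fin (n G) → Fin 3
    f w with w Fin.≟ v
    ... | yes _ = proj₁ δ
    ... | no _ = γ
    f-v : f v ≡ proj₁ δ
    f-v with v Fin.≟ v
    ... | yes _ = refl
    ... | no ne = contradiction refl ne
    f-≢v : ∀ {w} → w ≢ v → f w ≡ γ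
    f-≢v {w} ne with w Fin.≟ v
    ... | yes e = contradiction e ne
    ... | no _ = refl
    ext : ∃ λ (c : Fin (n G) → Fin 3) → (∀ {a b} → a ≢ u → b ≢ u → Adj G a b → c a ≢ c b) × (∀ {w} → Adj G u w → c w ≢ f w)
    ext with second-neighbour uv
    ... | w , uw , w≢v = extend u f (v , w , uv , uw , λ e → proj₂ δ (trans (sym f-v) (trans e (f-≢v w≢v))))
    c = proj₁ ext
    c′ : Fin (n G) → Fin 3
    c′ w with w Fin.≟ u
    ... | yes _ = γ
    ... | no _ = c w
    c′u : c′ u ≡ γ
    c′u with u Fin.≟ u
    ... | yes _ = refl
    ... | no ne = contradiction refl ne
    c′-≢u : ∀ {w} → w ≢ u → c′ w ≡ c w
    c′-≢u {w} ne with w Fin.≟ u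
    ... | yes e = contradiction e ne
    ... | no _ = refl
    at-u : ∀ {w} → Adj G u w → w ≢ v → c′ w ≢ γ
    at-u uw w≢v e = proj₂ (proj₂ ext) uw (trans (sym (c′-≢u (λ e → Adj-≢ G uw (sym e)))) (trans e (sym (f-≢v w≢v))))
    proper : ∀ {a b} → Adj G a b → ¬ SamePair a b u v → c′ a ≢ c′ b
    proper {a} {b} ab ne with a Fin.≟ u | b Fin.≟ u
    ... | yes refl | yes refl = contradiction refl (Adj-≢ G ab)
    ... | yes refl | no _ = λ e → at-u ab (λ { refl → ne (inj₁ (refl , refl)) }) (trans (c′-≢u (λ e → Adj-≢ G ab (sym e))) (sym e))
    ... | no _ | yes refl = λ e → at-u (Adj-sym G ab) (λ { refl → ne (inj₂ (refl , refl)) }) (trans (c′-≢u (Adj-≢ G ab)) e)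
    ... | no a≢ | no b≢ = proj₁ (proj₂ ext) a≢ b≢ ab
    c′v : c′ v ≡ γ
    c′v = decidable-stable (c′ v Fin.≟ γ) λ ne → uncolourable (c′ , λ a b ab → total ne a b ab)
      where
      total : c′ v ≢ γ → ∀ a b → Adj G a b → c′ a ≢ c′ b
      total ne a b ab with (a Fin.≟ u) ×-dec (b Fin.≟ v) | (a Fin.≟ v) ×-dec (b Fin.≟ u)
      ... | yes (refl , refl) | _ = λ e → ne (trans (sym e) c′u)
      ... | no _ | yes (refl , refl) = λ e → ne (trans e c′u)
      ... | no p | no q = proper ab [ p , q ]′

  -- A subgraph that misses a vertex also misses an edge at it, since no vertex is isolated. So it
  -- suffices to colour `G` without one edge, which `equal-ends` does.
  critical : Critical4 G
  critical = uncolourable , λ s → λ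
    { (inj₁ (v , out)) → let w , vw = neighbour v in missing s vw (outside s v w out)
    ; (inj₂ (u , v , uv , out)) → missing s uv out }
    where
    outside : ∀ (s : Subgraph G) v w → Subgraph.S s v ≡ false → Subgraph.F s v w ≡ false
    outside s v w out with Subgraph.F s v w in eq
    ... | false = refl
    ... | true with trans (sym out) (proj₁ (Subgraph.F⊆S s v w eq))
    ... | ()
    missing : ∀ (s : Subgraph G) {u v} → Adj G u v → Subgraph.F s u v ≡ false → SubColorable3 s
    missing s {u} {v} uv out with equal-ends uv 0F
    ... | c , _ , _ , proper = c , λ a b Fab → proper (Subgraph.F⊆E s a b Fab) λ
      { (inj₁ (refl , refl)) → true≢false (trans (sym Fab) out)
      ; (inj₂ (refl , refl)) → true≢false (trans (sym Fab) (trans (Subgraph.F-sym s a b) out)) }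
      where
      true≢false : true ≢ false
      true≢false ()

abstract
  -- This is `extend` for K₄: the three neighbours of the split vertex need distinct colours, and
  -- each must avoid the colour of the leaf attached to it.
  rainbow : (a b c : Fin 3) → ¬ (a ≡ b × b ≡ c) → ∃ λ p → ∃ λ q → ∃ λ r →
            (p ≢ q × q ≢ r × p ≢ r) × (p ≢ a × q ≢ b × r ≢ c)
  rainbow = from-yes (all? {n = 3} λ a → all? λ b → all? λ c →
    ¬? ((a Fin.≟ b) ×-dec (b Fin.≟ c)) →-dec any? λ p → any? λ q → any? λ r →
      (¬? (p Fin.≟ q) ×-dec (¬? (q Fin.≟ r) ×-dec ¬? (p Fin.≟ r))) ×-dec
      (¬? (p Fin.≟ a) ×-dec (¬? (q Fin.≟ b) ×-dec ¬? (r Fin.≟ c))))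

module _ (G : Graph) (K : IsK4 G) where

  private
    V : Set
    V = Fin (n G)

    adjacent : ∀ {u v} → u ≢ v → Adj G u v
    adjacent {u} {v} = Equivalence.from (proj₂ K u v)

  K4-structure : Structure G
  K4-structure = record
    { edge = edge ; 2-edge-connected = 2ec ; 2-connected = λ v P cl a≢ b≢ → 2c v P cl a≢ b≢
    ; uncolourable = unc ; extend = ext }
    where
    v₀ : V
    v₀ = subst Fin (sym (proj₁ K)) 0F
    edge : ∃ λ u → ∃ λ v → Adj G u v
    edge with frameAt G K v₀
    ... | _ , _ , F = Frame.ν F 0F , Frame.ν F 1F , Frame.adj⁺ F λ ()
    2ec : ∀ {u v} → Adj G u v → (P : V → Set) →
      (∀ {a b} → Adj G a b → ¬ SamePair a b u v → P a → P b) → ∀ a b → P a → P b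
    2ec {u} {v} uv P cl a b Pa with a Fin.≟ b | (a Fin.≟ u) ×-dec (b Fin.≟ v) | (a Fin.≟ v) ×-dec (b Fin.≟ u)
    ... | yes refl | _ | _ = Pa
    ... | no ne | no p | no q = cl (adjacent ne) [ p , q ]′ Pa
    ... | no ne | yes (refl , refl) | _ with frameAt₂ G K ne
    -- The forbidden edge is bypassed through a third vertex `w`.
    ... | w , F = cl (adjacent w≢v) [ (λ (e , _) → w≢u e) , (λ (_ , e) → ne (sym e)) ]′
                    (cl (adjacent (w≢u ∘ sym)) [ (λ (_ , e) → w≢v e) , (λ (e , _) → ne e) ]′ Pa)
      where
      open Frame F
      w≢u : w ≢ u
      w≢u e with inj (trans ν₂ (trans e (sym ν₀)))
      ... | ()
      w≢v : w ≢ v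
      w≢v e with inj (trans ν₂ (trans e (sym ν₁)))
      ... | ()
    2ec {u} {v} uv P cl a b Pa | no ne | no _ | yes (refl , refl) with frameAt₂ G K ne
    ... | w , F = cl (adjacent w≢u) [ (λ (_ , e) → ne (sym e)) , (λ (e , _) → w≢v e) ]′
                    (cl (adjacent (w≢v ∘ sym)) [ (λ (e , _) → ne e) , (λ (_ , e) → w≢u e) ]′ Pa)
      where
      open Frame F
      w≢v : w ≢ v
      w≢v e with inj (trans ν₂ (trans e (sym ν₀)))
      ... | ()
      w≢u : w ≢ u
      w≢u e with inj (trans ν₂ (trans e (sym ν₁)))
      ... | ()
    2c : ∀ v (P : V → Set) → (∀ {a b} → a ≢ v → b ≢ v → Adj G a b → P a → P b) → ∀ {a b} → a ≢ v → b ≢ v → P a → P b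
    2c v P cl {a} {b} a≢ b≢ Pa with a Fin.≟ b
    ... | yes refl = Pa
    ... | no ne = cl a≢ b≢ (adjacent ne) Pa
    unc : ¬ Colorable3 G
    unc (c , proper) with frameAt G K v₀
    ... | _ , _ , F with Fin.pigeonhole {3} {4} (s≤s (s≤s (s≤s (s≤s z≤n)))) (c ∘ Frame.ν F)
    ... | i , j , i<j , e = proper _ _ (Frame.adj⁺ F (λ { refl → ℕ.<-irrefl refl i<j })) e
    ext : ∀ z (f : V → Fin 3) → (∃ λ w → ∃ λ w′ → Adj G z w × Adj G z w′ × f w ≢ f w′) →
      ∃ λ (c : V → Fin 3) → (∀ {u v} → u ≢ z → v ≢ z → Adj G u v → c u ≢ c v) × (∀ {w} → Adj G z w → c w ≢ f w)
    ext z f (w , w′ , zw , zw′ , fw≢fw′) with frameAt G K z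
    ... | _ , _ , F = go (rainbow (f (ν 1F)) (f (ν 2F)) (f (ν 3F)) nonconstant)
      where
      open Frame F
      nonconstant : ¬ (f (ν 1F) ≡ f (ν 2F) × f (ν 2F) ≡ f (ν 3F))
      nonconstant (p , q) = fw≢fw′ (trans (val zw) (sym (val zw′)))
        where
        val : ∀ {w} → Adj G z w → f w ≡ f (ν 2F)
        val {w} zw with sur w
        ... | 0F , refl = contradiction (sym ν₀) (Adj-≢ G zw)
        ... | 1F , refl = p
        ... | 2F , refl = refl
        ... | 3F , refl = sym q
      go : (∃ λ p → ∃ λ q → ∃ λ r → (p ≢ q × q ≢ r × p ≢ r) × (p ≢ f (ν 1F) × q ≢ f (ν 2F) × r ≢ f (ν 3F))) →
           ∃ λ (c : V → Fin 3) → (∀ {u v} → u ≢ z → v ≢ z → Adj G u v → c u ≢ c v) × (∀ {w} → Adj G z w → c w ≢ f w)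
      go (p , q , r , (pq , qr , pr) , (p≢ , q≢ , r≢)) = c , proper , demand
        where
        table : Fin 4 → Fin 3
        -- The value at `z` is arbitrary, because the colouring is required to be proper only away
        -- from `z`.
        table 0F = p
        table 1F = p
        table 2F = q
        table 3F = r
        c : V → Fin 3
        c v = table (proj₁ (sur v))
        table-≢ : ∀ i j → i ≢ 0F → j ≢ 0F → i ≢ j → table i ≢ table j
        table-≢ 0F _ i≢ _ _ = contradiction refl i≢
        table-≢ _ 0F _ j≢ _ = contradiction refl j≢
        table-≢ 1F 1F _ _ ne = contradiction refl ne
        table-≢ 1F 2F _ _ _ = pq
        table-≢ 1F 3F _ _ _ = pr
        table-≢ 2F 1F _ _ _ = pq ∘ sym
        table-≢ 2F 2F _ _ ne = contradiction refl ne
        table-≢ 2F 3F _ _ _ = qr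
        table-≢ 3F 1F _ _ _ = pr ∘ sym
        table-≢ 3F 2F _ _ _ = qr ∘ sym
        table-≢ 3F 3F _ _ ne = contradiction refl ne
        proper : ∀ {u v} → u ≢ z → v ≢ z → Adj G u v → c u ≢ c v
        proper {u} {v} u≢ v≢ uv with sur u | sur v
        ... | i , refl | j , refl = table-≢ i j (λ { refl → u≢ ν₀ }) (λ { refl → v≢ ν₀ }) (λ { refl → Adj-≢ G uv refl })
        demand : ∀ {w} → Adj G z w → c w ≢ f w
        demand {w} zw with sur w
        ... | 0F , refl = contradiction (sym ν₀) (Adj-≢ G zw)
        ... | 1F , refl = p≢
        ... | 2F , refl = q≢
        ... | 3F , refl = r≢

module _ {G₁ G₂ H : Graph} (S₁ : Structure G₁) (S₂ : Structure G₂) where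

  private
    module S₁ = Structure S₁
    module S₂ = Structure S₂

  module Colouring (C : OreComp G₁ G₂ H) where
    open Comp C

    glue : {X : Set} → (Fin (n G₁) → X) → (Fin (n G₂) → X) → Fin (n H) → X
    glue f g h with cover h
    ... | inj₁ (u , _) = f u
    ... | inj₂ (w , _) = g w

    glue-φ₁ : ∀ {X : Set} {f : Fin (n G₁) → X} {g} u → glue f g (φ₁ u) ≡ f u
    glue-φ₁ {f = f} u with cover (φ₁ u)
    ... | inj₁ (u′ , e) = cong f (φ₁-inj _ _ e)
    ... | inj₂ (w , ne , e) = contradiction (sym e) (disj u w ne)

    glue-φ₂ : ∀ {X : Set} {f : Fin (n G₁) → X} {g} w → w ≢ z → glue f g (φ₂ w) ≡ g w
    glue-φ₂ {g = g} w ne with cover (φ₂ w)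
    ... | inj₁ (u , e) = contradiction e (disj u w ne)
    ... | inj₂ (w′ , n′ , e) = cong g (φ₂-inj _ _ n′ ne e)

    -- `S` will be the complement of the split vertex, where the glued colouring need not be proper.
    glue-proper : (S : Fin (n H) → Set) {f : Fin (n G₁) → Fin 3} {g : Fin (n G₂) → Fin 3} →
      (∀ {u u′} → S (φ₁ u) → S (φ₁ u′) → Adj G₁ u u′ → ¬ IsXY u u′ → f u ≢ f u′) →
      (∀ {w w′} → w ≢ z → w′ ≢ z → S (φ₂ w) → S (φ₂ w′) → Adj G₂ w w′ → g w ≢ g w′) →
      (∀ {w} → w ≢ z → S (φ₁ (end (A w))) → S (φ₂ w) → Adj G₂ z w → f (end (A w)) ≢ g w) →
      ∀ {h h′} → S h → S h′ → Adj H h h′ → glue f g h ≢ glue f g h′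
    glue-proper S {f} {g} p₁ p₂ p₁₂ {h} {h′} s s′ a with view h | view h′
    ... | one u | one u′ rewrite glue-φ₁ {f = f} {g} u | glue-φ₁ {f = f} {g} u′ =
      p₁ s s′ (proj₁ (φ₁-adj⁻ a)) (proj₂ (φ₁-adj⁻ a))
    ... | two w ne | two w′ n′ rewrite glue-φ₂ {f = f} {g} w ne | glue-φ₂ {f = f} {g} w′ n′ =
      p₂ ne n′ s s′ (trans (sym (adj₂ _ _ ne n′)) a)
    ... | one u | two w ne rewrite glue-φ₁ {f = f} {g} u | glue-φ₂ {f = f} {g} w ne with φ₁₂-adj⁻ ne a
    ... | zw , refl = p₁₂ ne s s′ zw
    glue-proper S {f} {g} p₁ p₂ p₁₂ s s′ a | two w ne | one u
      rewrite glue-φ₁ {f = f} {g} u | glue-φ₂ {f = f} {g} w ne with φ₁₂-adj⁻ ne (Adj-sym H a)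
    ... | zw , refl = p₁₂ ne s′ s zw ∘ sym

    Extension : Fin (n H) → (Fin (n H) → Fin 3) → Set
    Extension v f = ∃ λ (c : Fin (n H) → Fin 3) →
      (∀ {a b} → a ≢ v → b ≢ v → Adj H a b → c a ≢ c b) × (∀ {a} → Adj H v a → c a ≢ f a)

    Nonconstant : Fin (n H) → (Fin (n H) → Fin 3) → Set
    Nonconstant v f = ∃ λ a → ∃ λ b → Adj H v a × Adj H v b × f a ≢ f b

    -- Extend in `G₁` at `u` first. As `xy` is an edge of `G₁`, the colours of `x` and `y` differ;
    -- used as the precolouring at the split `z`, they are nonconstant because both parts of the
    -- neighbourhood are nonempty.
    extend-interior : ∀ u → interior u → ∀ f → Nonconstant (φ₁ u) f → Extension (φ₁ u) f
    extend-interior u int f (a , b , ua , ub , ne) with pull ua | pull ub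
      where
      pull : ∀ {a} → Adj H (φ₁ u) a → ∃ λ u′ → a ≡ φ₁ u′ × Adj G₁ u u′
      pull {a} ua with view a
      ... | one u′ = u′ , refl , proj₁ (φ₁-adj⁻ ua)
      ... | two w ne = contradiction (proj₂ (φ₁₂-adj⁻ ne ua)) (int (A w))
    ... | a′ , refl , ua′ | b′ , refl , ub′ with S₁.extend u (f ∘ φ₁) (a′ , b′ , ua′ , ub′ , ne)
    ... | c₁ , proper₁ , demand₁ with S₂.extend z (c₁ ∘ end ∘ A) (nonconstant A-ne₁ A-ne₂)
      where
      nonconstant : (∃ λ w → Adj G₂ z w × A w ≡ true) → (∃ λ w → Adj G₂ z w × A w ≡ false) →
                    ∃ λ w → ∃ λ w′ → Adj G₂ z w × Adj G₂ z w′ × c₁ (end (A w)) ≢ c₁ (end (A w′))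
      nonconstant (w , zw , e) (w′ , zw′ , e′) = w , w′ , zw , zw′ ,
        subst₂ (λ p q → c₁ (end p) ≢ c₁ (end q)) (sym e) (sym e′) (proper₁ (int true ∘ sym) (int false ∘ sym) xy)
    ... | c₂ , proper₂ , demand₂ = glue c₁ c₂ ,
      glue-proper (_≢ φ₁ u)
        (λ s s′ uu′ _ → proper₁ (s ∘ cong φ₁) (s′ ∘ cong φ₁) uu′)
        (λ ne n′ _ _ → proper₂ ne n′)
        (λ ne _ _ zw → demand₂ zw ∘ sym) ,
      demand
      where
      demand : ∀ {a} → Adj H (φ₁ u) a → glue c₁ c₂ a ≢ f a
      demand {a} ua with view a
      ... | one u′ = demand₁ (proj₁ (φ₁-adj⁻ ua)) ∘ trans (sym (glue-φ₁ u′))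
      ... | two w ne = contradiction (proj₂ (φ₁₂-adj⁻ ne ua)) (int (A w))

    -- Extend in `G₂` at `w` first. The colour that `z` receives is then given to both `x` and `y`
    -- in `G₁ - xy` by `equal-ends`.
    extend-φ₂ : ∀ w → w ≢ z → ∀ f → Nonconstant (φ₂ w) f → Extension (φ₂ w) f
    extend-φ₂ w w≢z f (a , b , wa , wb , ne) with φ₂-neighbour w≢z wa | φ₂-neighbour w≢z wb
    ... | a′ , refl , wa′ | b′ , refl , wb′ with S₂.extend w (f ∘ ψ (A w)) (a′ , b′ , wa′ , wb′ , ne)
    ... | c₂ , proper₂ , demand₂ with S₁.equal-ends xy (c₂ z)
    ... | c₁ , c₁x , c₁y , proper₁ = glue c₁ c₂ ,
      glue-proper (_≢ φ₂ w)
        (λ _ _ uu′ → proper₁ uu′)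
        (λ ne n′ s s′ → proper₂ (s ∘ cong φ₂) (s′ ∘ cong φ₂))
        (λ {w′} ne _ s zw′ e → proper₂ (w≢z ∘ sym) (s ∘ cong φ₂) zw′ (trans (sym (c₁-end (A w′))) e)) ,
      demand
      where
      c₁-end : ∀ b → c₁ (end b) ≡ c₂ z
      c₁-end true = c₁x
      c₁-end false = c₁y
      glue-ψ : ∀ b w′ → glue c₁ c₂ (ψ b w′) ≡ c₂ w′
      glue-ψ b w′ with w′ Fin.≟ z
      ... | yes refl = trans (glue-φ₁ (end b)) (c₁-end b)
      ... | no ne = glue-φ₂ w′ ne
      demand : ∀ {a} → Adj H (φ₂ w) a → glue c₁ c₂ a ≢ f a
      demand wa e with φ₂-neighbour w≢z wa
      ... | a′ , refl , wa′ = demand₂ wa′ (trans (sym (glue-ψ (A w) a′)) e)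

    -- The leaves at `x = z₁` belong to both parts. In `G₁` the copy of `x` at `y` is precoloured
    -- `γ`, which forces `c₁ y ≢ γ`; in `G₂` the copies of `z` on the side of `y` are then
    -- precoloured `c₁ y`. The task is to choose `γ` so that neither precolouring is constant.
    extend-x : ∀ f → Nonconstant (φ₁ x) f → Extension (φ₁ x) f
    extend-x f (a , b , xa , xb , fa≢fb) =
      build (choose (any? (λ w → (Adj? G₂ z w ×-dec (A w Bool.≟ true)) ×-dec ¬? (f (φ₂ w) Fin.≟ α))))
      where
      w₀ w₁ : Fin (n G₂)
      w₀ = proj₁ A-ne₁
      w₁ = proj₁ A-ne₂
      α : Fin 3
      α = f (φ₂ w₀)

      f₁ : Fin 3 → Fin (n G₁) → Fin 3
      f₁ γ u with u Fin.≟ y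
      ... | yes _ = γ
      ... | no _ = f (φ₁ u)
      f₁-y : ∀ γ → f₁ γ y ≡ γ
      f₁-y γ with y Fin.≟ y
      ... | yes _ = refl
      ... | no ne = contradiction refl ne
      f₁-≢y : ∀ γ {u} → u ≢ y → f₁ γ u ≡ f (φ₁ u)
      f₁-≢y γ {u} ne with u Fin.≟ y
      ... | yes e = contradiction e ne
      ... | no _ = refl
      f₂ : Fin 3 → Fin (n G₂) → Fin 3
      f₂ β w = if A w then f (φ₂ w) else β

      Choice : Set
      Choice = ∃ λ γ → (∃ λ u → Adj G₁ x u × u ≢ y × f (φ₁ u) ≢ γ) ×
        (∀ β → β ≢ γ → ∃ λ w → ∃ λ w′ → Adj G₂ z w × Adj G₂ z w′ × f₂ β w ≢ f₂ β w′)

      f₂-A : ∀ β {w} → A w ≡ true → f₂ β w ≡ f (φ₂ w)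
      f₂-A β e rewrite e = refl
      f₂-B : ∀ β {w} → A w ≡ false → f₂ β w ≡ β
      f₂-B β e rewrite e = refl

      choose : Dec (∃ λ w → (Adj G₂ z w × A w ≡ true) × f (φ₂ w) ≢ α) → Choice
      -- The leaves of the first part already differ in colour, so `γ` only has to differ from the
      -- colour of one leaf in `G₁`.
      choose (yes (w , (zw , Aw) , ne)) with S₁.second-neighbour xy
      ... | u , xu , u≢y with from-yes (all? {n = 3} λ γ → any? λ δ → ¬? (γ Fin.≟ δ)) (f (φ₁ u))
      ... | γ , ne′ = γ , (u , xu , u≢y , ne′) , λ β _ → w , w₀ , zw , proj₁ (proj₂ A-ne₁) ,
        subst₂ _≢_ (sym (f₂-A β Aw)) (sym (f₂-A β (proj₂ (proj₂ A-ne₁)))) ne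
      -- All leaves of the first part have colour `α`. With `γ = α` the colour of `y` differs from
      -- `α`, and since `f` is nonconstant, some leaf in `G₁` has a colour other than `α`.
      choose (no none) = α , witness , λ β β≢ → w₀ , w₁ , proj₁ (proj₂ A-ne₁) , proj₁ (proj₂ A-ne₂) ,
        subst₂ _≢_ (sym (f₂-A β (proj₂ (proj₂ A-ne₁)))) (sym (f₂-B β (proj₂ (proj₂ A-ne₂)))) (β≢ ∘ sym)
        where
        from : ∀ {a} → Adj H (φ₁ x) a → f a ≢ α → ∃ λ u → Adj G₁ x u × u ≢ y × f (φ₁ u) ≢ α
        from {a} xa ne with view a
        ... | one u = u , proj₁ (φ₁-adj⁻ xa) , (λ { refl → proj₂ (φ₁-adj⁻ xa) (inj₁ (refl , refl)) }) , ne
        ... | two w w≢z with φ₁₂-adj⁻ w≢z xa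
        ... | zw , e = contradiction (w , (zw , sym (end-inj {true} {A w} e)) , ne) none
        witness : ∃ λ u → Adj G₁ x u × u ≢ y × f (φ₁ u) ≢ α
        witness with f a Fin.≟ α
        ... | no ne = from xa ne
        ... | yes e = from xb (λ e′ → fa≢fb (trans e (sym e′)))

      build : Choice → Extension (φ₁ x) f
      build (γ , (u , xu , u≢y , fu≢γ) , f₂-nonconstant)
        with S₁.extend x (f₁ γ) (u , y , xu , xy , λ e → fu≢γ (trans (sym (f₁-≢y γ u≢y)) (trans e (f₁-y γ))))
      ... | c₁ , proper₁ , demand₁
        with S₂.extend z (f₂ (c₁ y)) (f₂-nonconstant (c₁ y) (λ e → demand₁ xy (trans e (sym (f₁-y γ)))))
      ... | c₂ , proper₂ , demand₂ = glue c₁ c₂ ,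
        glue-proper (_≢ φ₁ x)
          (λ s s′ uu′ _ → proper₁ (s ∘ cong φ₁) (s′ ∘ cong φ₁) uu′)
          (λ ne n′ _ _ → proper₂ ne n′)
          (λ {w} _ s _ zw → cross w s zw) ,
        demand
        where
        cross : ∀ w → φ₁ (end (A w)) ≢ φ₁ x → Adj G₂ z w → c₁ (end (A w)) ≢ c₂ w
        cross w s zw with A w in eq
        ... | true = contradiction refl s
        ... | false = λ e → demand₂ zw (trans (sym e) (sym (f₂-B (c₁ y) eq)))
        demand : ∀ {a} → Adj H (φ₁ x) a → glue c₁ c₂ a ≢ f a
        demand {a} xa with view a
        ... | one u′ = λ e → demand₁ (proj₁ (φ₁-adj⁻ xa)) (trans (sym (glue-φ₁ u′)) (trans e
                (sym (f₁-≢y γ (λ { refl → proj₂ (φ₁-adj⁻ xa) (inj₁ (refl , refl)) })))))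
        ... | two w w≢z = λ e → demand₂ (proj₁ (φ₁₂-adj⁻ w≢z xa)) (trans (sym (glue-φ₂ w w≢z)) (trans e
                (sym (f₂-A (c₁ y) (sym (end-inj {true} {A w} (proj₂ (φ₁₂-adj⁻ w≢z xa))))))))

    -- If the colours of `x` and `y` differ, the edge `xy` can be restored and `G₁` is coloured; if
    -- they agree, the two halves of `z` can be merged and `G₂` is coloured.
    comp-uncolourable : ¬ Colorable3 H
    comp-uncolourable (c , proper) with c (φ₁ x) Fin.≟ c (φ₁ y)
    ... | no ne = S₁.uncolourable (c ∘ φ₁ , λ u u′ → proper₁ u u′)
      where
      proper₁ : ∀ u u′ → Adj G₁ u u′ → c (φ₁ u) ≢ c (φ₁ u′)
      proper₁ u u′ uu′ with IsXY? u u′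
      ... | no p = proper _ _ (φ₁-adj⁺ uu′ p)
      ... | yes (inj₁ (refl , refl)) = ne
      ... | yes (inj₂ (refl , refl)) = ne ∘ sym
    ... | yes e = S₂.uncolourable (c ∘ ψ true , λ w w′ ww′ e′ →
        proper _ _ (ψ-adj⁺ ww′) (trans (indep (A w′) true w) (trans e′ (indep true (A w) w′))))
      where
      at-end : ∀ b → c (φ₁ (end b)) ≡ c (φ₁ x)
      at-end true = refl
      at-end false = sym e
      indep : ∀ b b′ w → c (ψ b w) ≡ c (ψ b′ w)
      indep b b′ w with w Fin.≟ z
      ... | yes _ = trans (at-end b) (sym (at-end b′))
      ... | no _ = refl

  module Connectivity (C : OreComp G₁ G₂ H) where
    open Comp C

    module _ (P : Fin (n H) → Set) where

      infix 4 _⟶_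
      _⟶_ : Fin (n H) → Fin (n H) → Set
      a ⟶ b = P a → P b

      AllOne : Set
      AllOne = ∀ u u′ → φ₁ u ⟶ φ₁ u′

      ψ-⟶ : AllOne → ∀ b c w → ψ b w ⟶ ψ c w
      ψ-⟶ all b c w with w Fin.≟ z
      ... | yes _ = all _ _
      ... | no _ = id

      -- A path of G₁ through xy can be rerouted through the split G₂.
      detour : (∀ {w w′} → w ≢ z → w′ ≢ z → φ₂ w ⟶ φ₂ w′) →
        (∀ {w} → Adj G₂ z w → φ₁ (end (A w)) ⟶ φ₂ w) → (∀ {w} → Adj G₂ z w → φ₂ w ⟶ φ₁ (end (A w))) →
        ∀ b c → φ₁ (end b) ⟶ φ₁ (end c)
      detour all₂ down up b c p with exit b | exit c
        where
        exit : ∀ b → ∃ λ w → Adj G₂ z w × A w ≡ b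
        exit true = A-ne₁
        exit false = A-ne₂
      ... | w , zw , refl | w′ , zw′ , refl =
        up zw′ (all₂ (λ e → Adj-≢ G₂ zw (sym e)) (λ e → Adj-≢ G₂ zw′ (sym e)) (down zw p))

      -- All vertices in `Q` are joined through a single crossing edge on side `b`. `Q` describes
      -- the vertices left after a deletion, and `b` a side whose end is still present.
      one-two : ∀ {b} → (∃ λ w → Adj G₂ z w × A w ≡ b) → ∀ {Q : Fin (n H) → Set} →
        (∀ {a} → Q (φ₁ a) → φ₁ a ⟶ φ₁ (end b)) → (∀ {a} → Q (φ₁ a) → φ₁ (end b) ⟶ φ₁ a) →
        (∀ {w w′} → w ≢ z → w′ ≢ z → φ₂ w ⟶ φ₂ w′) →
        (∀ {w} → Adj G₂ z w → A w ≡ b → φ₁ (end (A w)) ⟶ φ₂ w) →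
        (∀ {w} → Adj G₂ z w → A w ≡ b → φ₂ w ⟶ φ₁ (end (A w))) →
        ∀ {a c} → Q a → Q c → a ⟶ c
      one-two (w₀ , zw₀ , refl) {Q} to from all₂ down up {a} {c} qa qc p = out qc (inn qa p)
        where
        w₀≢z : w₀ ≢ z
        w₀≢z e = Adj-≢ G₂ zw₀ (sym e)
        inn : ∀ {a} → Q a → a ⟶ φ₂ w₀
        inn {a} qa p with view a
        ... | one u = down zw₀ refl (to qa p)
        ... | two w ne = all₂ ne w₀≢z p
        out : ∀ {a} → Q a → φ₂ w₀ ⟶ a
        out {a} qa p with view a
        ... | one u = from qa (up zw₀ refl p)
        ... | two w ne = all₂ w₀≢z ne p

    φ₂≢φ₁ : ∀ {u w} → w ≢ z → φ₂ w ≢ φ₁ u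
    φ₂≢φ₁ ne e = disj _ _ ne (sym e)

    z≢ : ∀ {w} → Adj G₂ z w → w ≢ z
    z≢ zw e = Adj-≢ G₂ zw (sym e)

    -- Once all of `φ₁` is joined, `x` and `y` may be treated as the one vertex `z`, and a path of
    -- `G₂` carried over by `ψ true` joins the rest.
    via-ψ : (P : Fin (n H) → Set) → AllOne P → (∀ w w′ → w ≢ z ⊎ w′ ≢ z → P (ψ true w) → P (ψ true w′)) →
      ∀ a b → P a → P b
    via-ψ P all₁ all₂ a b p = out b (inn a p)
      where
      x→ψ : P (φ₁ x) → P (ψ true z)
      x→ψ = subst P (sym (ψ-z true))
      inn : ∀ a → P a → P (φ₁ x)
      inn a p with view a
      ... | one u = all₁ _ _ p
      ... | two w ne = subst P (ψ-z true) (all₂ w z (inj₁ ne) (subst P (sym (ψ-φ₂ ne)) p))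
      out : ∀ a → P (φ₁ x) → P a
      out a p with view a
      ... | one u = all₁ _ _ p
      ... | two w ne = subst P (ψ-φ₂ ne) (all₂ z w (inj₂ ne) (x→ψ p))

    -- An edge at `φ₂ w` comes from `G₂`. Then `G₁ - xy` is intact and connected, so it plays the
    -- role of `z`, and `G₂` stays connected without the edge.
    cut : (P : Fin (n H) → Set) → ∀ {w h′} → w ≢ z → Adj H (φ₂ w) h′ →
      (∀ {a b} → Adj H a b → ¬ SamePair a b (φ₂ w) h′ → P a → P b) → ∀ a b → P a → P b
    cut P {w} ne a cl with φ₂-neighbour ne a
    ... | w′ , refl , ww′ = via-ψ P all₁ (λ p q _ → all₂ p q)
      where
      all₁ : AllOne P
      all₁ = S₁.2-edge-connected xy (P ∘ φ₁) λ ab p → cl (φ₁-adj⁺ ab p)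
        [ (λ (e , _) → φ₂≢φ₁ ne (sym e)) , (λ (_ , e) → φ₂≢φ₁ ne (sym e)) ]′
      all₂ : ∀ p q → P (ψ true p) → P (ψ true q)
      all₂ = S₂.2-edge-connected ww′ (P ∘ ψ true) λ {a} {b} ab p →
        ψ-⟶ P all₁ (A a) true b ∘ cl (ψ-adj⁺ ab) (p ∘
          [ (λ (e , e′) → inj₁ (ψ≡φ₂ {A b} {a} ne e , ψ-inj {A a} {A w} {b} {w′} e′))
          , (λ (e , e′) → inj₂ (ψ-inj {A b} {A w} {a} {w′} e , ψ≡φ₂ {A a} {b} ne e′)) ]′) ∘ ψ-⟶ P all₁ true (A b) a

    -- Both kinds of connectivity are needed in one induction: if an edge of `G₁` is deleted, it is
    -- the connectedness of `G₂ - z` that provides the detour replacing `xy`.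
    comp-2-edge-connected : ∀ {u v} → Adj H u v → (P : Fin (n H) → Set) →
      (∀ {a b} → Adj H a b → ¬ SamePair a b u v → P a → P b) → ∀ a b → P a → P b
    comp-2-edge-connected {h} {h′} hh P cl with view h | view h′
    -- No vertex is deleted here, so `Q` is a condition that always holds.
    ... | one u | one u′ = λ a b → one-two P A-ne₁ {λ _ → φ₁ x ≡ φ₁ x}
          (λ _ → all₁ _ _) (λ _ → all₁ _ _) all₂ (λ zw _ → down zw) (λ zw _ → up zw) refl refl
      where
      all₂ : ∀ {w w′} → w ≢ z → w′ ≢ z → P (φ₂ w) → P (φ₂ w′)
      all₂ = S₂.2-connected z (P ∘ φ₂) λ ne n′ ww′ → cl (trans (adj₂ _ _ ne n′) ww′)
        [ (λ (e , _) → φ₂≢φ₁ ne e) , (λ (e , _) → φ₂≢φ₁ ne e) ]′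
      down : ∀ {w} → Adj G₂ z w → P (φ₁ (end (A w))) → P (φ₂ w)
      down zw = cl (φ₁₂-adj⁺ zw) [ (λ (_ , e) → φ₂≢φ₁ (z≢ zw) e) , (λ (_ , e) → φ₂≢φ₁ (z≢ zw) e) ]′
      up : ∀ {w} → Adj G₂ z w → P (φ₂ w) → P (φ₁ (end (A w)))
      up zw = cl (Adj-sym H (φ₁₂-adj⁺ zw)) [ (λ (e , _) → φ₂≢φ₁ (z≢ zw) e) , (λ (e , _) → φ₂≢φ₁ (z≢ zw) e) ]′
      all₁ : AllOne P
      all₁ = S₁.2-edge-connected (proj₁ (φ₁-adj⁻ hh)) (P ∘ φ₁) λ {a} {b} ab ne → edge ab ne (IsXY? a b)
        where
        edge : ∀ {a b} → Adj G₁ a b → ¬ SamePair a b u u′ → Dec (IsXY a b) → P (φ₁ a) → P (φ₁ b)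
        edge ab ne (yes (inj₁ (refl , refl))) = detour P all₂ down up true false
        edge ab ne (yes (inj₂ (refl , refl))) = detour P all₂ down up false true
        edge ab ne (no p) = cl (φ₁-adj⁺ ab p) (ne ∘
          [ (λ (e , e′) → inj₁ (φ₁-inj _ _ e , φ₁-inj _ _ e′)) , (λ (e , e′) → inj₂ (φ₁-inj _ _ e , φ₁-inj _ _ e′)) ]′)
    ... | two w ne | _ = cut P ne hh cl
    ... | one u | two w ne = cut P ne (Adj-sym H hh) (λ ab p → cl ab (p ∘ [ inj₂ , inj₁ ]′))

    2-connected-φ₂ : ∀ {w} → w ≢ z → (P : Fin (n H) → Set) →
      (∀ {a b} → a ≢ φ₂ w → b ≢ φ₂ w → Adj H a b → P a → P b) → ∀ {a b} → a ≢ φ₂ w → b ≢ φ₂ w → P a → P b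
    2-connected-φ₂ {w} ne P cl {a} {b} a≢ b≢ p = out b≢ (inn a≢ p)
      where
      all₁ : AllOne P
      all₁ = S₁.2-edge-connected xy (P ∘ φ₁) λ ab p → cl (disj _ _ ne) (disj _ _ ne) (φ₁-adj⁺ ab p)
      ψ≢ : ∀ {b a} → a ≢ w → ψ b a ≢ φ₂ w
      ψ≢ {b} {a} a≢ e = a≢ (ψ≡φ₂ {b} {a} ne e)
      all₂ : ∀ {p q} → p ≢ w → q ≢ w → P (ψ true p) → P (ψ true q)
      all₂ = S₂.2-connected w (P ∘ ψ true) λ {a} {b} a≢ b≢ ab →
        ψ-⟶ P all₁ (A a) true b ∘ cl (ψ≢ {A b} a≢) (ψ≢ {A a} b≢) (ψ-adj⁺ ab) ∘ ψ-⟶ P all₁ true (A b) a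
      inn : ∀ {a} → a ≢ φ₂ w → P a → P (φ₁ x)
      inn {a} a≢ p with view a
      ... | one u = all₁ _ _ p
      ... | two w′ n′ = subst P (ψ-z true) (all₂ (a≢ ∘ cong φ₂) (ne ∘ sym) (subst P (sym (ψ-φ₂ n′)) p))
      out : ∀ {a} → a ≢ φ₂ w → P (φ₁ x) → P a
      out {a} a≢ p with view a
      ... | one u = all₁ _ _ p
      ... | two w′ n′ = subst P (ψ-φ₂ n′) (all₂ (ne ∘ sym) (a≢ ∘ cong φ₂) (subst P (sym (ψ-z true)) p))

    2-connected-interior : ∀ {u} → interior u → (P : Fin (n H) → Set) →
      (∀ {a b} → a ≢ φ₁ u → b ≢ φ₁ u → Adj H a b → P a → P b) → ∀ {a b} → a ≢ φ₁ u → b ≢ φ₁ u → P a → P b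
    2-connected-interior {u} int P cl = one-two P A-ne₁ {_≢ φ₁ u}
      (λ a≢ → all₁ (a≢ ∘ cong φ₁) (int true ∘ sym)) (λ a≢ → all₁ (int true ∘ sym) (a≢ ∘ cong φ₁)) all₂ (λ zw _ → down zw) (λ zw _ → up zw)
      where
      end≢ : ∀ b → φ₁ (end b) ≢ φ₁ u
      end≢ b e = int b (sym (φ₁-inj _ _ e))
      all₂ : ∀ {w w′} → w ≢ z → w′ ≢ z → P (φ₂ w) → P (φ₂ w′)
      all₂ = S₂.2-connected z (P ∘ φ₂) λ ne n′ ww′ → cl (φ₂≢φ₁ ne) (φ₂≢φ₁ n′) (trans (adj₂ _ _ ne n′) ww′)
      down : ∀ {w} → Adj G₂ z w → P (φ₁ (end (A w))) → P (φ₂ w)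
      down {w} zw = cl (end≢ (A w)) (φ₂≢φ₁ (z≢ zw)) (φ₁₂-adj⁺ zw)
      up : ∀ {w} → Adj G₂ z w → P (φ₂ w) → P (φ₁ (end (A w)))
      up {w} zw = cl (φ₂≢φ₁ (z≢ zw)) (end≢ (A w)) (Adj-sym H (φ₁₂-adj⁺ zw))
      all₁ : ∀ {a b} → a ≢ u → b ≢ u → P (φ₁ a) → P (φ₁ b)
      all₁ = S₁.2-connected u (P ∘ φ₁) λ {a} {b} a≢ b≢ ab → edge a≢ b≢ ab (IsXY? a b)
        where
        edge : ∀ {a b} → a ≢ u → b ≢ u → Adj G₁ a b → Dec (IsXY a b) → P (φ₁ a) → P (φ₁ b)
        edge _ _ ab (yes (inj₁ (refl , refl))) = detour P all₂ down up true false
        edge _ _ ab (yes (inj₂ (refl , refl))) = detour P all₂ down up false true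
        edge a≢ b≢ ab (no p) = cl (a≢ ∘ φ₁-inj _ _) (b≢ ∘ φ₁-inj _ _) (φ₁-adj⁺ ab p)

    -- Without `x = z₁` the parts remain joined at `y`, by an edge into the second part of the
    -- neighbourhood of `z`. The edge `xy` of `G₁` disappears together with `x`, so no detour is
    -- involved.
    2-connected-x : (P : Fin (n H) → Set) →
      (∀ {a b} → a ≢ φ₁ x → b ≢ φ₁ x → Adj H a b → P a → P b) → ∀ {a b} → a ≢ φ₁ x → b ≢ φ₁ x → P a → P b
    2-connected-x P cl = one-two P A-ne₂ {_≢ φ₁ x}
      (λ a≢ → all₁ (a≢ ∘ cong φ₁) (x≢y ∘ sym)) (λ a≢ → all₁ (x≢y ∘ sym) (a≢ ∘ cong φ₁)) all₂ down up
      where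
      end≢ : ∀ {b} → b ≡ false → φ₁ (end b) ≢ φ₁ x
      end≢ refl e = x≢y (sym (φ₁-inj _ _ e))
      all₂ : ∀ {w w′} → w ≢ z → w′ ≢ z → P (φ₂ w) → P (φ₂ w′)
      all₂ = S₂.2-connected z (P ∘ φ₂) λ ne n′ ww′ → cl (φ₂≢φ₁ ne) (φ₂≢φ₁ n′) (trans (adj₂ _ _ ne n′) ww′)
      down : ∀ {w} → Adj G₂ z w → A w ≡ false → P (φ₁ (end (A w))) → P (φ₂ w)
      down zw e = cl (end≢ e) (φ₂≢φ₁ (z≢ zw)) (φ₁₂-adj⁺ zw)
      up : ∀ {w} → Adj G₂ z w → A w ≡ false → P (φ₂ w) → P (φ₁ (end (A w)))
      up zw e = cl (φ₂≢φ₁ (z≢ zw)) (end≢ e) (Adj-sym H (φ₁₂-adj⁺ zw))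
      all₁ : ∀ {a b} → a ≢ x → b ≢ x → P (φ₁ a) → P (φ₁ b)
      all₁ = S₁.2-connected x (P ∘ φ₁) λ a≢ b≢ ab → cl (a≢ ∘ φ₁-inj _ _) (b≢ ∘ φ₁-inj _ _)
        (φ₁-adj⁺ ab [ (λ (e , _) → a≢ e) , (λ (_ , e) → b≢ e) ]′)

  comp-structure : OreComp G₁ G₂ H → Structure H
  comp-structure C = record
    { edge = let w , zw , _ = A-ne₁ in _ , _ , φ₁₂-adj⁺ zw
    ; 2-edge-connected = Connectivity.comp-2-edge-connected C
    ; 2-connected = λ v → 2c v (view v)
    ; uncolourable = Colouring.comp-uncolourable C
    ; extend = λ v → ext v (view v) }
    where
    open Comp C
    2c : ∀ v → VertexView v → (P : Fin (n H) → Set) →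
      (∀ {a b} → a ≢ v → b ≢ v → Adj H a b → P a → P b) → ∀ {a b} → a ≢ v → b ≢ v → P a → P b
    2c _ (two w ne) = Connectivity.2-connected-φ₂ C ne
    2c _ (one u) with caseOn u
    ... | is-x refl = Connectivity.2-connected-x C
    ... | is-y refl = Connectivity.2-connected-x (swapOre C)
    ... | is-interior int = Connectivity.2-connected-interior C int
    ext : ∀ v → VertexView v → ∀ f → Colouring.Nonconstant C v f → Colouring.Extension C v f
    ext _ (two w ne) = Colouring.extend-φ₂ C w ne
    ext _ (one u) with caseOn u
    ... | is-x refl = Colouring.extend-x C
    ... | is-y refl = Colouring.extend-x (swapOre C)
    ... | is-interior int = Colouring.extend-interior C u int

ore-structure : ∀ {G} → Ore4 G → Structure G
ore-structure {G} (base K) = K4-structure G K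
ore-structure (comp O₁ O₂ C) = comp-structure (ore-structure O₁) (ore-structure O₂) C

-- Splicing permutations

data Star {D : Set} (π : D → D) : D → D → Set where
  ε   : ∀ {a} → Star π a a
  _◅_ : ∀ a {b} → Star π (π a) b → Star π a b

infixr 5 _◅_ _◅◅_

_◅◅_ : ∀ {D : Set} {π : D → D} {a b c} → Star π a b → Star π b c → Star π a c
ε ◅◅ s = s
(a ◅ r) ◅◅ s = a ◅ (r ◅◅ s)

Star-step : ∀ {D : Set} {π : D → D} {a b} → π a ≡ b → Star π a b
Star-step {a = a} refl = a ◅ ε

Star-≡ : ∀ {D : Set} {π : D → D} {a a′ b} → a ≡ a′ → Star π a′ b → Star π a b
Star-≡ refl s = s

-- The nonempty label classes are exactly the cycles of `π`. Labelled by tails this is the condition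
-- on a rotation system; labelled by faces it identifies the faces without choosing orbit
-- representatives.
record Cyclic {D L : Set} (π : D → D) (label : D → L) : Set where
  field
    invariant : ∀ d → label (π d) ≡ label d
    reach     : ∀ {d d′} → label d ≡ label d′ → Star π d d′

  return : ∀ d → Star π (π d) d
  return d = reach (invariant d)

module _ {X : Set} {m : ℕ} (X↔ : X ↔ Fin m) where

  open Inverse X↔ using (to; from; strictlyInverseˡ; strictlyInverseʳ)

  ↔-dec : DecidableEquality X
  ↔-dec a b with to a Fin.≟ to b
  ... | yes e = yes (trans (sym (strictlyInverseʳ a)) (trans (cong from e) (strictlyInverseʳ b)))
  ... | no ne = no (ne ∘ cong to)

record Removal₁ {X : Set} (m : ℕ) (x : X) : Set where
  field
    size  : ℕ
    m≡    : m ≡ suc size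
    ι     : Fin size → X
    ι-inj : ∀ {i j} → ι i ≡ ι j → i ≡ j
    ι≢    : ∀ {i} → ι i ≢ x
    sur   : ∀ a → a ≢ x → ∃ λ i → ι i ≡ a

abstract
  remove₁ : {X : Set} {m : ℕ} → X ↔ Fin m → (x : X) → Removal₁ m x
  remove₁ {m = zero} X↔ x with Inverse.to X↔ x
  ... | ()
  remove₁ {m = suc k} X↔ x = record
    { size = k ; m≡ = refl
    ; ι = from ∘ punchIn (to x)
    ; ι-inj = λ e → Fin.punchIn-injective (to x) _ _ (from-inj e)
    ; ι≢ = λ {i} e → Fin.punchInᵢ≢i (to x) i (trans (sym (strictlyInverseˡ _)) (cong to e))
    ; sur = λ a ne → punchOut {i = to x} {to a} (λ e → ne (to-inj (sym e))) ,
        trans (cong from (Fin.punchIn-punchOut _)) (strictlyInverseʳ a) }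
    where
    open Inverse X↔ using (to; from; strictlyInverseˡ; strictlyInverseʳ)
    to-inj : ∀ {a b} → to a ≡ to b → a ≡ b
    to-inj {a} {b} e = trans (sym (strictlyInverseʳ a)) (trans (cong from e) (strictlyInverseʳ b))
    from-inj : ∀ {a b} → from a ≡ from b → a ≡ b
    from-inj {a} {b} e = trans (sym (strictlyInverseˡ a)) (trans (cong to e) (strictlyInverseˡ b))

-- Serves both for the two darts of the edge `xy` and for the two faces beside it.
module Removal₂ {X : Set} {m : ℕ} (X↔ : X ↔ Fin m) (x : Bool → X) (x≢ : x true ≢ x false) where

  private
    module A = Removal₁ (remove₁ X↔ (x true))
    other = A.sur (x false) (x≢ ∘ sym)
    module B = Removal₁ (remove₁ (↔-id (Fin A.size)) (proj₁ other))

  size : ℕ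
  size = B.size

  m≡ : m ≡ 2 + size
  m≡ = trans A.m≡ (cong suc B.m≡)

  ι : Fin size → X
  ι = A.ι ∘ B.ι

  ι-inj : ∀ {i j} → ι i ≡ ι j → i ≡ j
  ι-inj = B.ι-inj ∘ A.ι-inj

  ι≢ : ∀ {i} b → ι i ≢ x b
  ι≢ true = A.ι≢
  ι≢ false e = B.ι≢ (A.ι-inj (trans e (sym (proj₂ other))))

  data View : X → Set where
    kept    : ∀ i → View (ι i)
    removed : ∀ b → View (x b)

  view : ∀ a → View a
  view a with ↔-dec X↔ a (x true)
  ... | yes refl = removed true
  ... | no ne with A.sur a ne
  ... | i , refl with i Fin.≟ proj₁ other
  ... | yes refl = subst View (sym (proj₂ other)) (removed false)
  ... | no ne′ with B.sur i ne′
  ... | j , refl = kept j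

  x-inj : ∀ {b c} → x b ≡ x c → b ≡ c
  x-inj {true} {true} _ = refl
  x-inj {true} {false} e = contradiction e x≢
  x-inj {false} {true} e = contradiction (sym e) x≢
  x-inj {false} {false} _ = refl

  module _ {Y : Set} (f : Fin size → Y) (g : Bool → Y) where

    private
      elim-view : ∀ {a} → View a → Y
      elim-view (kept i) = f i
      elim-view (removed b) = g b

    elim : X → Y
    elim a = elim-view (view a)

    elim-ι : ∀ i → elim (ι i) ≡ f i
    elim-ι i = go (view (ι i)) refl
      where
      go : ∀ {a} (v : View a) → a ≡ ι i → elim-view v ≡ f i
      go (kept j) e = cong f (ι-inj e)
      go (removed b) e = contradiction (sym e) (ι≢ b)

    elim-x : ∀ b → elim (x b) ≡ g b
    elim-x b = go (view (x b)) refl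
      where
      go : ∀ {a} (v : View a) → a ≡ x b → elim-view v ≡ g b
      go (kept j) e = contradiction e (ι≢ b)
      go (removed c) e = cong g (x-inj e)

b≢not-b : ∀ {b} → b ≢ not b
b≢not-b {true} ()
b≢not-b {false} ()

≢⇒not : ∀ {b c : Bool} → b ≢ c → b ≡ not c
≢⇒not {true} {true} ne = contradiction refl ne
≢⇒not {true} {false} ne = refl
≢⇒not {false} {true} ne = refl
≢⇒not {false} {false} ne = contradiction refl ne

-- The darts d b are cut out of their cycles of π₁; each gap is closed by the cycle of π₂ through p b, opened behind p b.
module Splice {D₁ D₂ L₁ L₂ : Set} {m₁ m₂ : ℕ} (D₁↔ : D₁ ↔ Fin m₁) (D₂↔ : D₂ ↔ Fin m₂)
  {π₁ : D₁ → D₁} {label₁ : D₁ → L₁} (cyclic₁ : Cyclic π₁ label₁)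
  {π₂ : D₂ → D₂} {label₂ : D₂ → L₂} (cyclic₂ : Cyclic π₂ label₂)
  (d : Bool → D₁) (d≢ : d true ≢ d false) (label-d : ∀ {b} → label₁ (d b) ≢ label₁ (d (not b)))
  (p : Bool → D₂) (label-p : ∀ {b} → label₂ (p b) ≢ label₂ (p (not b)))
  where

  open Removal₂ D₁↔ d d≢

  private
    module C₁ = Cyclic cyclic₁
    module C₂ = Cyclic cyclic₂
    _≟₂_ = ↔-dec D₂↔

  D : Set
  D = Fin size ⊎ D₂

  data View₂ : D₂ → Set where
    at-p  : ∀ b → View₂ (p b)
    plain : ∀ {e} → (∀ b → e ≢ p b) → View₂ e

  view₂ : ∀ e → View₂ e
  view₂ e with e ≟₂ p true | e ≟₂ p false
  ... | yes refl | _ = at-p true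
  ... | no _ | yes refl = at-p false
  ... | no n₁ | no n₂ = plain λ { true → n₁ ; false → n₂ }

  label-p≢ : ∀ {e b} → label₂ e ≡ label₂ (p b) → ∀ {c} → e ≡ p c → c ≡ b
  label-p≢ {b = b} l {c} refl with c Bool.≟ b
  ... | yes e = e
  ... | no ne with ≢⇒not (ne ∘ sym)
  ... | refl = contradiction l label-p

  label-d≢ : ∀ {e b} → label₁ e ≡ label₁ (d b) → ∀ {c} → e ≡ d c → c ≡ b
  label-d≢ {b = b} l {c} refl with c Bool.≟ b
  ... | yes e = e
  ... | no ne with ≢⇒not (ne ∘ sym)
  ... | refl = contradiction l label-d

  -- `rep e` is where the spliced permutation arrives when `π₁` would arrive at `e`; a removed dart
  -- `d b` is replaced by the dart behind `p b`. `π` is given by equations only, since both the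
  -- glued rotation and the glued face permutation have this shape, with the same `rep`.
  module Spliced (rep : D₁ → D) (rep-ι : ∀ i → rep (ι i) ≡ inj₁ i) (rep-d : ∀ b → rep (d b) ≡ inj₂ (π₂ (p b)))
    (π : D → D) (π-ι : ∀ i → π (inj₁ i) ≡ rep (π₁ (ι i))) (π-p : ∀ b → π (inj₂ (p b)) ≡ rep (π₁ (d b)))
    (π-plain : ∀ {e} → (∀ b → e ≢ p b) → π (inj₂ e) ≡ inj₂ (π₂ e)) where

    walk₂ : ∀ {e b} → label₂ e ≡ label₂ (p b) → Star π₂ e (p b) → Star π (inj₂ e) (inj₂ (p b))
    walk₂ _ ε = ε
    walk₂ {b = b} l (e ◅ s) with e ≟₂ p b
    ... | yes refl = ε
    ... | no ne = inj₂ e ◅ Star-≡ (π-plain λ c e≡ → ne (trans e≡ (cong p (label-p≢ l e≡))))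
                    (walk₂ (trans (C₂.invariant e) l) s)

    walk₁ : ∀ {e b} → label₁ e ≡ label₁ (d b) → Star π₁ e (d b) → Star π (rep e) (rep (d b))
    walk₁ _ ε = ε
    walk₁ {e} {b} l (.e ◅ s) with view e
    ... | kept i = Star-≡ (rep-ι i)
                     (inj₁ i ◅ Star-≡ (π-ι i) (walk₁ (trans (C₁.invariant (ι i)) l) s))
    ... | removed c with label-d≢ l refl
    ... | refl = ε

    -- From `p b` the permutation `π` runs through the remainder of the cycle of `d b` and re-enters
    -- `D₂` at the successor of `p b`. So each step of `π₂` is still a walk of `π`.
    through-p : ∀ b → Star π (inj₂ (p b)) (inj₂ (π₂ (p b)))
    through-p b = Star-step (π-p b) ◅◅ subst (Star π _) (rep-d b) (walk₁ (C₁.invariant (d b)) (C₁.return (d b)))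

    lift₂ : ∀ {e e′} → Star π₂ e e′ → Star π (inj₂ e) (inj₂ e′)
    lift₂ ε = ε
    lift₂ (e ◅ s) with view₂ e
    ... | at-p b = through-p b ◅◅ lift₂ s
    ... | plain ne = Star-step (π-plain ne) ◅◅ lift₂ s

    lift₁ : ∀ {e e′} → Star π₁ e e′ → Star π (rep e) (rep e′)
    lift₁ ε = ε
    lift₁ (e ◅ s) with view e
    ... | kept i = Star-≡ (rep-ι i) (Star-step (π-ι i)) ◅◅ lift₁ s
    ... | removed b = Star-≡ (rep-d b) (lift₂ (C₂.return (p b)))
                        ◅◅ Star-step (π-p b) ◅◅ lift₁ s

    -- `j₁` and `j₂` embed the two sets of labels in one, where the label of `d b` is identified
    -- with that of `p b` and there is no other coincidence.
    module Labelled {L : Set} (j₁ : L₁ → L) (j₂ : L₂ → L) (j₁-inj : ∀ {l l′} → j₁ l ≡ j₁ l′ → l ≡ l′)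
      (j₂-inj : ∀ {l l′} → j₂ l ≡ j₂ l′ → l ≡ l′) (j-d : ∀ b → j₁ (label₁ (d b)) ≡ j₂ (label₂ (p b)))
      (j-only : ∀ {l e} → j₁ l ≡ j₂ (label₂ e) → ∃ λ b → l ≡ label₁ (d b) × label₂ e ≡ label₂ (p b)) where

      label : D → L
      label = [ j₁ ∘ label₁ ∘ ι , j₂ ∘ label₂ ]′

      label-rep : ∀ e → label (rep e) ≡ j₁ (label₁ e)
      label-rep e with view e
      ... | kept i = cong label (rep-ι i)
      ... | removed b = trans (cong label (rep-d b)) (trans (cong j₂ (C₂.invariant (p b))) (sym (j-d b)))

      cyclic : Cyclic π label
      cyclic = record { invariant = inv ; reach = λ {h} {h′} → reach h h′ }
        where
        inv : ∀ h → label (π h) ≡ label h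
        inv (inj₁ i) = trans (cong label (π-ι i)) (trans (label-rep _) (cong j₁ (C₁.invariant (ι i))))
        inv (inj₂ e) with view₂ e
        ... | at-p b = trans (cong label (π-p b)) (trans (label-rep _) (trans (cong j₁ (C₁.invariant (d b))) (j-d b)))
        ... | plain ne = trans (cong label (π-plain ne)) (cong j₂ (C₂.invariant e))
        reach : ∀ h h′ → label h ≡ label h′ → Star π h h′
        reach (inj₁ i) (inj₁ j) l = subst₂ (Star π) (rep-ι i) (rep-ι j) (lift₁ (C₁.reach (j₁-inj l)))
        reach (inj₂ e) (inj₂ e′) l = lift₂ (C₂.reach (j₂-inj l))
        reach (inj₁ i) (inj₂ e) l with j-only l
        ... | b , l₁ , l₂ = subst₂ (Star π) (rep-ι i) (rep-d b) (lift₁ (C₁.reach l₁))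
                              ◅◅ lift₂ (C₂.reach (trans (C₂.invariant (p b)) (sym l₂)))
        reach (inj₂ e) (inj₁ i) l with j-only (sym l)
        ... | b , l₁ , l₂ = lift₂ (C₂.reach (trans l₂ (sym (C₂.invariant (p b)))))
                              ◅◅ subst₂ (Star π) (rep-d b) (rep-ι i) (lift₁ (C₁.reach (sym l₁)))

    -- A cycle through both parts contains at least two darts of D₁ and three of D₂.
    module No4 (no4₁ : ∀ e → iter π₁ 4 e ≢ e) (no4₂ : ∀ e → iter π₂ 4 e ≢ e) where

      fixed₁ : ∀ {e} → π₁ e ≢ e
      fixed₁ {e} q = no4₁ e (trans (cong (π₁ ∘ π₁ ∘ π₁) q) (trans (cong (π₁ ∘ π₁) q) (trans (cong π₁ q) q)))

      fixed₂ : ∀ {e} → π₂ e ≢ e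
      fixed₂ {e} q = no4₂ e (trans (cong (π₂ ∘ π₂ ∘ π₂) q) (trans (cong (π₂ ∘ π₂) q) (trans (cong π₂ q) q)))

      involutive₁ : ∀ {e} → π₁ (π₁ e) ≢ e
      involutive₁ {e} q = no4₁ e (trans (cong (π₁ ∘ π₁) q) q)

      involutive₂ : ∀ {e} → π₂ (π₂ e) ≢ e
      involutive₂ {e} q = no4₂ e (trans (cong (π₂ ∘ π₂) q) q)

      π₁-d : ∀ b → ∃ λ i → π₁ (d b) ≡ ι i
      π₁-d b = go (view (π₁ (d b))) refl
        where
        go : ∀ {e} → View e → π₁ (d b) ≡ e → ∃ λ i → π₁ (d b) ≡ ι i
        go (kept i) q = i , q
        go (removed c) q with label-d≢ (C₁.invariant (d b)) q
        ... | refl = contradiction q fixed₁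

      rep-inj₁ : ∀ {e i} → rep e ≡ inj₁ i → e ≡ ι i
      rep-inj₁ {e} q with view e
      ... | kept j with trans (sym (rep-ι j)) q
      ... | refl = refl
      rep-inj₁ {e} q | removed b with trans (sym (rep-d b)) q
      ... | ()

      rep-inj₂ : ∀ {e f} → rep e ≡ inj₂ f → ∃ λ b → e ≡ d b × f ≡ π₂ (p b)
      rep-inj₂ {e} q with view e
      ... | kept j with trans (sym (rep-ι j)) q
      ... | ()
      rep-inj₂ {e} q | removed b with trans (sym (rep-d b)) q
      ... | refl = b , refl , refl

      π-p-inj₁ : ∀ b → ∃ λ i → π (inj₂ (p b)) ≡ inj₁ i × π₁ (d b) ≡ ι i
      π-p-inj₁ b with π₁-d b
      ... | i , q = i , trans (π-p b) (trans (cong rep q) (rep-ι i)) , q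

      step₁ : ∀ {i j} → π (inj₁ i) ≡ inj₁ j → π₁ (ι i) ≡ ι j
      step₁ {i} q = rep-inj₁ (trans (sym (π-ι i)) q)

      step₂ : ∀ {e f} → π (inj₂ e) ≡ inj₂ f → π₂ e ≡ f
      step₂ {e} q with view₂ e
      ... | plain ne = Sum.inj₂-injective (trans (sym (π-plain ne)) q)
      ... | at-p b with trans (sym q) (proj₁ (proj₂ (π-p-inj₁ b)))
      ... | ()

      -- As `π₂` has no cycle of length 1 or 2, `e₀` and `e₁` differ from `p b`. So four steps from
      -- `i` can lead back only by way of `e₀`, `e₁` and `e₂ = p b`, and then `ι i` and `d b` would
      -- form a cycle of length 2 of `π₁`.
      crossing : ∀ {i f} → π (inj₁ i) ≡ inj₂ f → iter π 4 (inj₁ i) ≢ inj₁ i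
      crossing {i} q₀ q with rep-inj₂ (trans (sym (π-ι i)) q₀)
      ... | b , π₁i , refl = finish (view₂ e₂) refl
        where
        e₀ e₁ e₂ : D₂
        e₀ = π₂ (p b)
        e₁ = π₂ e₀
        e₂ = π₂ e₁
        l₀ : label₂ e₀ ≡ label₂ (p b)
        l₀ = C₂.invariant (p b)
        l₁ = trans (C₂.invariant e₀) l₀
        l₂ = trans (C₂.invariant e₁) l₁
        q₁ : π (inj₂ e₀) ≡ inj₂ e₁
        q₁ = π-plain λ c r → fixed₂ (trans r (cong p (label-p≢ l₀ r)))
        q₂ : π (inj₂ e₁) ≡ inj₂ e₂
        q₂ = π-plain λ c r → involutive₂ (trans r (cong p (label-p≢ l₁ r)))
        π-e₂ : π (inj₂ e₂) ≡ inj₁ i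
        π-e₂ = trans (cong π (sym (trans (cong (π ∘ π) q₀) (trans (cong π q₁) q₂)))) q
        finish : ∀ {e} → View₂ e → e ≡ e₂ → ⊥
        finish (plain ne) refl with trans (sym (π-plain ne)) π-e₂
        ... | ()
        finish (at-p c) r with label-p≢ l₂ (sym r) | π-p-inj₁ c
        ... | refl | j , πp , π₁d with trans (sym πp) (trans (cong (π ∘ inj₂) r) π-e₂)
        ... | refl = involutive₁ (trans (cong π₁ π₁i) π₁d)

      which : ∀ (h : D) → (∃ λ i → h ≡ inj₁ i) ⊎ (∃ λ e → h ≡ inj₂ e)
      which (inj₁ i) = inj₁ (i , refl)
      which (inj₂ e) = inj₂ (e , refl)

      shift : ∀ {h h′} → π h ≡ h′ → iter π 4 h ≡ h → iter π 4 h′ ≡ h′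
      shift refl q = cong π q

      last : ∀ {h₀ h₁ h₂ h₃} → π h₀ ≡ h₁ → π h₁ ≡ h₂ → π h₂ ≡ h₃ → iter π 4 h₀ ≡ h₀ → π h₃ ≡ h₀
      last refl refl refl q = q

      no4-inj₁ : ∀ i → iter π 4 (inj₁ i) ≢ inj₁ i
      no4-inj₁ i q with which (π (inj₁ i))
      ... | inj₂ (f , q₀) = crossing q₀ q
      ... | inj₁ (i₁ , q₀) with which (π (inj₁ i₁))
      ... | inj₂ (f , q₁) = crossing q₁ (shift q₀ q)
      ... | inj₁ (i₂ , q₁) with which (π (inj₁ i₂))
      ... | inj₂ (f , q₂) = crossing q₂ (shift q₁ (shift q₀ q))
      ... | inj₁ (i₃ , q₂) = no4₁ (ι i) (trans (cong (π₁ ∘ π₁ ∘ π₁) (step₁ q₀)) (trans (cong (π₁ ∘ π₁) (step₁ q₁))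
                        (trans (cong π₁ (step₁ q₂)) (step₁ (last q₀ q₁ q₂ q)))))

      no4 : ∀ h → iter π 4 h ≢ h
      no4 (inj₁ i) = no4-inj₁ i
      no4 (inj₂ e) q with which (π (inj₂ e))
      ... | inj₁ (i , q₀) = no4-inj₁ i (shift q₀ q)
      ... | inj₂ (e₁ , q₀) with which (π (inj₂ e₁))
      ... | inj₁ (i , q₁) = no4-inj₁ i (shift q₁ (shift q₀ q))
      ... | inj₂ (e₂ , q₁) with which (π (inj₂ e₂))
      ... | inj₁ (i , q₂) = no4-inj₁ i (shift q₂ (shift q₁ (shift q₀ q)))
      ... | inj₂ (e₃ , q₂) = no4₂ e (trans (cong (π₂ ∘ π₂ ∘ π₂) (step₂ q₀)) (trans (cong (π₂ ∘ π₂) (step₂ q₁))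
                        (trans (cong π₂ (step₂ q₂)) (step₂ (last q₀ q₁ q₂ q)))))

-- Gluing plane embeddings

-- The labels of the faces replace counting orbits; no face passes twice through a vertex, and none has length 1, 2 or 4.
record GoodEmbedding (G : Graph) : Set₁ where
  field
    D L      : Set
    m k      : ℕ
    D↔       : D ↔ Fin m
    L↔       : L ↔ Fin k
    tl hd    : D → Fin (n G)
    dart-adj : ∀ d → Adj G (tl d) (hd d)
    dart-inj : ∀ {d d′} → tl d ≡ tl d′ → hd d ≡ hd d′ → d ≡ d′
    dart-sur : ∀ {u v} → Adj G u v → ∃ λ d → tl d ≡ u × hd d ≡ v
    rev      : D → D
    rev-tl   : ∀ d → tl (rev d) ≡ hd d
    rev-hd   : ∀ d → hd (rev d) ≡ tl d
    rot      : D → D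
    rot-cyclic : Cyclic rot tl
    face     : D → L
    face-cyclic : Cyclic (rot ∘ rev) face
    face-sur : ∀ l → ∃ λ d → face d ≡ l
    euler    : 2 * n G + 2 * k ≡ m + 4
    simple   : ∀ {d d′} → tl d ≡ tl d′ → face d ≡ face d′ → d ≡ d′
    rot≢     : ∀ d → rot d ≢ d
    no4      : ∀ d → iter (rot ∘ rev) 4 d ≢ d

  module Rot = Cyclic rot-cyclic
  module Face = Cyclic face-cyclic

  rev-rev : ∀ d → rev (rev d) ≡ d
  rev-rev d = dart-inj (trans (rev-tl (rev d)) (rev-hd d)) (trans (rev-hd (rev d)) (rev-tl d))

  hd≢tl : ∀ {d v} → tl d ≡ v → hd d ≢ v
  hd≢tl {d} refl e = Adj-≢ G (dart-adj d) (sym e)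

  -- The darts `rev d` and `rot (rev d)` start at the same vertex, and the latter lies on the face
  -- of `d`. If both sides of the edge were the same face, that face would pass twice through this
  -- vertex.
  face-rev : ∀ d → face (rev d) ≢ face d
  face-rev d e = rot≢ (rev d) (simple (Rot.invariant (rev d)) (trans (Face.invariant d) (sym e)))

-- last b is the last dart of the block A = b in the rotation around z.
record Consecutive {G : Graph} (E : GoodEmbedding G) (z : Fin (n G)) (A : Fin (n G) → Bool) : Set where
  open GoodEmbedding E
  field
    last    : Bool → D
    last-tl : ∀ b → tl (last b) ≡ z
    last-A  : ∀ b → A (hd (last b)) ≡ b
    next-A  : ∀ b → A (hd (rot (last b))) ≡ not b
    stay    : ∀ {b d} → tl d ≡ z → A (hd d) ≡ b → d ≢ last b → A (hd (rot d)) ≡ b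

module Glue {G₁ G₂ H : Graph} (C : OreComp G₁ G₂ H) (E₁ : GoodEmbedding G₁) (E₂ : GoodEmbedding G₂)
  (K : Consecutive E₂ (OreComp.z C) (OreComp.A C)) where

  open Comp C
  private
    module E₁ = GoodEmbedding E₁
    module E₂ = GoodEmbedding E₂
    module K = Consecutive K

  dart-xy : ∃ λ d → E₁.tl d ≡ x × E₁.hd d ≡ y
  dart-xy = E₁.dart-sur xy

  d : Bool → E₁.D
  d true = proj₁ dart-xy
  d false = E₁.rev (proj₁ dart-xy)

  tl-d : ∀ b → E₁.tl (d b) ≡ end b
  tl-d true = proj₁ (proj₂ dart-xy)
  tl-d false = trans (E₁.rev-tl _) (proj₂ (proj₂ dart-xy))

  rev-d : ∀ b → E₁.rev (d b) ≡ d (not b)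
  rev-d true = refl
  rev-d false = E₁.rev-rev _

  hd-d : ∀ b → E₁.hd (d b) ≡ end (not b)
  hd-d b = trans (sym (E₁.rev-tl (d b))) (trans (cong E₁.tl (rev-d b)) (tl-d (not b)))

  d≢ : d true ≢ d false
  d≢ e = x≢y (trans (sym (tl-d true)) (trans (cong E₁.tl e) (tl-d false)))

  label-d : ∀ {b} → E₁.face (d b) ≢ E₁.face (d (not b))
  label-d {b} e = E₁.face-rev (d b) (trans (cong E₁.face (rev-d b)) (sym e))

  module R = Removal₂ E₁.D↔ d d≢
  open R using (ι; ι≢; ι-inj)

  D : Set
  D = Fin R.size ⊎ E₂.D

  first : Bool → E₂.D
  first b = E₂.rot (K.last (not b))

  first-tl : ∀ b → E₂.tl (first b) ≡ z
  first-tl b = trans (E₂.Rot.invariant _) (K.last-tl (not b))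

  first-A : ∀ b → A (E₂.hd (first b)) ≡ b
  first-A b = trans (K.next-A (not b)) (Bool.not-involutive b)

  rep : E₁.D → D
  rep = R.elim inj₁ (inj₂ ∘ first)

  rep-ι : ∀ i → rep (ι i) ≡ inj₁ i
  rep-ι = R.elim-ι inj₁ (inj₂ ∘ first)

  rep-d : ∀ b → rep (d b) ≡ inj₂ (first b)
  rep-d = R.elim-x inj₁ (inj₂ ∘ first)

  last≢ : ∀ {b} → K.last b ≢ K.last (not b)
  last≢ {b} e = b≢not-b (trans (sym (K.last-A b)) (trans (cong (A ∘ E₂.hd) e) (K.last-A (not b))))

  data At : E₂.D → Set where
    at-last : ∀ b → At (K.last b)
    plain   : ∀ {e} → (∀ b → e ≢ K.last b) → At e

  at : ∀ e → At e
  at e with ↔-dec E₂.D↔ e (K.last true) | ↔-dec E₂.D↔ e (K.last false)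
  ... | yes refl | _ = at-last true
  ... | no _ | yes refl = at-last false
  ... | no p | no q = plain λ { true → p ; false → q }

  module _ {Y : Set} (f : Bool → Y) (g : E₂.D → Y) where

    switch-at : ∀ {e} → At e → Y
    switch-at (at-last b) = f b
    switch-at {e} (plain _) = g e

    switch : E₂.D → Y
    switch e = switch-at (at e)

    switch-last : ∀ b → switch (K.last b) ≡ f b
    switch-last b = go (at (K.last b)) refl
      where
      go : ∀ {e} (v : At e) → e ≡ K.last b → switch-at v ≡ f b
      go (plain p) e = contradiction e (p b)
      go (at-last c) e with c Bool.≟ b
      ... | yes refl = refl
      ... | no ne with ≢⇒not ne
      ... | refl = contradiction (sym e) last≢

    switch-plain : ∀ {e} → (∀ b → e ≢ K.last b) → switch e ≡ g e
    switch-plain {e} p = go (at e) p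
      where
      go : ∀ {e} (v : At e) → (∀ b → e ≢ K.last b) → switch-at v ≡ g e
      go (plain _) p = refl
      go (at-last b) p = contradiction refl (p b)

  -- The rotation around z₁ and z₂ after splitting z.
  split-rot : E₂.D → E₂.D
  split-rot = switch first E₂.rot

  split-tl split-hd : E₂.D → Fin (n H)
  split-tl e = ψ (A (E₂.hd e)) (E₂.tl e)
  split-hd e = ψ (A (E₂.tl e)) (E₂.hd e)

  split-tl-z : ∀ {e} → E₂.tl e ≡ z → split-tl e ≡ φ₁ (end (A (E₂.hd e)))
  split-tl-z {e} q = trans (cong (ψ (A (E₂.hd e))) q) (ψ-z _)

  -- From a dart at `z` the split rotation reaches the last dart of its block, jumps to the first
  -- one, and from there reaches the whole block.
  split-cyclic : Cyclic split-rot split-tl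
  split-cyclic = record { invariant = inv ; reach = λ {e} {e′} → reach e e′ (E₂.tl e Fin.≟ z) }
    where
    split-last : ∀ b → split-rot (K.last b) ≡ first b
    split-last = switch-last first E₂.rot
    split-plain : ∀ {e} → (∀ b → e ≢ K.last b) → split-rot e ≡ E₂.rot e
    split-plain = switch-plain first E₂.rot
    inv : ∀ e → split-tl (split-rot e) ≡ split-tl e
    inv e with at e
    ... | at-last b = trans (split-tl-z (first-tl b))
            (trans (cong (φ₁ ∘ end) (trans (first-A b) (sym (K.last-A b)))) (sym (split-tl-z (K.last-tl b))))
    ... | plain p = go (E₂.tl e Fin.≟ z)
      where
      go : Dec (E₂.tl e ≡ z) → split-tl (E₂.rot e) ≡ split-tl e
      go (yes q) = trans (split-tl-z (trans (E₂.Rot.invariant e) q))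
        (trans (cong (φ₁ ∘ end) (K.stay q refl (p _))) (sym (split-tl-z q)))
      go (no ne) = trans (cong (ψ (A (E₂.hd (E₂.rot e)))) (E₂.Rot.invariant e)) (ψ-indep ne)
    away : ∀ {e e′} → E₂.tl e ≢ z → Star E₂.rot e e′ → Star split-rot e e′
    away ne ε = ε
    away ne (e ◅ s) = e ◅ Star-≡ (split-plain λ { b refl → ne (K.last-tl b) }) (away (ne ∘ trans (sym (E₂.Rot.invariant e))) s)
    to-last : ∀ {e b} → E₂.tl e ≡ z → A (E₂.hd e) ≡ b → Star E₂.rot e (K.last b) → Star split-rot e (K.last b)
    to-last q a ε = ε
    to-last {e} {b} q a (.e ◅ s) with ↔-dec E₂.D↔ e (K.last b)
    ... | yes refl = ε
    ... | no ne = e ◅ Star-≡ (split-plain avoid) (to-last (trans (E₂.Rot.invariant e) q) (K.stay q a ne) s)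
      where
      avoid : ∀ c → e ≢ K.last c
      avoid c refl = ne (cong K.last (trans (sym (K.last-A c)) a))
    -- The hypothesis on `e` is an invariant along the rotation of `E₂`: if the current dart is in
    -- block `b`, it is reachable from `first b`. It survives because a block is entered only at its
    -- first dart, and it holds vacuously at the last dart of the other block, where the walk
    -- starts.
    from-first : ∀ {e e′ b} → E₂.tl e ≡ z → (A (E₂.hd e) ≡ b → Star split-rot (first b) e) → A (E₂.hd e′) ≡ b →
                 Star E₂.rot e e′ → Star split-rot (first b) e′
    from-first q h a ε = h a
    from-first {e} {e′} {b} q h a (.e ◅ s) = from-first (trans (E₂.Rot.invariant e) q) next a s
      where
      next : A (E₂.hd (E₂.rot e)) ≡ b → Star split-rot (first b) (E₂.rot e)
      next a′ with at e
      ... | at-last c = Star-≡ (cong (E₂.rot ∘ K.last) (trans (cong not (trans (sym a′) (K.next-A c))) (Bool.not-involutive c))) ε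
      next a′ | plain p with A (E₂.hd e) Bool.≟ b
      ... | yes a″ = h a″ ◅◅ Star-step (split-plain p)
      ... | no ne = contradiction (trans (sym (K.stay q refl (p _))) a′) ne
    reach : ∀ e e′ → Dec (E₂.tl e ≡ z) → split-tl e ≡ split-tl e′ → Star split-rot e e′
    reach e e′ (no ne) q = away ne (E₂.Rot.reach (ψ-inj {w = E₂.tl e} {E₂.tl e′} q))
    reach e e′ (yes t) q = to-last t refl (E₂.Rot.reach (trans t (sym (K.last-tl _))))
      ◅◅ Star-step (split-last _)
      ◅◅ from-first (K.last-tl _) (λ a → contradiction (trans (sym a) (K.last-A _)) b≢not-b) (sym same)
           (E₂.Rot.reach (trans (K.last-tl _) (sym t′)))
      where
      t′ : E₂.tl e′ ≡ z
      t′ = trans (sym (ψ-inj {w = E₂.tl e} {E₂.tl e′} q)) t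
      same : A (E₂.hd e) ≡ A (E₂.hd e′)
      same = end-inj (φ₁-inj _ _ (trans (sym (split-tl-z t)) (trans q (split-tl-z t′))))

  tail head : D → Fin (n H)
  tail = [ φ₁ ∘ E₁.tl ∘ ι , split-tl ]′
  head = [ φ₁ ∘ E₁.hd ∘ ι , split-hd ]′

  -- The block on side `b` takes the place of the dart `d b` around `end b`: the predecessor of
  -- `d b` leads to `first b`, and the last dart of the block leads to the successor of `d b`.
  rot : D → D
  rot = [ (λ i → rep (E₁.rot (ι i))) , switch (λ b → rep (E₁.rot (d b))) (inj₂ ∘ E₂.rot) ]′

  rot-last : ∀ b → rot (inj₂ (K.last b)) ≡ rep (E₁.rot (d b))
  rot-last = switch-last (λ b → rep (E₁.rot (d b))) (inj₂ ∘ E₂.rot)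

  rot-plain : ∀ {e} → (∀ b → e ≢ K.last b) → rot (inj₂ e) ≡ inj₂ (E₂.rot e)
  rot-plain = switch-plain (λ b → rep (E₁.rot (d b))) (inj₂ ∘ E₂.rot)

  rev₁ : ∀ i → ∃ λ j → ι j ≡ E₁.rev (ι i)
  rev₁ i = go (R.view (E₁.rev (ι i))) refl
    where
    go : ∀ {e} → R.View e → e ≡ E₁.rev (ι i) → ∃ λ j → ι j ≡ E₁.rev (ι i)
    go (R.kept j) q = j , q
    go (R.removed b) q = contradiction
      (trans (sym (E₁.rev-rev (ι i))) (trans (cong E₁.rev (sym q)) (rev-d b))) (ι≢ (not b))

  rev : D → D
  rev = [ inj₁ ∘ proj₁ ∘ rev₁ , inj₂ ∘ E₂.rev ]′

  tl-ι≢ : ∀ {i b} → E₁.tl (ι i) ≡ end b → E₁.hd (ι i) ≢ end (not b)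
  tl-ι≢ {i} {b} t h = ι≢ b (E₁.dart-inj (trans t (sym (tl-d b))) (trans h (sym (hd-d b))))

  φ₁-end≡split-tl : ∀ {u e} → φ₁ u ≡ split-tl e → E₂.tl e ≡ z × u ≡ end (A (E₂.hd e))
  φ₁-end≡split-tl {u} {e} q = ψ≡φ₁ {A (E₂.hd e)} {E₂.tl e} (sym q)

  split-tl-last : ∀ b → split-tl (K.last b) ≡ φ₁ (end b)
  split-tl-last b = trans (split-tl-z (K.last-tl b)) (cong (φ₁ ∘ end) (K.last-A b))

  module RotSplice = Splice E₁.D↔ E₂.D↔ E₁.rot-cyclic split-cyclic d d≢
    (λ {b} q → b≢not-b (end-inj {b} (trans (sym (tl-d b)) (trans q (tl-d (not b))))))
    K.last
    (λ {b} q → b≢not-b (end-inj {b} (φ₁-inj _ _ (trans (sym (split-tl-last b)) (trans q (split-tl-last (not b)))))))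

  module RotSpliced = RotSplice.Spliced rep rep-ι
    (λ b → trans (rep-d b) (cong inj₂ (sym (switch-last first E₂.rot b))))
    rot (λ _ → refl) rot-last
    (λ p → trans (rot-plain p) (cong inj₂ (sym (switch-plain first E₂.rot p))))

  rot-only : ∀ {u e} → φ₁ u ≡ split-tl e → ∃ λ b → u ≡ E₁.tl (d b) × split-tl e ≡ split-tl (K.last b)
  rot-only {u} {e} q = let t , u≡ = φ₁-end≡split-tl {u} {e} q in
    A (E₂.hd e) , trans u≡ (sym (tl-d (A (E₂.hd e)))) , trans (split-tl-z t) (sym (split-tl-last (A (E₂.hd e))))

  module RotLabelled = RotSpliced.Labelled {Fin (n H)} φ₁ id (φ₁-inj _ _) id
    (λ b → trans (cong φ₁ (tl-d b)) (sym (split-tl-last b)))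
    rot-only

  rot-cyclic : Cyclic rot tail
  rot-cyclic = RotLabelled.cyclic

  -- The face permutation of `E₂` sends this dart to `first b`, so it marks the corner at `z` where
  -- block `b` begins. There the face is opened; after the gluing it arrives at `end (not b)`, the
  -- head of `d b`, and continues along the face of `d b`.
  p : Bool → E₂.D
  p b = E₂.rev (K.last (not b))

  φ-p : ∀ b → E₂.rot (E₂.rev (p b)) ≡ first b
  φ-p b = cong E₂.rot (E₂.rev-rev _)

  face-p : ∀ b → E₂.face (first b) ≡ E₂.face (p b)
  face-p b = trans (cong E₂.face (sym (φ-p b))) (E₂.Face.invariant (p b))

  -- The two corners between the blocks lie in different faces, because a face through both would
  -- pass twice through `z`.
  face-first≢ : ∀ {b} → E₂.face (first b) ≢ E₂.face (first (not b))
  face-first≢ {b} q = b≢not-b (trans (sym (first-A b)) (trans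
    (cong (A ∘ E₂.hd) (E₂.simple (trans (first-tl b) (sym (first-tl (not b)))) q)) (first-A (not b))))

  module FaceSplice = Splice E₁.D↔ E₂.D↔ E₁.face-cyclic E₂.face-cyclic d d≢ (λ {b} → label-d {b}) p
    (λ {b} q → face-first≢ {b} (trans (face-p b) (trans q (sym (face-p (not b))))))

  module FaceSpliced = FaceSplice.Spliced rep rep-ι
    (λ b → trans (rep-d b) (cong inj₂ (sym (φ-p b))))
    (rot ∘ rev)
    (λ i → cong (rep ∘ E₁.rot) (proj₂ (rev₁ i)))
    (λ b → trans (cong (rot ∘ inj₂) (E₂.rev-rev _)) (trans (rot-last (not b)) (cong (rep ∘ E₁.rot) (sym (rev-d b)))))
    (λ {e} ne → rot-plain λ b q → ne (not b) (trans (sym (E₂.rev-rev e))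
      (trans (cong E₂.rev q) (cong (E₂.rev ∘ K.last) (sym (Bool.not-involutive b))))))

  faces₁ : Bool → E₁.L
  faces₁ b = E₁.face (d b)

  module RL = Removal₂ E₁.L↔ faces₁ (label-d {true})

  L : Set
  L = Fin RL.size ⊎ E₂.L

  j₁ : E₁.L → L
  j₁ = RL.elim inj₁ (inj₂ ∘ E₂.face ∘ p)

  j₁-ι : ∀ i → j₁ (RL.ι i) ≡ inj₁ i
  j₁-ι = RL.elim-ι inj₁ (inj₂ ∘ E₂.face ∘ p)

  j₁-face : ∀ b → j₁ (faces₁ b) ≡ inj₂ (E₂.face (p b))
  j₁-face = RL.elim-x inj₁ (inj₂ ∘ E₂.face ∘ p)

  face-p-inj : ∀ {b c} → E₂.face (p b) ≡ E₂.face (p c) → b ≡ c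
  face-p-inj {b} {c} q with b Bool.≟ c
  ... | yes e = e
  ... | no ne with ≢⇒not (ne ∘ sym)
  ... | refl = contradiction (trans (face-p b) (trans q (sym (face-p (not b))))) (face-first≢ {b})

  j₁-inj : ∀ {l l′} → j₁ l ≡ j₁ l′ → l ≡ l′
  j₁-inj {l} {l′} q = go (RL.view l) (RL.view l′) q
    where
    go : ∀ {l l′} → RL.View l → RL.View l′ → j₁ l ≡ j₁ l′ → l ≡ l′
    go (RL.kept i) (RL.kept j) q with trans (sym (j₁-ι i)) (trans q (j₁-ι j))
    ... | refl = refl
    go (RL.kept i) (RL.removed b) q with trans (sym (j₁-ι i)) (trans q (j₁-face b))
    ... | ()
    go (RL.removed b) (RL.kept i) q with trans (sym (j₁-ι i)) (trans (sym q) (j₁-face b))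
    ... | ()
    go (RL.removed b) (RL.removed c) q =
      cong faces₁ (face-p-inj (Sum.inj₂-injective (trans (sym (j₁-face b)) (trans q (j₁-face c)))))

  j₁-only : ∀ {l f} → j₁ l ≡ inj₂ f → ∃ λ b → l ≡ faces₁ b × f ≡ E₂.face (p b)
  j₁-only {l} q = go (RL.view l) q
    where
    go : ∀ {l f} → RL.View l → j₁ l ≡ inj₂ f → ∃ λ b → l ≡ faces₁ b × f ≡ E₂.face (p b)
    go (RL.kept i) q with trans (sym (j₁-ι i)) q
    ... | ()
    go (RL.removed b) q = b , refl , Sum.inj₂-injective (trans (sym q) (j₁-face b))

  module FaceLabelled = FaceSpliced.Labelled j₁ inj₂ j₁-inj Sum.inj₂-injective j₁-face j₁-only

  face : D → L
  face = [ j₁ ∘ E₁.face ∘ ι , inj₂ ∘ E₂.face ]′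

  dart-adj : ∀ h → Adj H (tail h) (head h)
  dart-adj (inj₁ i) = φ₁-adj⁺ (E₁.dart-adj (ι i)) λ
    { (inj₁ (t , h)) → tl-ι≢ {i} {true} t h ; (inj₂ (t , h)) → tl-ι≢ {i} {false} t h }
  dart-adj (inj₂ e) = ψ-adj⁺ (E₂.dart-adj e)

  dart-apart : ∀ i e → φ₁ (E₁.tl (ι i)) ≡ split-tl e → φ₁ (E₁.hd (ι i)) ≢ split-hd e
  dart-apart i e t h = E₂.hd≢tl (proj₁ (φ₁-end≡split-tl {e = e} t)) (proj₁ (ψ≡φ₁ {A (E₂.tl e)} {E₂.hd e} (sym h)))

  dart-inj : ∀ {h h′} → tail h ≡ tail h′ → head h ≡ head h′ → h ≡ h′
  dart-inj {inj₁ i} {inj₁ j} t h = cong inj₁ (ι-inj (E₁.dart-inj (φ₁-inj _ _ t) (φ₁-inj _ _ h)))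
  dart-inj {inj₂ e} {inj₂ f} t h =
    cong inj₂ (E₂.dart-inj (ψ-inj {w = E₂.tl e} {E₂.tl f} t) (ψ-inj {w = E₂.hd e} {E₂.hd f} h))
  dart-inj {inj₁ i} {inj₂ e} t h = contradiction h (dart-apart i e t)
  dart-inj {inj₂ e} {inj₁ i} t h = contradiction (sym h) (dart-apart i e (sym t))

  rev-tl : ∀ h → tail (rev h) ≡ head h
  rev-tl (inj₁ i) = cong φ₁ (trans (cong E₁.tl (proj₂ (rev₁ i))) (E₁.rev-tl (ι i)))
  rev-tl (inj₂ e) = cong₂ (λ u v → ψ (A u) v) (E₂.rev-hd e) (E₂.rev-tl e)

  rev-hd : ∀ h → head (rev h) ≡ tail h
  rev-hd (inj₁ i) = cong φ₁ (trans (cong E₁.hd (proj₂ (rev₁ i))) (E₁.rev-hd (ι i)))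
  rev-hd (inj₂ e) = cong₂ (λ u v → ψ (A u) v) (E₂.rev-tl e) (E₂.rev-hd e)

  dart-sur : ∀ {h h′} → Adj H h h′ → ∃ λ e → tail e ≡ h × head e ≡ h′
  dart-sur {h} {h′} a with view h | view h′
  ... | one u | one v with E₁.dart-sur (proj₁ (φ₁-adj⁻ a))
  ... | e , refl , refl = go (R.view e) (proj₂ (φ₁-adj⁻ a))
    where
    go : ∀ {e} → R.View e → ¬ IsXY (E₁.tl e) (E₁.hd e) → ∃ λ f → tail f ≡ φ₁ (E₁.tl e) × head f ≡ φ₁ (E₁.hd e)
    go (R.kept i) ne = inj₁ i , refl , refl
    go (R.removed true) ne = contradiction (inj₁ (tl-d true , hd-d true)) ne
    go (R.removed false) ne = contradiction (inj₂ (tl-d false , hd-d false)) ne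
  dart-sur a | two w ne | _ with φ₂-neighbour ne a
  ... | w′ , refl , ww′ with E₂.dart-sur ww′
  ... | e , refl , refl = inj₂ e , ψ-φ₂ ne , refl
  dart-sur a | one u | two w ne with φ₂-neighbour ne (Adj-sym H a)
  ... | w′ , q , ww′ with E₂.dart-sur (Adj-sym G₂ ww′)
  ... | e , refl , refl = inj₂ e , sym q , ψ-φ₂ ne

  face-sur : ∀ l → ∃ λ h → face h ≡ l
  face-sur (inj₂ l) with E₂.face-sur l
  ... | e , q = inj₂ e , cong inj₂ q
  face-sur (inj₁ i) with E₁.face-sur (RL.ι i)
  ... | e , q = go (R.view e) q
    where
    go : ∀ {e} → R.View e → E₁.face e ≡ RL.ι i → ∃ λ h → face h ≡ inj₁ i
    go (R.kept j) q = inj₁ j , trans (cong j₁ q) (j₁-ι i)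
    go (R.removed b) q = contradiction (sym q) (RL.ι≢ b)

  -- If a dart of each part had the same tail and face, simplicity of `E₂` would make `e` the dart
  -- `first b`, and simplicity of `E₁` would make `ι i` the removed dart `d b`.
  face-apart : ∀ i e → φ₁ (E₁.tl (ι i)) ≡ split-tl e → j₁ (E₁.face (ι i)) ≢ inj₂ (E₂.face e)
  face-apart i e t f with φ₁-end≡split-tl {e = e} t | j₁-only f
  ... | tz , u≡ | b , f₁ , f₂ with E₂.simple (trans tz (sym (first-tl b))) (trans f₂ (sym (face-p b)))
  ... | refl = ι≢ b (E₁.simple (trans u≡ (trans (cong end (first-A b)) (sym (tl-d b)))) f₁)

  simple : ∀ {h h′} → tail h ≡ tail h′ → face h ≡ face h′ → h ≡ h′
  simple {inj₁ i} {inj₁ j} t f = cong inj₁ (ι-inj (E₁.simple (φ₁-inj _ _ t) (j₁-inj f)))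
  simple {inj₂ e} {inj₂ e′} t f = cong inj₂ (E₂.simple (ψ-inj {w = E₂.tl e} {E₂.tl e′} t) (Sum.inj₂-injective f))
  simple {inj₁ i} {inj₂ e} t f = contradiction f (face-apart i e t)
  simple {inj₂ e} {inj₁ i} t f = contradiction (sym f) (face-apart i e (sym t))

  rot-d : ∀ b → ∃ λ i → E₁.rot (d b) ≡ ι i
  rot-d b = go (R.view (E₁.rot (d b))) refl
    where
    go : ∀ {e} → R.View e → E₁.rot (d b) ≡ e → ∃ λ i → E₁.rot (d b) ≡ ι i
    go (R.kept i) q = i , q
    go (R.removed c) q with end-inj {b} {c} (trans (sym (tl-d b)) (trans (sym (E₁.Rot.invariant (d b))) (trans (cong E₁.tl q) (tl-d c))))
    ... | refl = contradiction q (E₁.rot≢ (d b))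

  rot≢ : ∀ h → rot h ≢ h
  rot≢ (inj₁ i) q = go (R.view (E₁.rot (ι i))) refl
    where
    go : ∀ {e} → R.View e → E₁.rot (ι i) ≡ e → ⊥
    go (R.kept j) r with trans (sym (rep-ι j)) (trans (cong rep (sym r)) q)
    ... | refl = E₁.rot≢ (ι i) r
    go (R.removed b) r with trans (sym (rep-d b)) (trans (cong rep (sym r)) q)
    ... | ()
  rot≢ (inj₂ e) q with at e
  ... | plain p = E₂.rot≢ e (Sum.inj₂-injective q)
  ... | at-last b with rot-d b
  ... | i , r with trans (sym (rep-ι i)) (trans (cong rep (sym r)) q)
  ... | ()

  vertices : suc (n H) ≡ n G₁ + n G₂
  vertices = trans (cong suc (Permutation.↔⇒≡ (↔-sym Fin.+↔⊎ ↔-∘ bijection))) (trans (sym (ℕ.+-suc _ _)) (cong (n G₁ +_) (sym V.m≡)))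
    where
    module V = Removal₁ (remove₁ (↔-id (Fin (n G₂))) z)
    to : Fin (n H) → Fin (n G₁) ⊎ Fin V.size
    to h with view h
    ... | one u = inj₁ u
    ... | two w ne = inj₂ (proj₁ (V.sur w ne))
    from : Fin (n G₁) ⊎ Fin V.size → Fin (n H)
    from (inj₁ u) = φ₁ u
    from (inj₂ i) = φ₂ (V.ι i)
    from-to : ∀ h → from (to h) ≡ h
    from-to h with view h
    ... | one u = refl
    ... | two w ne = cong φ₂ (proj₂ (V.sur w ne))
    from-inj : ∀ {s t} → from s ≡ from t → s ≡ t
    from-inj {inj₁ u} {inj₁ v} q = cong inj₁ (φ₁-inj _ _ q)
    from-inj {inj₁ u} {inj₂ j} q = contradiction q (disj _ _ V.ι≢)
    from-inj {inj₂ i} {inj₁ v} q = contradiction (sym q) (disj _ _ V.ι≢)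
    from-inj {inj₂ i} {inj₂ j} q = cong inj₂ (V.ι-inj (φ₂-inj _ _ V.ι≢ V.ι≢ q))
    bijection : Fin (n H) ↔ (Fin (n G₁) ⊎ Fin V.size)
    bijection = mk↔ₛ′ to from (λ s → from-inj (from-to (from s))) from-to

  -- One vertex, one edge and two faces are lost in comparison with the disjoint union, so the two
  -- Euler characteristics give 2 + 2 - 1 + 1 - 2 = 2. Adding 6 to both sides avoids subtraction.
  euler : 2 * n H + 2 * (RL.size + E₂.k) ≡ (R.size + E₂.m) + 4
  euler = ℕ.+-cancelʳ-≡ 6 _ _ (begin
    2 * n H + 2 * (RL.size + E₂.k) + 6                    ≡⟨ lhs (n H) RL.size E₂.k ⟩
    2 * suc (n H) + 2 * (2 + RL.size) + 2 * E₂.k          ≡⟨ cong₂ (λ a b → 2 * a + 2 * b + 2 * E₂.k) vertices (sym RL.m≡) ⟩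
    2 * (n G₁ + n G₂) + 2 * E₁.k + 2 * E₂.k               ≡⟨ mid (n G₁) (n G₂) E₁.k E₂.k ⟩
    (2 * n G₁ + 2 * E₁.k) + (2 * n G₂ + 2 * E₂.k)         ≡⟨ cong₂ _+_ E₁.euler E₂.euler ⟩
    (E₁.m + 4) + (E₂.m + 4)                               ≡⟨ cong (λ a → (a + 4) + (E₂.m + 4)) R.m≡ ⟩
    (2 + R.size + 4) + (E₂.m + 4)                         ≡⟨ rhs R.size E₂.m ⟩
    (R.size + E₂.m) + 4 + 6                               ∎)
    where
    open ≡-Reasoning
    open +-*-Solver
    lhs : ∀ a b c → 2 * a + 2 * (b + c) + 6 ≡ 2 * suc a + 2 * (2 + b) + 2 * c
    lhs = solve 3 (λ a b c → con 2 :* a :+ con 2 :* (b :+ c) :+ con 6 := con 2 :* (con 1 :+ a) :+ con 2 :* (con 2 :+ b) :+ con 2 :* c) refl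
    mid : ∀ a b c e → 2 * (a + b) + 2 * c + 2 * e ≡ (2 * a + 2 * c) + (2 * b + 2 * e)
    mid = solve 4 (λ a b c e → con 2 :* (a :+ b) :+ con 2 :* c :+ con 2 :* e := (con 2 :* a :+ con 2 :* c) :+ (con 2 :* b :+ con 2 :* e)) refl
    rhs : ∀ a b → (2 + a + 4) + (b + 4) ≡ (a + b) + 4 + 6
    rhs = solve 2 (λ a b → (con 2 :+ a :+ con 4) :+ (b :+ con 4) := (a :+ b) :+ con 4 :+ con 6) refl

  glued : GoodEmbedding H
  glued = record
    { D = D ; L = L ; m = R.size + E₂.m ; k = RL.size + E₂.k
    ; D↔ = ↔-sym Fin.+↔⊎ ↔-∘ (↔-id _ ⊎-↔ E₂.D↔) ; L↔ = ↔-sym Fin.+↔⊎ ↔-∘ (↔-id _ ⊎-↔ E₂.L↔)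
    ; tl = tail ; hd = head ; dart-adj = dart-adj ; dart-inj = dart-inj ; dart-sur = dart-sur
    ; rev = rev ; rev-tl = rev-tl ; rev-hd = rev-hd
    ; rot = rot ; rot-cyclic = rot-cyclic
    ; face = face ; face-cyclic = FaceLabelled.cyclic ; face-sur = face-sur
    ; euler = euler ; simple = simple ; rot≢ = rot≢
    ; no4 = FaceSpliced.No4.no4 E₁.no4 E₂.no4 }

-- Embeddings with small vertex degrees

module _ {G : Graph} (E : GoodEmbedding G) where
  open GoodEmbedding E

  module _ {v : Fin (n G)} {A : Fin (n G) → Bool} where

    private
      val : D → Bool
      val = A ∘ hd

    two-blocks : (β : Bool) (last : Bool → D) → (∀ b → tl (last b) ≡ v) →
      val (last β) ≡ β → val (last (not β)) ≡ not β → val (rot (last β)) ≡ not β → val (rot (last (not β))) ≡ β →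
      (∀ {b d} → tl d ≡ v → val d ≡ b → d ≢ last b → val (rot d) ≡ b) → Consecutive E v A
    two-blocks true last t p q r s stay = record
      { last = last ; last-tl = t ; last-A = λ { true → p ; false → q }
      ; next-A = λ { true → r ; false → s } ; stay = stay }
    two-blocks false last t p q r s stay = record
      { last = last ; last-tl = t ; last-A = λ { false → p ; true → q }
      ; next-A = λ { false → r ; true → s } ; stay = stay }

    choose : D → D → Bool → Bool → D
    choose a c true true = a
    choose a c false false = a
    choose a c true false = c
    choose a c false true = c

    choose-same : ∀ {a c} β → choose a c β β ≡ a
    choose-same true = refl
    choose-same false = refl

    choose-other : ∀ {a c} β → choose a c β (not β) ≡ c
    choose-other true = refl
    choose-other false = refl

    blocks : ∀ {a c} β → tl a ≡ v → tl c ≡ v → val a ≡ β → val c ≡ not β → val (rot a) ≡ not β → val (rot c) ≡ β →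
      (∀ {d} → tl d ≡ v → d ≢ a → d ≢ c → val (rot d) ≡ val d) → Consecutive E v A
    blocks {a} {c} β ta tc va vc ra rc rest = two-blocks β last ttl
        (trans (cong val (choose-same β)) va) (trans (cong val (choose-other β)) vc)
        (trans (cong (val ∘ rot) (choose-same β)) ra) (trans (cong (val ∘ rot) (choose-other β)) rc)
        (λ {b} {d} t q ne → trans (rest t (not-a q ne) (not-c q ne)) q)
      where
      last : Bool → D
      last = choose a c β
      ttl : ∀ b → tl (last b) ≡ v
      ttl b with b Bool.≟ β
      ... | yes refl = trans (cong tl (choose-same b)) ta
      ... | no ne with ≢⇒not ne
      ... | refl = trans (cong tl (choose-other β)) tc
      not-a : ∀ {b d} → val d ≡ b → d ≢ last b → d ≢ a
      not-a {b} q ne refl with trans (sym va) q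
      ... | refl = ne (sym (choose-same β))
      not-c : ∀ {b d} → val d ≡ b → d ≢ last b → d ≢ c
      not-c {b} q ne refl with trans (sym vc) q
      ... | refl = ne (sym (choose-other β))

    around₃ : ∀ {a} → rot (rot (rot a)) ≡ a → ∀ {d} → Star rot a d → d ≡ a ⊎ d ≡ rot a ⊎ d ≡ rot (rot a)
    around₃ q ε = 1st refl
    around₃ q (a ◅ s) with around₃ (cong rot q) s
    ... | 1st e = 2nd e
    ... | 2nd e = 3rd e
    ... | 3rd e = 1st (trans e q)

    around₄ : ∀ {a} → rot (rot (rot (rot a))) ≡ a → ∀ {d} → Star rot a d →
              d ≡ a ⊎ d ≡ rot a ⊎ d ≡ rot (rot a) ⊎ d ≡ rot (rot (rot a))
    around₄ q ε = inj₁ refl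
    around₄ q (a ◅ s) with around₄ (cong rot q) s
    ... | inj₁ e = inj₂ (inj₁ e)
    ... | inj₂ (inj₁ e) = inj₂ (inj₂ (inj₁ e))
    ... | inj₂ (inj₂ (inj₁ e)) = inj₂ (inj₂ (inj₂ e))
    ... | inj₂ (inj₂ (inj₂ e)) = inj₁ (trans e q)

    tl-rot : ∀ {a} → tl a ≡ v → tl (rot a) ≡ v
    tl-rot t = trans (Rot.invariant _) t

    odd-one : ∀ {a} → tl a ≡ v → rot (rot (rot a)) ≡ a →
      ∀ β → val a ≡ β → val (rot a) ≡ not β → val (rot (rot a)) ≡ not β → Consecutive E v A
    odd-one {a} t q β p₀ p₁ p₂ = blocks β t (tl-rot (tl-rot t)) p₀ p₂ p₁ (trans (cong val q) p₀) rest
      where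
      rest : ∀ {d} → tl d ≡ v → d ≢ a → d ≢ rot (rot a) → val (rot d) ≡ val d
      rest t′ n₀ n₂ with around₃ q (Rot.reach (trans t (sym t′)))
      ... | 1st e = contradiction e n₀
      ... | 2nd refl = trans p₂ (sym p₁)
      ... | 3rd e = contradiction e n₂

    -- At degree four the blocks are not consecutive if the sides alternate, so the cyclic pattern
    -- is required to be two equal sides followed by two opposite ones.
    consecutive₄ : ∀ {a} → tl a ≡ v → rot (rot (rot (rot a))) ≡ a → ∀ β → val a ≡ β → val (rot a) ≡ not β →
      val (rot (rot a)) ≡ not β → val (rot (rot (rot a))) ≡ β → Consecutive E v A
    consecutive₄ {a} t q β p₀ p₁ p₂ p₃ = blocks β t (tl-rot (tl-rot t)) p₀ p₂ p₁ p₃ rest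
      where
      rest : ∀ {d} → tl d ≡ v → d ≢ a → d ≢ rot (rot a) → val (rot d) ≡ val d
      rest t′ n₀ n₂ with around₄ q (Rot.reach (trans t (sym t′)))
      ... | inj₁ e = contradiction e n₀
      ... | inj₂ (inj₁ refl) = trans p₂ (sym p₁)
      ... | inj₂ (inj₂ (inj₁ e)) = contradiction e n₂
      ... | inj₂ (inj₂ (inj₂ refl)) = trans (cong val q) (trans p₀ (sym p₃))

    -- At degree three one of the two blocks is a single dart, so every separation is consecutive.
    consecutive₃ : ∀ {a} → tl a ≡ v → rot (rot (rot a)) ≡ a →
      (∃ λ w → Adj G v w × A w ≡ true) → (∃ λ w → Adj G v w × A w ≡ false) → Consecutive E v A
    consecutive₃ {a} t q (w , vw , Aw) (w′ , vw′ , Aw′) = go _ _ _ refl refl refl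
      where
      values : ∀ {u} → Adj G v u → A u ≡ val a ⊎ A u ≡ val (rot a) ⊎ A u ≡ val (rot (rot a))
      values vu with dart-sur vu
      ... | e , t′ , refl with around₃ q (Rot.reach (trans t (sym t′)))
      ... | 1st r = 1st (cong val r)
      ... | 2nd r = 2nd (cong val r)
      ... | 3rd r = 3rd (cong val r)
      constant : ∀ b → val a ≡ b → val (rot a) ≡ b → val (rot (rot a)) ≡ b → ∀ {u} → Adj G v u → A u ≡ b
      constant b p₀ p₁ p₂ vu with values vu
      ... | 1st r = trans r p₀
      ... | 2nd r = trans r p₁
      ... | 3rd r = trans r p₂
      t₁ = tl-rot t
      t₂ = tl-rot t₁
      go : ∀ b₀ b₁ b₂ → val a ≡ b₀ → val (rot a) ≡ b₁ → val (rot (rot a)) ≡ b₂ → Consecutive E v A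
      go true true true p₀ p₁ p₂ with trans (sym Aw′) (constant true p₀ p₁ p₂ vw′)
      ... | ()
      go false false false p₀ p₁ p₂ with trans (sym Aw) (constant false p₀ p₁ p₂ vw)
      ... | ()
      go true false false p₀ p₁ p₂ = odd-one t q true p₀ p₁ p₂
      go false true true p₀ p₁ p₂ = odd-one t q false p₀ p₁ p₂
      go false true false p₀ p₁ p₂ = odd-one t₁ (cong rot q) true p₁ p₂ (trans (cong val q) p₀)
      go true false true p₀ p₁ p₂ = odd-one t₁ (cong rot q) false p₁ p₂ (trans (cong val q) p₀)
      go false false true p₀ p₁ p₂ =
        odd-one t₂ (cong (rot ∘ rot) q) true p₂ (trans (cong val q) p₀) (trans (cong (val ∘ rot) q) p₁)
      go true true false p₀ p₁ p₂ =
        odd-one t₂ (cong (rot ∘ rot) q) false p₂ (trans (cong val q) p₀) (trans (cong (val ∘ rot) q) p₁)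

-- The tetrahedral drawing of K₄

Dart₄ : Set
Dart₄ = Fin 4 × Fin 3

-- The second component numbers the neighbours of a vertex in the cyclic order of the tetrahedron,
-- whose four faces are triangles.
hd₄ : Dart₄ → Fin 4
hd₄ (0F , 0F) = 1F
hd₄ (0F , 1F) = 2F
hd₄ (0F , 2F) = 3F
hd₄ (1F , 0F) = 0F
hd₄ (1F , 1F) = 3F
hd₄ (1F , 2F) = 2F
hd₄ (2F , 0F) = 0F
hd₄ (2F , 1F) = 1F
hd₄ (2F , 2F) = 3F
hd₄ (3F , 0F) = 0F
hd₄ (3F , 1F) = 2F
hd₄ (3F , 2F) = 1F

next₃ : Fin 3 → Fin 3
next₃ 0F = 1F
next₃ 1F = 2F
next₃ 2F = 0F

rot₄ : Dart₄ → Dart₄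
rot₄ (v , k) = v , next₃ k

rev₄ : Dart₄ → Dart₄
rev₄ (0F , 0F) = 1F , 0F
rev₄ (0F , 1F) = 2F , 0F
rev₄ (0F , 2F) = 3F , 0F
rev₄ (1F , 0F) = 0F , 0F
rev₄ (1F , 1F) = 3F , 2F
rev₄ (1F , 2F) = 2F , 1F
rev₄ (2F , 0F) = 0F , 1F
rev₄ (2F , 1F) = 1F , 2F
rev₄ (2F , 2F) = 3F , 1F
rev₄ (3F , 0F) = 0F , 2F
rev₄ (3F , 1F) = 2F , 2F
rev₄ (3F , 2F) = 1F , 1F

φ₄ : Dart₄ → Dart₄
φ₄ = rot₄ ∘ rev₄

-- A face of K₄ is labelled by the vertex not on it.
face₄ : Dart₄ → Fin 4
face₄ = hd₄ ∘ rot₄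

_≟₄_ : (d e : Dart₄) → Dec (d ≡ e)
_≟₄_ = ≡-dec Fin._≟_ Fin._≟_

all₄? : {P : Dart₄ → Set} → (∀ d → Dec (P d)) → Dec (∀ d → P d)
all₄? {P} P? with all? {n = 4} (λ v → all? {n = 3} λ k → P? (v , k))
... | yes p = yes λ (v , k) → p v k
... | no np = no λ p → np λ v k → p (v , k)

any₄? : {P : Dart₄ → Set} → (∀ d → Dec (P d)) → Dec (∃ P)
any₄? {P} P? with any? {n = 4} (λ v → any? {n = 3} λ k → P? (v , k))
... | yes (v , k , p) = yes ((v , k) , p)
... | no np = no λ ((v , k) , p) → np (v , k , p)

abstract
  tl₄≢hd₄ : ∀ d → proj₁ d ≢ hd₄ d
  tl₄≢hd₄ = from-yes (all₄? λ d → ¬? (proj₁ d Fin.≟ hd₄ d))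

  dart-inj₄ : ∀ d e → proj₁ d ≡ proj₁ e → hd₄ d ≡ hd₄ e → d ≡ e
  dart-inj₄ = from-yes (all₄? λ d → all₄? λ e → (proj₁ d Fin.≟ proj₁ e) →-dec ((hd₄ d Fin.≟ hd₄ e) →-dec (d ≟₄ e)))

  dart-sur₄ : ∀ u v → u ≢ v → ∃ λ d → proj₁ d ≡ u × hd₄ d ≡ v
  dart-sur₄ = from-yes (all? {n = 4} λ u → all? {n = 4} λ v → ¬? (u Fin.≟ v) →-dec any₄? λ d → (proj₁ d Fin.≟ u) ×-dec (hd₄ d Fin.≟ v))

  rev-tl₄ : ∀ d → proj₁ (rev₄ d) ≡ hd₄ d
  rev-tl₄ = from-yes (all₄? λ d → proj₁ (rev₄ d) Fin.≟ hd₄ d)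

  rev-hd₄ : ∀ d → hd₄ (rev₄ d) ≡ proj₁ d
  rev-hd₄ = from-yes (all₄? λ d → hd₄ (rev₄ d) Fin.≟ proj₁ d)

  rot³₄ : ∀ d → rot₄ (rot₄ (rot₄ d)) ≡ d
  rot³₄ = from-yes (all₄? λ d → rot₄ (rot₄ (rot₄ d)) ≟₄ d)

  rot-orbit₄ : ∀ d e → proj₁ d ≡ proj₁ e → e ≡ d ⊎ e ≡ rot₄ d ⊎ e ≡ rot₄ (rot₄ d)
  rot-orbit₄ = from-yes (all₄? λ d → all₄? λ e → (proj₁ d Fin.≟ proj₁ e) →-dec
    ((e ≟₄ d) ⊎-dec ((e ≟₄ rot₄ d) ⊎-dec (e ≟₄ rot₄ (rot₄ d)))))

  face-invariant₄ : ∀ d → face₄ (φ₄ d) ≡ face₄ d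
  face-invariant₄ = from-yes (all₄? λ d → face₄ (φ₄ d) Fin.≟ face₄ d)

  face-orbit₄ : ∀ d e → face₄ d ≡ face₄ e → e ≡ d ⊎ e ≡ φ₄ d ⊎ e ≡ φ₄ (φ₄ d)
  face-orbit₄ = from-yes (all₄? λ d → all₄? λ e → (face₄ d Fin.≟ face₄ e) →-dec
    ((e ≟₄ d) ⊎-dec ((e ≟₄ φ₄ d) ⊎-dec (e ≟₄ φ₄ (φ₄ d)))))

  face-sur₄ : ∀ l → ∃ λ d → face₄ d ≡ l
  face-sur₄ = from-yes (all? {n = 4} λ l → any₄? λ d → face₄ d Fin.≟ l)

  simple₄ : ∀ d e → proj₁ d ≡ proj₁ e → face₄ d ≡ face₄ e → d ≡ e
  simple₄ = from-yes (all₄? λ d → all₄? λ e → (proj₁ d Fin.≟ proj₁ e) →-dec ((face₄ d Fin.≟ face₄ e) →-dec (d ≟₄ e)))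

  rot≢₄ : ∀ d → rot₄ d ≢ d
  rot≢₄ = from-yes (all₄? λ d → ¬? (rot₄ d ≟₄ d))

  no4₄ : ∀ d → iter φ₄ 4 d ≢ d
  no4₄ = from-yes (all₄? λ d → ¬? (iter φ₄ 4 d ≟₄ d))

orbit₃⇒Star : {D : Set} {π : D → D} {d e : D} → e ≡ d ⊎ e ≡ π d ⊎ e ≡ π (π d) → Star π d e
orbit₃⇒Star (1st refl) = ε
orbit₃⇒Star {d = d} (2nd refl) = d ◅ ε
orbit₃⇒Star {d = d} (3rd refl) = d ◅ _ ◅ ε

module _ {G : Graph} {z c d : Fin (n G)} (F : Frame G z c d) where
  open Frame F

  K4-embedding : GoodEmbedding G
  K4-embedding = record
    { D = Dart₄ ; L = Fin 4 ; m = 12 ; k = 4 ; D↔ = ↔-sym Fin.*↔× ; L↔ = ↔-id _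
    ; tl = ν ∘ proj₁ ; hd = ν ∘ hd₄
    ; dart-adj = λ d → adj⁺ (tl₄≢hd₄ d)
    ; dart-inj = λ t h → dart-inj₄ _ _ (inj t) (inj h)
    ; dart-sur = sur₄
    ; rev = rev₄ ; rev-tl = λ d → cong ν (rev-tl₄ d) ; rev-hd = λ d → cong ν (rev-hd₄ d)
    ; rot = rot₄
    ; rot-cyclic = record { invariant = λ _ → refl ; reach = λ q → orbit₃⇒Star (rot-orbit₄ _ _ (inj q)) }
    ; face = face₄
    ; face-cyclic = record { invariant = face-invariant₄ ; reach = λ q → orbit₃⇒Star (face-orbit₄ _ _ q) }
    ; face-sur = face-sur₄
    ; euler = cong (λ a → 2 * a + 8) size
    ; simple = λ t f → simple₄ _ _ (inj t) f
    ; rot≢ = rot≢₄ ; no4 = no4₄ }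
    where
    sur₄ : ∀ {u v} → Adj G u v → ∃ λ d → ν (proj₁ d) ≡ u × ν (hd₄ d) ≡ v
    sur₄ {u} {v} uv with sur u | sur v
    ... | i , refl | j , refl with dart-sur₄ i j (λ { refl → Adj-≢ G uv refl })
    ... | d , refl , refl = d , refl , refl

record CubicEmbedding (G : Graph) : Set₁ where
  field
    E    : GoodEmbedding G
    rot³ : ∀ d → GoodEmbedding.rot E (GoodEmbedding.rot E (GoodEmbedding.rot E d)) ≡ d

  open GoodEmbedding E

  cubic-consecutive : ∀ v A → (∃ λ w → Adj G v w × A w ≡ true) → (∃ λ w → Adj G v w × A w ≡ false) → Consecutive E v A
  cubic-consecutive v A (w , vw , e) ne with dart-sur vw
  ... | d , t , _ = consecutive₃ E t (rot³ d) (w , vw , e) ne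

K4-cubic : ∀ {G} {z c d : Fin (n G)} → Frame G z c d → CubicEmbedding G
K4-cubic F = record { E = K4-embedding F ; rot³ = rot³₄ }

-- Embedding Ore graphs with few triangles

module GlueConsecutive {G₁ G₂ H : Graph} (C : OreComp G₁ G₂ H) (E₁ : GoodEmbedding G₁) (E₂ : GoodEmbedding G₂)
  (K : Consecutive E₂ (OreComp.z C) (OreComp.A C)) (A′ : Fin (n H) → Bool) where

  open Comp C
  open Glue C E₁ E₂ K
  private
    module E₁ = GoodEmbedding E₁
    module E₂ = GoodEmbedding E₂
    module K = Consecutive K
  open Removal₂ E₁.D↔ d d≢ using (ι; ι≢; ι-inj; kept; removed) renaming (view to dart-view)

  kept-dart : ∀ e → (∀ b → e ≢ d b) → ∃ λ i → ι i ≡ e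
  kept-dart e ne with dart-view e
  ... | kept i = i , refl
  ... | removed b = contradiction refl (ne b)

  kept-interior : ∀ {u} → interior u → ∀ e → E₁.tl e ≡ u → ∃ λ i → ι i ≡ e
  kept-interior int e t = kept-dart e λ { b refl → int b (trans (sym t) (tl-d b)) }

  head-rep : ∀ {e} → (∀ b → e ≢ d b) → head (rep e) ≡ φ₁ (E₁.hd e)
  head-rep {e} ne with kept-dart e ne
  ... | i , refl = cong head (rep-ι i)

  head-rot : ∀ {u} → interior u → ∀ i → E₁.tl (ι i) ≡ u → head (rot (inj₁ i)) ≡ φ₁ (E₁.hd (E₁.rot (ι i)))
  head-rot int i t = head-rep λ b e → int b (trans (sym t) (trans (sym (E₁.Rot.invariant (ι i))) (trans (cong E₁.tl e) (tl-d b))))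

  -- The gluing changes the rotation only around `x` and `y`, so the rotation at `u` is still that
  -- of `E₁`.
  interior-consecutive : ∀ {u} → interior u → Consecutive E₁ u (A′ ∘ φ₁) → Consecutive glued (φ₁ u) A′
  interior-consecutive {u} int K₁ = record
    { last = inj₁ ∘ i
    ; last-tl = λ b → cong φ₁ (tl-i b)
    ; last-A = λ b → trans (cong (A′ ∘ φ₁ ∘ E₁.hd) (ι-i b)) (K₁.last-A b)
    ; next-A = λ b → trans (cong A′ (head-rot int (i b) (tl-i b)))
        (trans (cong (A′ ∘ φ₁ ∘ E₁.hd ∘ E₁.rot) (ι-i b)) (K₁.next-A b))
    ; stay = λ {b} {h} → stay h }
    where
    module K₁ = Consecutive K₁
    i : Bool → _
    i b = proj₁ (kept-interior int (K₁.last b) (K₁.last-tl b))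
    ι-i : ∀ b → ι (i b) ≡ K₁.last b
    ι-i b = proj₂ (kept-interior int (K₁.last b) (K₁.last-tl b))
    tl-i : ∀ b → E₁.tl (ι (i b)) ≡ u
    tl-i b = trans (cong E₁.tl (ι-i b)) (K₁.last-tl b)
    stay : ∀ {b} h → tail h ≡ φ₁ u → A′ (head h) ≡ b → h ≢ inj₁ (i b) → A′ (head (rot h)) ≡ b
    stay {b} (inj₁ j) t a ne = trans (cong A′ (head-rot int j t′))
      (K₁.stay t′ a λ e → ne (cong inj₁ (ι-inj (trans e (sym (ι-i b))))))
      where
      t′ : E₁.tl (ι j) ≡ u
      t′ = φ₁-inj _ _ t
    stay (inj₂ e) t = contradiction (proj₂ (φ₁-end≡split-tl {e = e} (sym t))) (int (A (E₂.hd e)))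

  φ₂-consecutive : ∀ {w} → w ≢ z → Consecutive E₂ w (A′ ∘ ψ (A w)) → Consecutive glued (φ₂ w) A′
  φ₂-consecutive {w} ne K₂ = record
    { last = inj₂ ∘ K₂.last
    ; last-tl = λ b → trans (cong (ψ _) (K₂.last-tl b)) (ψ-φ₂ ne)
    ; last-A = λ b → trans (val (K₂.last-tl b)) (K₂.last-A b)
    ; next-A = λ b → trans (rot-val (K₂.last-tl b)) (K₂.next-A b)
    ; stay = λ {b} {h} → stay h }
    where
    module K₂ = Consecutive K₂
    val : ∀ {e} → E₂.tl e ≡ w → A′ (head (inj₂ e)) ≡ A′ (ψ (A w) (E₂.hd e))
    val {e} t = cong (λ v → A′ (ψ (A v) (E₂.hd e))) t
    rot-val : ∀ {e} → E₂.tl e ≡ w → A′ (head (rot (inj₂ e))) ≡ A′ (ψ (A w) (E₂.hd (E₂.rot e)))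
    rot-val {e} t = trans (cong (A′ ∘ head) (rot-plain λ { b refl → ne (trans (sym t) (K.last-tl b)) }))
      (val (trans (E₂.Rot.invariant e) t))
    stay : ∀ {b} h → tail h ≡ φ₂ w → A′ (head h) ≡ b → h ≢ inj₂ (K₂.last b) → A′ (head (rot h)) ≡ b
    stay (inj₁ i) t = contradiction t (disj _ _ ne)
    stay (inj₂ e) t a e≢ = trans (rot-val t′) (K₂.stay t′ (trans (sym (val t′)) a) (e≢ ∘ cong inj₂))
      where
      t′ : E₂.tl e ≡ w
      t′ = ψ≡φ₂ {A (E₂.hd e)} {E₂.tl e} ne t

  -- If `x` has degree three in `G₁`, the rotation at the merged vertex is `s`, `t`, followed by the
  -- first block from `first true` to `K.last true`. A block of one or two darts gives degree three
  -- or four.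
  module Cubic (rot³ : ∀ e → E₁.rot (E₁.rot (E₁.rot e)) ≡ e) where

    s t : E₁.D
    s = E₁.rot (d true)
    t = E₁.rot s

    tl-s : E₁.tl s ≡ x
    tl-s = trans (E₁.Rot.invariant _) (tl-d true)

    tl-t : E₁.tl t ≡ x
    tl-t = trans (E₁.Rot.invariant _) tl-s

    not-d-false : ∀ {e} → E₁.tl e ≡ x → e ≢ d false
    not-d-false q refl = x≢y (trans (sym q) (tl-d false))

    kept-s : ∃ λ i → ι i ≡ s
    kept-s = kept-dart s λ { true e → E₁.rot≢ _ e ; false → not-d-false tl-s }

    kept-t : ∃ λ i → ι i ≡ t
    kept-t = kept-dart t λ { true e → E₁.rot≢ _ (trans (cong E₁.rot (sym e)) (rot³ _)) ; false → not-d-false tl-t }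

    s′ : D
    s′ = inj₁ (proj₁ kept-s)

    tail-s′ : tail s′ ≡ φ₁ x
    tail-s′ = cong φ₁ (trans (cong E₁.tl (proj₂ kept-s)) tl-s)

    head-s′ : head s′ ≡ φ₁ (E₁.hd s)
    head-s′ = cong (φ₁ ∘ E₁.hd) (proj₂ kept-s)

    rot-s′ : rot s′ ≡ inj₁ (proj₁ kept-t)
    rot-s′ = trans (cong (rep ∘ E₁.rot) (proj₂ kept-s)) (trans (cong rep (sym (proj₂ kept-t))) (rep-ι _))

    rot²-s′ : rot (rot s′) ≡ inj₂ (first true)
    rot²-s′ = trans (cong rot rot-s′) (trans (cong (rep ∘ E₁.rot) (proj₂ kept-t)) (trans (cong rep (rot³ _)) (rep-d true)))

    rot-last-true : rot (inj₂ (K.last true)) ≡ s′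
    rot-last-true = trans (rot-last true) (trans (cong rep (sym (proj₂ kept-s))) (rep-ι _))

    x-consecutive₃ : first true ≡ K.last true →
      (∃ λ h → Adj H (φ₁ x) h × A′ h ≡ true) → (∃ λ h → Adj H (φ₁ x) h × A′ h ≡ false) → Consecutive glued (φ₁ x) A′
    x-consecutive₃ q = consecutive₃ glued {a = s′} tail-s′
      (trans (cong rot (trans rot²-s′ (cong inj₂ q))) rot-last-true)

    x-consecutive₄ : E₂.rot (first true) ≡ K.last true → first true ≢ K.last true →
      A′ (φ₁ (E₁.hd t)) ≡ not (A′ (φ₁ (E₁.hd s))) →
      A′ (φ₂ (E₂.hd (first true))) ≡ not (A′ (φ₁ (E₁.hd s))) →
      A′ (φ₂ (E₂.hd (K.last true))) ≡ A′ (φ₁ (E₁.hd s)) → Consecutive glued (φ₁ x) A′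
    x-consecutive₄ q ne vt vf vl = consecutive₄ glued {a = s′} tail-s′
      (trans (cong rot rot³-s′) rot-last-true)
      (A′ (φ₁ (E₁.hd s))) (cong A′ head-s′)
      (trans (cong (A′ ∘ head) rot-s′) (trans (cong (A′ ∘ φ₁ ∘ E₁.hd) (proj₂ kept-t)) vt))
      (trans (cong (A′ ∘ head) rot²-s′) (trans (cong A′ (at-z (first-tl true))) vf))
      (trans (cong (A′ ∘ head) rot³-s′) (trans (cong A′ (at-z (K.last-tl true))) vl))
      where
      at-z : ∀ {e} → E₂.tl e ≡ z → head (inj₂ e) ≡ φ₂ (E₂.hd e)
      at-z t = ψ-φ₂ (E₂.hd≢tl t)
      first≢ : ∀ b → first true ≢ K.last b
      first≢ true = ne
      first≢ false e with trans (sym (first-A true)) (trans (cong (A ∘ E₂.hd) e) (K.last-A false))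
      ... | ()
      rot³-s′ : rot (rot (rot s′)) ≡ inj₂ (K.last true)
      rot³-s′ = trans (cong rot rot²-s′) (trans (rot-plain first≢) (cong inj₂ q))

-- Drawings with prescribed consecutive blocks, by induction

Separated : (G : Graph) → Fin (n G) → (Fin (n G) → Bool) → Set
Separated G z A = (∃ λ w → Adj G z w × A w ≡ true) × (∃ λ w → Adj G z w × A w ≡ false)

-- At most four, two and no triangles survive in the three cases.
record Embeddable (G : Graph) : Set₁ where
  field
    whole  : ¬ AtLeast 25 (Tri G) → GoodEmbedding G
    split  : ∀ z A → Separated G z A → ¬ AtLeast 13 (λ t → Tri G t × Sp G z A t) →
             Σ (GoodEmbedding G) λ E → Consecutive E z A
    split₂ : ∀ z A v B → Separated G z A → Separated G v B →
             ¬ AtLeast 1 (λ t → Tri G t × Sp G z A t × Sp G v B t) →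
             Σ (GoodEmbedding G) λ E → Consecutive E z A × Consecutive E v B

K4-embeddable : ∀ {G} → IsK4 G → Embeddable G
K4-embeddable {G} k = record
  { whole = λ _ → CubicEmbedding.E cubic
  ; split = λ z A (p , q) _ → CubicEmbedding.E cubic , CubicEmbedding.cubic-consecutive cubic z A p q
  ; split₂ = λ z A v B (p , q) (r , s) _ → CubicEmbedding.E cubic ,
      CubicEmbedding.cubic-consecutive cubic z A p q , CubicEmbedding.cubic-consecutive cubic v B r s }
  where
  cubic : CubicEmbedding G
  cubic with frameAt G k (subst Fin (sym (proj₁ k)) 0F)
  ... | _ , _ , F = K4-cubic F

-- `t` is new because it contains `v`. One of the six orders of a triangle is enough: 7 + 6 = 13
-- already exceeds the allowance of 12.
AtLeast-cons : ∀ {G v k} {P Q : Triple (Fin (n G)) → Set} → (∀ {t} → P t → Avoid G v t → Q t) →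
  ∀ {t} → v ∈₃ t → Q t → AtLeast k (λ t → P t × Avoid G v t) → AtLeast (suc k) Q
AtLeast-cons f {t} v∈ q (L , u , a , l) =
  t ∷ L , All.map (λ { (_ , av) refl → av v∈ }) a ∷ u , q ∷ All.map (λ (p , av) → f p av) a , s≤s l

module _ {G₁ G₂ H : Graph} (C : OreComp G₁ G₂ H) (B₁ : Bounds G₁) (B₂ : Bounds G₂) where

  open Comp C
  private
    module B₁ = Bounds B₁
    module B₂ = Bounds B₂

  Sp-φ₁ : ∀ {u A′ t} → Sp G₁ u (A′ ∘ φ₁) t → Sp H (φ₁ u) A′ (map₃ φ₁ t)
  Sp-φ₁ {t = t} sp u∈ a∈ b∈ a≢ b≢ with ∈₃-map⁻ φ₁ t a∈ | ∈₃-map⁻ φ₁ t b∈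
  ... | a , a∈t , refl | b , b∈t , refl = sp (∈₃-φ₁ u∈) a∈t b∈t (a≢ ∘ cong φ₁) (b≢ ∘ cong φ₁)

  -- If `z` lies on a surviving triangle through `w`, its side there is `A w`. So `ψ (side t)` and
  -- `ψ (A w)` agree on `t`, and the condition at `w` can be transported.
  Sp-φ₂ : ∀ {w A′ t} → w ≢ z → Tri G₂ t → Sp G₂ z A t → Sp G₂ w (A′ ∘ ψ (A w)) t → Sp H (φ₂ w) A′ (image t)
  Sp-φ₂ {w} {A′} {t} ne tr spz sp w∈ a∈ b∈ a≢ b≢ = value a∈ b∈ a≢ b≢
    where
    w∈t : w ∈₃ t
    w∈t = φ₂∈image {t} ne w∈
    same : ∀ {a} → a ∈₃ t → ψ (side t) a ≡ ψ (A w) a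
    same {a} a∈ with a Fin.≟ z
    ... | no _ = refl
    ... | yes refl = cong (φ₁ ∘ end) (sym (side-spec tr spz a∈ w∈t ne))
    value : ∀ {a b} → a ∈₃ image t → b ∈₃ image t → a ≢ φ₂ w → b ≢ φ₂ w → A′ a ≡ A′ b
    value a∈ b∈ a≢ b≢ with ∈₃-map⁻ (ψ (side t)) t a∈ | ∈₃-map⁻ (ψ (side t)) t b∈
    ... | a , a∈t , refl | b , b∈t , refl =
      trans (cong A′ (same a∈t)) (trans (sp w∈t a∈t b∈t (λ { refl → a≢ (ψ-φ₂ ne) }) (λ { refl → b≢ (ψ-φ₂ ne) }))
        (cong A′ (sym (same b∈t))))

  Separated-φ₁ : ∀ {u A′} → interior u → Separated H (φ₁ u) A′ → Separated G₁ u (A′ ∘ φ₁)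
  Separated-φ₁ {u} {A′} int (p , q) = pull p , pull q
    where
    pull : ∀ {b} → (∃ λ h → Adj H (φ₁ u) h × A′ h ≡ b) → ∃ λ w → Adj G₁ u w × A′ (φ₁ w) ≡ b
    pull (h , a , e) with view h
    ... | one v = v , proj₁ (φ₁-adj⁻ a) , e
    ... | two w ne = contradiction (proj₂ (φ₁₂-adj⁻ ne a)) (int (A w))

  Separated-φ₂ : ∀ {w A′} → w ≢ z → Separated H (φ₂ w) A′ → Separated G₂ w (A′ ∘ ψ (A w))
  Separated-φ₂ {w} {A′} ne (p , q) = pull p , pull q
    where
    pull : ∀ {b} → (∃ λ h → Adj H (φ₂ w) h × A′ h ≡ b) → ∃ λ v → Adj G₂ w v × A′ (ψ (A w) v) ≡ b
    pull (h , a , e) with φ₂-neighbour ne a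
    ... | v , refl , wv = v , wv , e

  noE-count : ∀ {k} {K : Triple (Fin (n G₁)) → Set} → ¬ AtLeast k (λ t → Tri G₁ t × NoE G₁ x y t × K t) →
              ¬ AtLeast (12 + k) (λ t → Tri G₁ t × K t)
  noE-count few m = few (AtLeast-NoE G₁ B₁.thin xy m)

  module _ (M₁ : Embeddable G₁) (M₂ : Embeddable G₂) where

    private
      module M₁ = Embeddable M₁
      module M₂ = Embeddable M₂

    embed₁ : ¬ AtLeast 13 (λ t → Tri G₁ t × NoE G₁ x y t × ⊤) → GoodEmbedding G₁
    embed₁ few = M₁.whole λ m → noE-count few (AtLeast-⇒ (_, tt) m)

    comp-whole : ¬ AtLeast 25 (Tri H) → GoodEmbedding H
    comp-whole few = Glue.glued C E₁ (proj₁ E₂) (proj₂ E₂)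
      where
      E₁ : GoodEmbedding G₁
      -- 13 triples of `G₁ - xy` and the 12 guaranteed after splitting `G₂` would make 25; the next
      -- count is the same with the parts exchanged.
      E₁ = embed₁ λ m → few (AtLeast-⇒ proj₁ (combine {K₁ = λ _ → ⊤} {K₂ = λ _ → ⊤} {K = λ _ → ⊤}
        (λ _ _ → tt) (λ _ _ _ → tt) m (B₂.sp⊤ z A A-ne₁ A-ne₂)))
      E₂ : Σ (GoodEmbedding G₂) λ E → Consecutive E z A
      E₂ = M₂.split z A (A-ne₁ , A-ne₂) λ m → few (AtLeast-⇒ proj₁ (combine {K₁ = λ _ → ⊤} {K₂ = λ _ → ⊤} {K = λ _ → ⊤}
        (λ _ _ → tt) (λ _ _ _ → tt) (B₁.noE⊤ xy) (AtLeast-⇒ (λ (tr , sp) → tr , sp , tt) m)))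

    Splittable : Fin (n H) → (Fin (n H) → Bool) → Set₁
    Splittable v A′ = Separated H v A′ → ¬ AtLeast 13 (λ t → Tri H t × Sp H v A′ t) → Σ (GoodEmbedding H) λ E → Consecutive E v A′

    -- The two triangles guaranteed in `G₁ - xy` miss `φ₂ w` and exhaust the allowance. So no
    -- triangle of `G₂` survives the splittings of both `z` and `w`, which is the situation of
    -- `split₂`.
    split-φ₂ : ∀ {w} → w ≢ z → ∀ A′ → Splittable (φ₂ w) A′
    split-φ₂ {w} ne A′ sep few = glue E₂
      where
      E₁ : GoodEmbedding G₁
      E₁ = embed₁ λ m → few (left {K₁ = λ _ → ⊤} (λ _ _ w∈ → contradiction w∈ (φ₂∉φ₁ ne)) m)
      E₂ : Σ (GoodEmbedding G₂) λ E → Consecutive E z A × Consecutive E w (A′ ∘ ψ (A w))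
      E₂ = M₂.split₂ z A w _ (A-ne₁ , A-ne₂) (Separated-φ₂ {A′ = A′} ne sep)
        λ m → few (combine {K₁ = λ _ → ⊤} {K₂ = Sp G₂ w (A′ ∘ ψ (A w))} (λ _ _ w∈ → contradiction w∈ (φ₂∉φ₁ ne))
          (λ {t} tr spz sp → Sp-φ₂ {A′ = A′} {t} ne tr spz sp) (B₁.noE⊤ xy) m)
      glue : (Σ (GoodEmbedding G₂) λ E → Consecutive E z A × Consecutive E w (A′ ∘ ψ (A w))) →
             Σ (GoodEmbedding H) λ E → Consecutive E (φ₂ w) A′
      glue (E₂ , K , K₂) = Glue.glued C E₁ E₂ K , GlueConsecutive.φ₂-consecutive C E₁ E₂ K A′ ne K₂

    -- The survivors in `G₂` miss `φ₁ u` and exhaust the allowance, so no triangle of `G₁ - xy`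
    -- survives the splitting of `u`. Restoring `xy` adds at most two triangles, which is what
    -- `split` allows for `G₁`.
    split-interior : ∀ {u} → interior u → ∀ A′ → Splittable (φ₁ u) A′
    split-interior {u} int A′ sep few = glue E₁ E₂
      where
      u∉image : ∀ {t} → ¬ φ₁ u ∈₃ image t
      u∉image {t} h = int (side t) (proj₂ (φ₁∈image {t} h))
      E₁ : Σ (GoodEmbedding G₁) λ E → Consecutive E u (A′ ∘ φ₁)
      E₁ = M₁.split u _ (Separated-φ₁ {A′ = A′} int sep)
        (noE-count λ m → few (combine {K₁ = Sp G₁ u (A′ ∘ φ₁)} {K₂ = λ _ → ⊤}
          (λ {t} _ → Sp-φ₁ {A′ = A′} {t}) (λ {t} _ _ _ h → contradiction h (u∉image {t})) m (B₂.sp⊤ z A A-ne₁ A-ne₂)))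
      E₂ : Σ (GoodEmbedding G₂) λ E → Consecutive E z A
      E₂ = M₂.split z A (A-ne₁ , A-ne₂) λ m → few (right {K₂ = λ _ → ⊤} (λ {t} _ _ _ h → contradiction h (u∉image {t}))
        (AtLeast-⇒ (λ (tr , sp) → tr , sp , tt) m))
      glue : (Σ (GoodEmbedding G₁) λ E → Consecutive E u (A′ ∘ φ₁)) → (Σ (GoodEmbedding G₂) λ E → Consecutive E z A) →
             Σ (GoodEmbedding H) λ E → Consecutive E (φ₁ u) A′
      glue (E₁ , K₁) (E₂ , K) = Glue.glued C E₁ E₂ K , GlueConsecutive.interior-consecutive C E₁ E₂ K A′ int K₁

    -- `u` can be neither `x` nor `y`, since a triangle of `G₁` that avoids this vertex would
    -- survive both splittings. For interior `u`, `split` applies to `G₁` after restoring `xy`, and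
    -- `split₂` to `G₂`.
    split-both : ∀ {u w} → w ≢ z → ∀ A′ A″ → Separated H (φ₁ u) A′ → Separated H (φ₂ w) A″ →
      ¬ AtLeast 1 (λ t → Tri H t × Sp H (φ₁ u) A′ t × Sp H (φ₂ w) A″ t) →
      Σ (GoodEmbedding H) λ E → Consecutive E (φ₁ u) A′ × Consecutive E (φ₂ w) A″
    split-both {u} {w} ne A′ A″ sep′ sep″ few with caseOn u
    ... | is-x refl = contradiction (left {K₁ = Avoid G₁ x}
          (λ _ av → (λ h → contradiction (∈₃-φ₁ h) av) , λ h → contradiction h (φ₂∉φ₁ ne))
          (AtLeast-weaken (s≤s z≤n) (AtLeast-⇒ (λ (tr , av) → tr , (λ (p , _) → av p) , av) (B₁.avoid x)))) few
    ... | is-y refl = contradiction (left {K₁ = Avoid G₁ y}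
          (λ _ av → (λ h → contradiction (∈₃-φ₁ h) av) , λ h → contradiction h (φ₂∉φ₁ ne))
          (AtLeast-weaken (s≤s z≤n) (AtLeast-⇒ (λ (tr , av) → tr , (λ (_ , p) → av p) , av) (B₁.avoid y)))) few
    ... | is-interior int = glue E₁ E₂
      where
      E₁ : Σ (GoodEmbedding G₁) λ E → Consecutive E u (A′ ∘ φ₁)
      E₁ = M₁.split u _ (Separated-φ₁ {A′ = A′} int sep′)
        (noE-count λ m → few (left {K₁ = Sp G₁ u (A′ ∘ φ₁)}
          (λ {t} _ sp → Sp-φ₁ {A′ = A′} {t} sp , λ h → contradiction h (φ₂∉φ₁ ne)) m))
      E₂ : Σ (GoodEmbedding G₂) λ E → Consecutive E z A × Consecutive E w (A″ ∘ ψ (A w))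
      E₂ = M₂.split₂ z A w _ (A-ne₁ , A-ne₂) (Separated-φ₂ {A′ = A″} ne sep″)
        λ m → few (right {K₂ = Sp G₂ w (A″ ∘ ψ (A w))}
          (λ {t} tr spz sp → (λ h → contradiction (proj₂ (φ₁∈image {t} h)) (int (side t))) , Sp-φ₂ {A′ = A″} {t} ne tr spz sp) m)
      glue : (Σ (GoodEmbedding G₁) λ E → Consecutive E u (A′ ∘ φ₁)) →
             (Σ (GoodEmbedding G₂) λ E → Consecutive E z A × Consecutive E w (A″ ∘ ψ (A w))) →
             Σ (GoodEmbedding H) λ E → Consecutive E (φ₁ u) A′ × Consecutive E (φ₂ w) A″
      glue (E₁ , K₁) (E₂ , K , K₂) = Glue.glued C E₁ E₂ K ,
        GlueConsecutive.interior-consecutive C E₁ E₂ K A′ int K₁ ,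
        GlueConsecutive.φ₂-consecutive C E₁ E₂ K A″ ne K₂

    -- The two vertices must come from different parts, for otherwise the other part has a triangle
    -- that avoids both.
    comp-split₂ : ∀ v A′ w A″ → Separated H v A′ → Separated H w A″ →
      ¬ AtLeast 1 (λ t → Tri H t × Sp H v A′ t × Sp H w A″ t) →
      Σ (GoodEmbedding H) λ E → Consecutive E v A′ × Consecutive E w A″
    comp-split₂ v A′ w A″ sep′ sep″ few with view v | view w
    ... | one u | two w ne = split-both ne A′ A″ sep′ sep″ few
    ... | two w ne | one u with split-both {u} ne A″ A′ sep″ sep′ (λ m → few (AtLeast-⇒ (λ (tr , p , q) → tr , q , p) m))
    ...   | E , p , q = E , q , p
    comp-split₂ v A′ w A″ sep′ sep″ few | one u | one u′ = contradiction
      (right {K₂ = Avoid G₂ z}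
        (λ {t} _ _ av → (λ h → contradiction (proj₁ (φ₁∈image {t} h)) av) , λ h → contradiction (proj₁ (φ₁∈image {t} h)) av)
        (AtLeast-weaken (s≤s z≤n) (AtLeast-⇒ (λ (tr , av) → tr , Avoid⇒Sp G₂ av , av) (B₂.avoid z)))) few
    comp-split₂ v A′ w A″ sep′ sep″ few | two w₁ n₁ | two w₂ n₂ = contradiction
      (left {K₁ = λ _ → ⊤} (λ _ _ → (λ h → contradiction h (φ₂∉φ₁ n₁)) , λ h → contradiction h (φ₂∉φ₁ n₂))
        (AtLeast-weaken (s≤s z≤n) (B₁.noE⊤ xy))) few

  -- In each K₄ the triangle off the merged vertex accounts for 6 triples, which exhausts the
  -- allowance of 12. So `A′` must break every triangle at the merged vertex, and this determines
  -- how it separates the neighbours.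
  module SplitX (k₁ : IsK4 G₁) (k₂ : IsK4 G₂) (A′ : Fin (n H) → Bool) (sep : Separated H (φ₁ x) A′)
    (few : ¬ AtLeast 13 (λ t → Tri H t × Sp H (φ₁ x) A′ t)) where

    adjacent₂ : ∀ {u v} → u ≢ v → Adj G₂ u v
    adjacent₂ {u} {v} = Equivalence.from (proj₂ k₂ u v)

    adjacent₁ : ∀ {u v} → u ≢ v → Adj G₁ u v
    adjacent₁ {u} {v} = Equivalence.from (proj₂ k₁ u v)

    -- Otherwise the triangle `x a b`, which does not use the edge `xy`, would survive as well.
    opposite₁ : ∀ {a b} → a ≢ x → b ≢ x → a ≢ b → a ≢ y → b ≢ y → A′ (φ₁ a) ≢ A′ (φ₁ b)
    opposite₁ {a} {b} a≢x b≢x a≢b a≢y b≢y e = few (combine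
      {K₁ = Sp G₁ x (A′ ∘ φ₁)} {K₂ = Avoid G₂ z}
      (λ {t} _ → Sp-φ₁ {A′ = A′} {t}) (λ {t} _ _ av h → contradiction (proj₁ (φ₁∈image {t} h)) av)
      (AtLeast-cons {G = G₁} {v = x} {P = Tri G₁}
        (λ tr av → tr , Avoid⇒NoE G₁ av , λ h → contradiction h av)
        {t = x , a , b} (1st refl)
        ( (adjacent₁ (a≢x ∘ sym) , adjacent₁ a≢b , adjacent₁ (b≢x ∘ sym))
        , (λ { (_ , 1st q) → x≢y (sym q) ; (_ , 2nd q) → a≢y (sym q) ; (_ , 3rd q) → b≢y (sym q) })
        , λ _ {_} {_} p q p≢ q≢ → trans (at-a p p≢) (sym (at-a q q≢)) )
        (B₁.avoid x))
      (AtLeast-⇒ (λ (tr , av) → tr , Avoid⇒Sp G₂ av , av) (B₂.avoid z)))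
      where
      at-a : ∀ {c} → c ∈₃ (x , a , b) → c ≢ x → A′ (φ₁ c) ≡ A′ (φ₁ a)
      at-a (1st refl) ne = contradiction refl ne
      at-a (2nd refl) ne = refl
      at-a (3rd refl) ne = sym e

    -- Two neighbours of `z` in the first part form with `z` a triangle that survives the
    -- composition and becomes a triangle at `x`, so `A′` has to break it.
    opposite₂ : ∀ {a b} → a ≢ z → b ≢ z → a ≢ b → A a ≡ true → A b ≡ true → A′ (φ₂ a) ≢ A′ (φ₂ b)
    opposite₂ {a} {b} a≢z b≢z a≢b Aa Ab e = few (combine
      {K₁ = Avoid G₁ x} {K₂ = λ t → Avoid G₂ z t ⊎ t ≡ (z , a , b)}
      (λ {t} _ av h → contradiction (∈₃-φ₁ h) av) good
      (AtLeast-⇒ (λ (tr , av) → tr , Avoid⇒NoE G₁ av , av) (B₁.avoid x))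
      (AtLeast-cons {G = G₂} {v = z} {P = Tri G₂}
        (λ tr av → tr , Avoid⇒Sp G₂ av , inj₁ av)
        {t = z , a , b} (1st refl)
        ( (adjacent₂ (a≢z ∘ sym) , adjacent₂ a≢b , adjacent₂ (b≢z ∘ sym))
        , (λ _ {_} {_} p q p≢ q≢ → trans (at-A p p≢) (sym (at-A q q≢)))
        , inj₂ refl )
        (B₂.avoid z)))
      where
      at-A : ∀ {c} → c ∈₃ (z , a , b) → c ≢ z → A c ≡ true
      at-A (1st refl) ne = contradiction refl ne
      at-A (2nd refl) ne = Aa
      at-A (3rd refl) ne = Ab
      side≡ : side (z , a , b) ≡ true
      side≡ with z Fin.≟ z
      ... | yes _ = Aa
      ... | no ne = contradiction refl ne
      value : ∀ {h} → h ∈₃ image (z , a , b) → h ≢ φ₁ x → A′ h ≡ A′ (φ₂ a)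
      value (1st refl) ne = contradiction (trans (ψ-z _) (cong (φ₁ ∘ end) side≡)) ne
      value (2nd refl) ne = cong A′ (ψ-φ₂ a≢z)
      value (3rd refl) ne = trans (cong A′ (ψ-φ₂ b≢z)) (sym e)
      good : ∀ {t} → Tri G₂ t → Sp G₂ z A t → Avoid G₂ z t ⊎ t ≡ (z , a , b) → Sp H (φ₁ x) A′ (image t)
      good {t} _ _ (inj₁ av) h = contradiction (proj₁ (φ₁∈image {t} h)) av
      good _ _ (inj₂ refl) _ p q p≢ q≢ = trans (value p p≢) (sym (value q q≢))

    cubic₁ : CubicEmbedding G₁
    cubic₁ with frameAt₂ G₁ k₁ x≢y
    ... | _ , F = K4-cubic F

    Result : Set₁
    Result = Σ (GoodEmbedding H) λ E → Consecutive E (φ₁ x) A′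

    private
      E₁ = CubicEmbedding.E cubic₁
      module E₁ = GoodEmbedding E₁

    module _ (cubic₂ : CubicEmbedding G₂) where

      private
        module Q₂ = CubicEmbedding cubic₂
        module E₂ = GoodEmbedding Q₂.E

      K : Consecutive Q₂.E z A
      K = Q₂.cubic-consecutive z A A-ne₁ A-ne₂

      private
        module K = Consecutive K

      open Glue C E₁ Q₂.E K using (first; first-tl; first-A; glued)
      open GlueConsecutive C E₁ Q₂.E K A′

      module Cu = Cubic (CubicEmbedding.rot³ cubic₁)

      opposite-st : A′ (φ₁ (E₁.hd Cu.t)) ≡ not (A′ (φ₁ (E₁.hd Cu.s)))
      opposite-st = ≢⇒not (opposite₁ (E₁.hd≢tl Cu.tl-t) (E₁.hd≢tl Cu.tl-s) (apart Cu.tl-t Cu.tl-s (E₁.rot≢ _))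
        (λ e → not-y Cu.tl-t (proj₂ Cu.kept-t) e) (λ e → not-y Cu.tl-s (proj₂ Cu.kept-s) e))
        where
        open Removal₂ E₁.D↔ (Glue.d C E₁ Q₂.E K) (Glue.d≢ C E₁ Q₂.E K) using (ι; ι≢)
        apart : ∀ {d e} → E₁.tl d ≡ x → E₁.tl e ≡ x → d ≢ e → E₁.hd d ≢ E₁.hd e
        apart p q ne r = ne (E₁.dart-inj (trans p (sym q)) r)
        not-y : ∀ {d i} → E₁.tl d ≡ x → ι i ≡ d → E₁.hd d ≢ y
        not-y {i = i} p refl q = ι≢ true (E₁.dart-inj (trans p (sym (proj₁ (proj₂ (E₁.dart-sur xy)))))
          (trans q (sym (proj₂ (proj₂ (E₁.dart-sur xy))))))

      result₃ : (∀ {a b} → a ≢ z → b ≢ z → A a ≡ true → A b ≡ true → a ≡ b) → Result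
      result₃ unique = glued , Cu.x-consecutive₃
        (E₂.dart-inj (trans (first-tl true) (sym (K.last-tl true)))
          (unique (E₂.hd≢tl (first-tl true)) (E₂.hd≢tl (K.last-tl true)) (first-A true) (K.last-A true)))
        (proj₁ sep) (proj₂ sep)

      result₄ : ∀ {a b e} → E₂.tl e ≡ z → E₂.hd e ≡ a → E₂.hd (E₂.rot e) ≡ b →
        (∀ {c} → c ≢ z → A c ≡ true → c ≡ a ⊎ c ≡ b) → A a ≡ true → A b ≡ true →
        A′ (φ₂ a) ≡ not (A′ (φ₁ (E₁.hd Cu.s))) → A′ (φ₂ b) ≡ A′ (φ₁ (E₁.hd Cu.s)) → Result
      result₄ {a} {b} {e} te refl refl only Aa Ab va vb = glued ,
        Cu.x-consecutive₄ (trans (cong E₂.rot first≡) (sym last≡))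
          (λ q → E₂.rot≢ e (trans (sym last≡) (trans (sym q) first≡))) opposite-st
          (trans (cong (A′ ∘ φ₂ ∘ E₂.hd) first≡) va) (trans (cong (A′ ∘ φ₂ ∘ E₂.hd) last≡) vb)
        where
        tr : E₂.tl (E₂.rot e) ≡ z
        tr = trans (E₂.Rot.invariant e) te
        rot-inj : ∀ {p q} → E₂.rot p ≡ E₂.rot q → p ≡ q
        rot-inj {p} {q} r = trans (sym (Q₂.rot³ p)) (trans (cong (E₂.rot ∘ E₂.rot) r) (Q₂.rot³ q))
        last≡ : K.last true ≡ E₂.rot e
        last≡ with only (E₂.hd≢tl (K.last-tl true)) (K.last-A true)
        ... | inj₂ q = E₂.dart-inj (trans (K.last-tl true) (sym tr)) q
        ... | inj₁ q with E₂.dart-inj (trans (K.last-tl true) (sym te)) q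
        ... | r with trans (sym (K.next-A true)) (trans (cong (A ∘ E₂.hd ∘ E₂.rot) r) Ab)
        ... | ()
        first≡ : first true ≡ e
        first≡ with only (E₂.hd≢tl (first-tl true)) (first-A true)
        ... | inj₁ q = E₂.dart-inj (trans (first-tl true) (sym te)) q
        ... | inj₂ q with rot-inj (E₂.dart-inj (trans (first-tl true) (sym tr)) q)
        ... | r with trans (sym (K.last-A false)) (trans (cong (A ∘ E₂.hd) r) Aa)
        ... | ()

      s-side : Bool
      s-side = A′ (φ₁ (E₁.hd Cu.s))

    -- The mirror image of the embedding of K₄ is used if the first one lists the two neighbours in the wrong order.
    split-x : Result
    split-x = go A-ne₁ A-ne₂
      where
      go : (∃ λ w → Adj G₂ z w × A w ≡ true) → (∃ λ w → Adj G₂ z w × A w ≡ false) → Result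
      go (w₀ , zw₀ , A₀) (w₁ , zw₁ , A₁) = decide (A (ν 3F)) refl
        where
        w₀≢w₁ : w₀ ≢ w₁
        w₀≢w₁ refl with trans (sym A₀) A₁
        ... | ()
        F : Frame G₂ z w₀ w₁
        F = frame G₂ k₂ (Adj-≢ G₂ zw₀) (Adj-≢ G₂ zw₁) w₀≢w₁
        open Frame F
        only : ∀ {c} → c ≢ z → A c ≡ true → c ≡ w₀ ⊎ c ≡ ν 3F
        only {c} ne Ac with sur c
        ... | 0F , refl = contradiction ν₀ ne
        ... | 1F , refl = inj₁ ν₁
        ... | 3F , refl = inj₂ refl
        ... | 2F , refl with trans (sym Ac) (trans (cong A ν₂) A₁)
        ... | ()
        w₂ : Fin (n G₂)
        w₂ = ν 3F
        w₀≢w₂ : w₀ ≢ w₂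
        w₀≢w₂ e with inj (trans ν₁ e)
        ... | ()
        w₂≢z : w₂ ≢ z
        w₂≢z e with inj (trans e (sym ν₀))
        ... | ()
        w₀≢z : w₀ ≢ z
        w₀≢z e = Adj-≢ G₂ zw₀ (sym e)
        -- The frame sends 0, 1, 2 to `z`, `a`, `b`, and the rotation at 0 passes from 1 to 2, so
        -- `b` follows `a` around `z`. The dart `s` belongs to `G₁`; its side is therefore the same
        -- for either drawing of `G₂`.
        ordered : ∀ {a b} → z ≢ a → z ≢ b → a ≢ b → (∀ {c} → c ≢ z → A c ≡ true → c ≡ a ⊎ c ≡ b) → A a ≡ true → A b ≡ true →
          A′ (φ₂ a) ≢ s-side (K4-cubic F) → A′ (φ₂ b) ≡ s-side (K4-cubic F) → Result
        ordered za zb ab only Aa Ab va vb =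
          result₄ (K4-cubic F′) {e = 0F , 0F} (Frame.ν₀ F′) (Frame.ν₁ F′) (Frame.ν₂ F′) only Aa Ab (≢⇒not va) vb
          where F′ = frame G₂ k₂ za zb ab
        decide : ∀ b → A (ν 3F) ≡ b → Result
        decide false A₂ = result₃ (K4-cubic F) λ a≢ b≢ Aa Ab → trans (single a≢ Aa) (sym (single b≢ Ab))
          where
          single : ∀ {c} → c ≢ z → A c ≡ true → c ≡ w₀
          single ne Ac with only ne Ac
          ... | inj₁ e = e
          ... | inj₂ refl with trans (sym Ac) A₂
          ... | ()
        decide true A₂ with A′ (φ₂ w₂) Bool.≟ s-side (K4-cubic F)
        ... | yes e = ordered (w₀≢z ∘ sym) (w₂≢z ∘ sym) w₀≢w₂ only A₀ A₂
                (λ e′ → opposite₂ w₀≢z w₂≢z w₀≢w₂ A₀ A₂ (trans e′ (sym e))) e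
        ... | no ne = ordered (w₂≢z ∘ sym) (w₀≢z ∘ sym) (w₀≢w₂ ∘ sym) (λ n Ac → [ inj₂ , inj₁ ]′ (only n Ac)) A₂ A₀ ne
                (trans (≢⇒not (opposite₂ w₀≢z w₂≢z w₀≢w₂ A₀ A₂))
                  (trans (cong not (≢⇒not ne)) (Bool.not-involutive _)))

K4-or-avoid : ∀ {G} → Ore4 G → IsK4 G ⊎ (∀ v → AtLeast 12 (λ t → Tri G t × Avoid G v t))
K4-or-avoid (base k) = inj₁ k
K4-or-avoid (comp O₁ O₂ C) = inj₂ (comp-avoid (ore-bounds O₁) (ore-bounds O₂) C)

module _ {G₁ G₂ H : Graph} (O₁ : Ore4 G₁) (O₂ : Ore4 G₂) where

  private
    B₁ = ore-bounds O₁
    B₂ = ore-bounds O₂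

  -- Triangles that avoid `x` in `G₁` or `z` in `G₂` survive any splitting of the merged vertex. A
  -- composite part would supply 12 such triples and the other part 6; these 18 = 13 + 5 are too
  -- many, so both parts are K₄.
  split-end : (C : OreComp G₁ G₂ H) → ∀ A′ → let v = OreComp.φ₁ C (OreComp.x C) in Separated H v A′ →
    ¬ AtLeast 13 (λ t → Tri H t × Sp H v A′ t) → Σ (GoodEmbedding H) λ E → Consecutive E v A′
  split-end C A′ sep few = SplitX.split-x C B₁ B₂ k₁ k₂ A′ sep few
    where
    open Comp C
    combined : ∀ {i j} → AtLeast i (λ t → Tri G₁ t × Avoid G₁ x t) → AtLeast j (λ t → Tri G₂ t × Avoid G₂ z t) →
               AtLeast (i + j) (λ t → Tri H t × Sp H (φ₁ x) A′ t)
    combined p q = combine {K₁ = Avoid G₁ x} {K₂ = Avoid G₂ z}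
      (λ {t} _ av h → contradiction (∈₃-φ₁ h) av) (λ {t} _ _ av h → contradiction (proj₁ (φ₁∈image {t} h)) av)
      (AtLeast-⇒ (λ (tr , av) → tr , Avoid⇒NoE G₁ av , av) p) (AtLeast-⇒ (λ (tr , av) → tr , Avoid⇒Sp G₂ av , av) q)
    k₁ : IsK4 G₁
    k₁ with K4-or-avoid O₁
    ... | inj₁ k = k
    ... | inj₂ av = contradiction (AtLeast-weaken (ℕ.m≤m+n 13 5) (combined (av x) (Bounds.avoid B₂ z))) few
    k₂ : IsK4 G₂
    k₂ with K4-or-avoid O₂
    ... | inj₁ k = k
    ... | inj₂ av = contradiction (AtLeast-weaken (ℕ.m≤m+n 13 5) (combined (Bounds.avoid B₁ x) (av z))) few

  comp-embeddable : OreComp G₁ G₂ H → Embeddable G₁ → Embeddable G₂ → Embeddable H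
  comp-embeddable C M₁ M₂ = record
    { whole = comp-whole C B₁ B₂ M₁ M₂ ; split = λ v → split v (view v) ; split₂ = comp-split₂ C B₁ B₂ M₁ M₂ }
    where
    open Comp C
    split : ∀ v → VertexView v → ∀ A′ → Splittable C B₁ B₂ M₁ M₂ v A′
    split _ (two w ne) = split-φ₂ C B₁ B₂ M₁ M₂ ne
    split _ (one u) with caseOn u
    ... | is-x refl = split-end C
    ... | is-y refl = split-end (swapOre C)
    ... | is-interior int = split-interior C B₁ B₂ M₁ M₂ int

ore-embeddable : ∀ {G} → Ore4 G → Embeddable G
ore-embeddable (base k) = K4-embeddable k
ore-embeddable (comp O₁ O₂ C) = comp-embeddable O₁ O₂ C (ore-embeddable O₁) (ore-embeddable O₂)

-- From labelled faces to face counts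

module _ {D : Set} (π : D → D) where

  iter-shift : ∀ j d → iter π j (π d) ≡ π (iter π j d)
  iter-shift zero d = refl
  iter-shift (suc j) d = cong π (iter-shift j d)

  iter-+ : ∀ i j d → iter π (i + j) d ≡ iter π i (iter π j d)
  iter-+ zero j d = refl
  iter-+ (suc i) j d = cong π (iter-+ i j d)

  iter-period : ∀ {p d} → iter π p d ≡ d → ∀ j → iter π (j * p) d ≡ d
  iter-period q zero = refl
  iter-period {p} {d} q (suc j) = trans (iter-+ p (j * p) d) (trans (cong (iter π p) (iter-period q j)) q)

  Star⇒iter : ∀ {d e} → Star π d e → ∃ λ j → iter π j d ≡ e
  Star⇒iter ε = 0 , refl
  Star⇒iter (d ◅ s) with Star⇒iter s
  ... | j , q = suc j , trans (sym (iter-shift j d)) q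

  module _ {L : Set} {label : D → L} (cyclic : Cyclic π label) where
    open Cyclic cyclic

    iter-invariant : ∀ j d → label (iter π j d) ≡ label d
    iter-invariant zero d = refl
    iter-invariant (suc j) d = trans (invariant _) (iter-invariant j d)

    -- One less than a period of `d`, because the return path starts at `π d`.
    period : D → ℕ
    period d = proj₁ (Star⇒iter (return d))

    iter-suc-period : ∀ d → iter π (suc (period d)) d ≡ d
    iter-suc-period d = trans (sym (iter-shift (period d) d)) (proj₂ (Star⇒iter (return d)))

    π-injective : ∀ {d e} → π d ≡ π e → d ≡ e
    π-injective {d} {e} q = trans (sym at-d) (trans (sym (iter-shift N d)) (trans (cong (iter π N) q) (trans (iter-shift N e) at-e)))
      where
      N : ℕ
      -- `suc N` is the product of the periods of `d` and `e`, so `iter π N` undoes `π` on both.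
      N = period d + period e * suc (period d)
      at-d : iter π (suc N) d ≡ d
      at-d = iter-period {suc (period d)} (iter-suc-period d) (suc (period e))
      at-e : iter π (suc N) e ≡ e
      at-e = subst (λ i → iter π i e ≡ e) (ℕ.*-comm (suc (period d)) (suc (period e)))
        (iter-period {suc (period e)} (iter-suc-period e) (suc (period d)))

    π⁻¹ : D → D
    π⁻¹ d = iter π (period d) d

    π-π⁻¹ : ∀ d → π (π⁻¹ d) ≡ d
    π-π⁻¹ = iter-suc-period

    π⁻¹-π : ∀ d → π⁻¹ (π d) ≡ d
    π⁻¹-π d = π-injective (π-π⁻¹ (π d))

least : ∀ {m} {P : Fin m → Set} → Decidable P → ∃ P → ∃ λ i → P i × (∀ {j} → P j → toℕ i ≤ toℕ j)
least {zero} P? (() , _)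
least {suc m} {P} P? (i , p) with P? zero
... | yes p₀ = zero , p₀ , λ _ → z≤n
... | no np₀ with least (P? ∘ suc) (pred i p)
  where
  pred : ∀ i → P i → ∃ λ j → P (suc j)
  pred zero p = contradiction p np₀
  pred (suc j) p = j , p
... | j , q , min = suc j , q , λ { {zero} r → contradiction r np₀ ; {suc i} r → s≤s (min r) }

-- `faceCount` inspects only the first `suc m` iterates. They cover the orbit: among the iterates 0
-- to `suc m` two coincide, and cutting out the part between them lowers the exponent `j`.
iter-below : ∀ {m} (φ : Fin (suc m) → Fin (suc m)) d j → ∃ λ i → i < suc m × iter φ i d ≡ iter φ j d
iter-below {m} φ d = <-rec _ go
  where
  go : ∀ j → (∀ {i} → i < j → ∃ λ h → h < suc m × iter φ h d ≡ iter φ i d) → ∃ λ i → i < suc m × iter φ i d ≡ iter φ j d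
  go j rec with j ℕ.<? suc m
  ... | yes j< = j , j< , refl
  ... | no j≮ with Fin.pigeonhole (ℕ.n<1+n (suc m)) (λ i → iter φ (toℕ i) d)
  ... | a , b , a<b , q with rec smaller
    where
    b≤j : toℕ b ≤ j
    b≤j = ℕ.≤-trans (ℕ.≤-pred (Fin.toℕ<n b)) (ℕ.≮⇒≥ j≮)
    smaller : (j ∸ toℕ b) + toℕ a < j
    smaller = subst ((j ∸ toℕ b) + toℕ a <_) (ℕ.m∸n+n≡m b≤j) (ℕ.+-monoʳ-< (j ∸ toℕ b) a<b)
  ... | h , h< , r = h , h< , trans r (trans (iter-+ φ (j ∸ toℕ b) (toℕ a) d)
    (trans (cong (iter φ (j ∸ toℕ b)) q) (trans (sym (iter-+ φ (j ∸ toℕ b) (toℕ b) d)) (cong (λ i → iter φ i d) (ℕ.m∸n+n≡m b≤j)))))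
    where
    b≤j : toℕ b ≤ j
    b≤j = ℕ.≤-trans (ℕ.≤-pred (Fin.toℕ<n b)) (ℕ.≮⇒≥ j≮)

sum-indicator : {A : Set} (p : A → Bool) (xs : List A) →
  sum (map (λ a → if p a then 1 else 0) xs) ≡ length (filter (λ a → p a Bool.≟ true) xs)
sum-indicator p [] = refl
sum-indicator p (a ∷ xs) with p a
... | true = cong suc (sum-indicator p xs)
... | false = sum-indicator p xs

-- The darts counted are the minima of their orbits. Two of them with the same label would be equal,
-- and the least dart with a given label is counted, so they correspond to the labels one to one.
faceCount-labels : ∀ {m k} {φ : Fin (suc m) → Fin (suc m)} {label : Fin (suc m) → Fin k} → Cyclic φ label →
  (∀ l → ∃ λ d → label d ≡ l) → faceCount (suc m) φ ≡ k
faceCount-labels {m} {k} {φ} {label} cyclic sur = trans (sum-indicator leader (allFin (suc m))) (ℕ.≤-antisym upper lower)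
  where
  open Cyclic cyclic
  leader : Fin (suc m) → Bool
  leader d = all (λ j → toℕ d ≤ᵇ toℕ (iter φ j d)) (upTo (suc m))
  leader? : ∀ d → Dec (leader d ≡ true)
  leader? d = leader d Bool.≟ true
  leader⇒least : ∀ {d} → leader d ≡ true → ∀ {e} → label d ≡ label e → toℕ d ≤ toℕ e
  leader⇒least {d} q l with Star⇒iter φ (reach l)
  ... | j , r with iter-below φ d j
  ... | i , i< , s = subst (λ e → toℕ d ≤ toℕ e) (trans s r)
    (ℕ.≤ᵇ⇒≤ _ _ (All.lookup (All.all⁺ _ (upTo (suc m)) (Equivalence.from Bool.T-≡ q)) (∈-upTo⁺ i<)))
  least⇒leader : ∀ {d} → (∀ {e} → label d ≡ label e → toℕ d ≤ toℕ e) → leader d ≡ true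
  least⇒leader {d} min = Equivalence.to Bool.T-≡ (All.all⁻ _
    (All.tabulate {xs = upTo (suc m)} λ {j} _ → ℕ.≤⇒≤ᵇ (min (sym (iter-invariant φ cyclic j d)))))
  leaders : List (Fin (suc m))
  leaders = filter leader? (allFin (suc m))
  unique-labels : ∀ {ds} → Unique ds → All (λ d → leader d ≡ true) ds → Unique (map label ds)
  unique-labels [] [] = []
  unique-labels (d∉ ∷ u) (q ∷ qs) = All.map⁺ (All.zipWith
    (λ (ne , r) l → ne (Fin.toℕ-injective (ℕ.≤-antisym (leader⇒least q l) (leader⇒least r (sym l))))) (d∉ , qs)) ∷ unique-labels u qs
  upper : length leaders ≤ k
  upper = subst₂ _≤_ (List.length-map label leaders) (List.length-tabulate id)
    (unique⊆⇒length≤ (unique-labels (Unique.filter⁺ leader? (Unique.allFin⁺ _)) (All.all-filter leader? (allFin (suc m)))) (λ _ → ∈-allFin _))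
  minimum : ∀ l → ∃ λ d → label d ≡ l × (∀ {e} → label e ≡ l → toℕ d ≤ toℕ e)
  minimum l = least (λ d → label d Fin.≟ l) (sur l)
  lower : k ≤ length leaders
  lower = subst (_≤ length leaders) (trans (List.length-map _ (allFin k)) (List.length-tabulate id))
    (unique⊆⇒length≤ {xs = map (proj₁ ∘ minimum) (allFin k)}
      (Unique.map⁺ (λ {l} {l′} q → trans (sym (proj₁ (proj₂ (minimum l)))) (trans (cong label q) (proj₁ (proj₂ (minimum l′))))) (Unique.allFin⁺ k))
      (λ d∈ → sub (∈-map⁻ _ d∈)))
    where
    sub : ∀ {d} → (∃ λ l → l ∈ allFin k × d ≡ proj₁ (minimum l)) → d ∈ leaders
    sub (l , _ , refl) = ∈-filter⁺ leader? (∈-allFin _)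
      (least⇒leader λ q → proj₂ (proj₂ (minimum l)) (trans (sym q) (proj₁ (proj₂ (minimum l)))))

module _ {D L : Set} {m : ℕ} (D↔ : D ↔ Fin m) {π : D → D} {label : D → L} (cyclic : Cyclic π label)
  {π′ : Fin m → Fin m} (π′-to : ∀ d → π′ (Inverse.to D↔ d) ≡ Inverse.to D↔ (π d)) where

  open Inverse D↔ using (to; from; strictlyInverseˡ; strictlyInverseʳ)
  open Cyclic cyclic

  transport-from : ∀ i → from (π′ i) ≡ π (from i)
  transport-from i = trans (cong (from ∘ π′) (sym (strictlyInverseˡ i))) (trans (cong from (π′-to (from i))) (strictlyInverseʳ _))

  transport-Star : ∀ {d e} → Star π d e → Star π′ (to d) (to e)
  transport-Star ε = ε
  transport-Star (d ◅ s) = to d ◅ Star-≡ (π′-to d) (transport-Star s)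

  transport-cyclic : Cyclic π′ (label ∘ from)
  transport-cyclic = record
    { invariant = λ i → trans (cong label (transport-from i)) (invariant (from i))
    ; reach = λ {i} {j} l → subst₂ (Star π′) (strictlyInverseˡ i) (strictlyInverseˡ j) (transport-Star (reach l)) }

Cyclic-map : {D L M : Set} {π : D → D} {label : D → L} (f : L → M) → (∀ {l l′} → f l ≡ f l′ → l ≡ l′) →
  Cyclic π label → Cyclic π (f ∘ label)
Cyclic-map f inj C = record { invariant = λ d → cong f (Cyclic.invariant C d) ; reach = λ q → Cyclic.reach C (inj q) }

module _ {G : Graph} (E : GoodEmbedding G) (edge : ∃ λ u → ∃ λ v → Adj G u v) where
  open GoodEmbedding E
  open Inverse D↔ using (to; from; strictlyInverseˡ; strictlyInverseʳ)

  private
    from-inj : ∀ {i j} → from i ≡ from j → i ≡ j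
    from-inj {i} {j} e = trans (sym (strictlyInverseˡ i)) (trans (cong to e) (strictlyInverseˡ j))

    rot′ rev′ φ′ : Fin m → Fin m
    rot′ = to ∘ rot ∘ from
    rev′ = to ∘ rev ∘ from
    φ′ i = rot′ (rev′ i)

    rot′-to : ∀ d → rot′ (to d) ≡ to (rot d)
    rot′-to d = cong (to ∘ rot) (strictlyInverseʳ d)

    φ′-to : ∀ d → φ′ (to d) ≡ to (rot (rev d))
    φ′-to d = trans (rot′-to (rev (from (to d)))) (cong (to ∘ rot ∘ rev) (strictlyInverseʳ d))

    rot-cyclic′ : Cyclic rot′ (tl ∘ from)
    rot-cyclic′ = transport-cyclic D↔ rot-cyclic {rot′} rot′-to

    face-cyclic′ : Cyclic φ′ (Inverse.to L↔ ∘ face ∘ from)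
    face-cyclic′ = Cyclic-map (Inverse.to L↔) to-inj (transport-cyclic D↔ face-cyclic {φ′} φ′-to)
      where
      to-inj : ∀ {l l′} → Inverse.to L↔ l ≡ Inverse.to L↔ l′ → l ≡ l′
      to-inj {l} {l′} q = trans (sym (Inverse.strictlyInverseʳ L↔ l)) (trans (cong (Inverse.from L↔) q) (Inverse.strictlyInverseʳ L↔ l′))

    face-sur′ : ∀ l → ∃ λ i → Inverse.to L↔ (face (from i)) ≡ l
    face-sur′ l with face-sur (Inverse.from L↔ l)
    ... | d , q = to d , trans (cong (Inverse.to L↔ ∘ face) (strictlyInverseʳ d))
      (trans (cong (Inverse.to L↔) q) (Inverse.strictlyInverseˡ L↔ l))

    faceCount≡ : ∀ {m} {φ : Fin m → Fin m} {label : Fin m → Fin k} → Fin m → Cyclic φ label →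
      (∀ l → ∃ λ d → label d ≡ l) → faceCount m φ ≡ k
    faceCount≡ {suc m} _ = faceCount-labels

  plane-embedding : PlaneEmbedding G
  plane-embedding = record
    { m = m ; tl = tl ∘ from ; hd = hd ∘ from
    ; dart-adj = λ i → dart-adj (from i)
    ; dart-inj = λ _ _ t h → from-inj (dart-inj t h)
    ; dart-sur = λ u v uv → let d , t , h = dart-sur uv in
        to d , trans (cong tl (strictlyInverseʳ d)) t , trans (cong hd (strictlyInverseʳ d)) h
    ; rev = rev′
    ; rev-tl = λ i → trans (cong tl (strictlyInverseʳ _)) (rev-tl _)
    ; rev-hd = λ i → trans (cong hd (strictlyInverseʳ _)) (rev-hd _)
    ; rot = rot′ ; rot⁻¹ = π⁻¹ rot′ rot-cyclic′
    ; rot-inv₁ = π-π⁻¹ rot′ rot-cyclic′ ; rot-inv₂ = π⁻¹-π rot′ rot-cyclic′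
    ; rot-tl = Cyclic.invariant rot-cyclic′
    ; rot-cyc = λ _ _ t → Star⇒iter rot′ (Cyclic.reach rot-cyclic′ t)
    ; euler = trans (cong (λ f → 2 * n G + 2 * f) (faceCount≡ dart face-cyclic′ face-sur′)) euler }
    where
    -- `faceCount` is 1 by convention if there are no darts; an edge excludes this case.
    dart : Fin m
    dart = to (proj₁ (dart-sur (proj₂ (proj₂ edge))))

  no-face-4 : ¬ HasFace4 plane-embedding
  no-face-4 (i , q , _) = no4 (from i) (trans (sym (iter-from 4)) (cong from q))
    where
    iter-from : ∀ j → from (iter φ′ j i) ≡ iter (rot ∘ rev) j (from i)
    iter-from zero = refl
    iter-from (suc j) = trans (transport-from D↔ face-cyclic {φ′} φ′-to _) (cong (rot ∘ rev) (iter-from j))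

-- The theorem

abstract
  K4-24 : ∀ {G} → IsK4 G → AtLeast 24 (Tri G)
  K4-24 {G} k with frameAt G k (subst Fin (sym (proj₁ k)) 0F)
  ... | _ , _ , F = AtLeast-⇒ proj₁ (frame-triangles G k F L
    (from-yes (allPairs? (λ s t → ¬? (≟-triple s t)) L)) (from-yes (All.all? Distinct? L)) (All.tabulate {xs = L} λ _ → tt))
    where
    L : List (Triple (Fin 4))
    L = shuffled ((0F , 1F , 2F) ∷ (0F , 1F , 3F) ∷ (0F , 2F , 3F) ∷ (1F , 2F , 3F) ∷ [])

four-triangles : ∀ {G} → Ore4 G → AtLeast 24 (Tri G)
four-triangles {G} (base k) = K4-24 {G} k
four-triangles (comp O₁ O₂ C) = ore-24 (ore-bounds O₁) (ore-bounds O₂) C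

theorem3 : ∀ (G : Graph) → Ore4 G
    → 4 ≤ triangles G × ((triangles G ≡ 4) ⇔ Pl44f G)
theorem3 G O = ℕ.*-cancelˡ-≤ 6 (AtLeast-Tri⇒≤ G (four-triangles O)) , mk⇔ to λ ((_ , _ , t) , _) → t
  where
  open Structure (ore-structure O) using (edge; connected; critical)
  to : triangles G ≡ 4 → Pl44f G
  to t = ((connected , plane-embedding E edge) , critical , t) , plane-embedding E edge , no-face-4 E edge
    where
    E : GoodEmbedding G
    -- Four triangles have exactly 24 orderings, so 25 ordered triples are impossible.
    E = Embeddable.whole (ore-embeddable O) λ m →
      ℕ.<-irrefl refl (subst (λ t → 25 ≤ 6 * t) t (AtLeast-Tri⇒≤ G m))
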